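{- A permutation $w \in \mathfrak{S}_n$ is a prism if and only if there exists an integer $i$ such that $w$ contains at least one of the following eight calibrated mesh patterns. Let $R = \{(a,2) : 0 \le a \le 4\} \cup \{(2,b) : 0 \le b \le 4\}$, $U = \{(a,b) : a \in \{0,1,2\},\ b \in \{3,4\}\}$, $D = \{(a,b) : a \in \{3,4\},\ b \in \{0,1,2\}\}$. (1) $(21, \{(0,1),(1,1),(2,1),(2,0)\})$ with $x_2 = i+1$, $y_2 = i+1$; (2) $(21, \{(1,0),(1,1),(1,2),(0,2)\})$ with $x_2 = i+1$, $y_2 = i+1$; (3) $(21, \{(0,1),(1,1),(2,1),(0,2)\})$ with $x_1 = i$, $y_1 = i$; (4) $(21, \{(1,0),(1,1),(1,2),(2,0)\})$ with $x_1 = i$, $y_1 = i$; (5) $(4123, R \cup D)$ with $x_2 = i$, $y_2 = i$; (6) $(2341, R \cup U)$ with $x_2 = i$, $y_2 = i$; (7) $(3142, R \cup U \cup D)$ with $x_2 = i$, $y_2 = i$; (8) $(2413, R \cup U \cup D)$ with $x_2 = i$, $y_2 = i$.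
   Context: Bruhat order: $\sigma_i$ swaps $i,i+1$; a reduced word of $w$ is a minimal-length word $i_1\cdots i_\ell$ with $w=\sigma_{i_1}\cdots\sigma_{i_\ell}$; $u\preceq w$ iff a reduced word of $u$ is a subword of one of $w$; $B(w)=\{u:u\preceq w\}$. A permutation $w$ is a prism if $B(w)\cong\mathbf{2}\times X$ as posets for some poset $X$, where $\mathbf{2}$ is the two-element chain. Calibrated mesh patterns: let $p \in \mathfrak{S}_k$ (written in one-line notation) and $M \subseteq \{0,\dots,k\}^2$ (cell $(a,b)$ is the unit square with lower-left corner $(a,b)$ in the grid $[0,k+1]^2$ containing the graph $\{(j,p(j))\}$ of $p$). An occurrence of $p$ in $w \in \mathfrak{S}_n$ is a choice of positions $x_1<\cdots<x_k$ such that $w(x_1)\cdots w(x_k)$ is in the same relative order as $p(1)\cdots p(k)$; let $y_1<\cdots<y_k$ be the values $\{w(x_1),\dots,w(x_k)\}$ in increasing order, and set $x_0=y_0=0$, $x_{k+1}=y_{k+1}=n+1$. Such an occurrence is an occurrence of the mesh pattern $(p,M)$ if for every $(a,b)\in M$ there is no $x$ with $x_a < x < x_{a+1}$ and $y_b < w(x) < y_{b+1}$. A calibrated mesh pattern additionally prescribes values for some of the $x_a$ (positions) and $y_b$ (values); $w$ contains it if $w$ has an occurrence of $(p,M)$ meeting those prescriptions. -}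

module Defs where

open import Data.Bool.Properties using () renaming (≤-poset to 𝟚)
open import Data.Fin using (Fin; zero; suc; toℕ; inject₁; _<_)
open import Data.Fin.Patterns using (0F; 1F; 2F; 3F; 4F)
open import Data.Fin.Permutation
  using (Permutation′; permutation; _≈_; _∘ₚ_; transpose; id; _⟨$⟩ʳ_)
open import Data.Fin.Properties using (all?; _≟_)
open import Data.Integer using (ℤ; +_; 1ℤ) renaming (_+_ to _+ℤ_)
open import Data.List using (List; []; _∷_; _++_; length; allFin; cartesianProduct)
open import Data.List.Relation.Binary.Sublist.Propositional using (_⊆_)
open import Data.List.Relation.Unary.All using (All)
import Data.Nat as ℕ
open import Data.Nat using (ℕ; pred)
open import Data.Product using (Σ; ∃; ∃₂; _×_; _,_; proj₁)
open import Data.Product.Relation.Binary.Pointwise.NonDependent using (×-poset)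
open import Data.Vec using (Vec; []; _∷_; _∷ʳ_; lookup; map)
open import Data.Vec.Membership.Propositional using (_∈_)
open import Data.Vec.Relation.Unary.Linked using (Linked)
open import Function using (_on_; _∘_; _⇔_)
open import Level using (0ℓ)
open import Relation.Binary using (Rel; Poset)
open import Relation.Binary.Bundles.Raw using (RawRelation)
open import Relation.Binary.Morphism.Structures using (IsOrderIsomorphism)
open import Relation.Binary.PropositionalEquality using (_≡_)
open import Relation.Nullary using (¬_)
open import Relation.Nullary.Decidable using (True; toWitness)

private
  variable
    n : ℕ

-- Permutations of {1,…,n} are represented on Fin n, where j : Fin n stands
-- for the number toℕ j + 1.

-- The letter j stands for σ_{toℕ j + 1}; there are n - 1 letters.
σ : Fin (pred n) → Permutation′ n
σ {ℕ.suc n} j = transpose (inject₁ j) (suc j)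

-- _∘ₚ_ applies its left argument first, so this is the usual product
-- σ_{i₁} ⋯ σ_{iₗ}, in which the rightmost factor acts first.
⟦_⟧ : List (Fin (pred n)) → Permutation′ n
⟦ [] ⟧    = id
⟦ i ∷ v ⟧ = ⟦ v ⟧ ∘ₚ σ i

record IsReducedWord (v : List (Fin (pred n))) (w : Permutation′ n) : Set where
  field
    product : ⟦ v ⟧ ≈ w
    minimal : ∀ v′ → ⟦ v′ ⟧ ≈ w → length v ℕ.≤ length v′

-- A subword is a not necessarily contiguous subsequence, which is what the
-- sublist relation _⊆_ expresses.
infix 4 _⪯_
_⪯_ : Rel (Permutation′ n) 0ℓ
u ⪯ w = ∃₂ λ a b → IsReducedWord a u × IsReducedWord b w × a ⊆ b

-- Raw, because antisymmetry and transitivity of ⪯ are theorems about this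
-- definition; they are not needed to state what an order isomorphism is.
B : Permutation′ n → RawRelation 0ℓ 0ℓ 0ℓ
B w = record
  { Carrier = ∃ (_⪯ w)
  ; _≈_     = _≈_ on proj₁
  ; _∼_     = _⪯_ on proj₁
  }

infix 4 _≅_
_≅_ : RawRelation 0ℓ 0ℓ 0ℓ → Poset 0ℓ 0ℓ 0ℓ → Set
R ≅ P = ∃ (IsOrderIsomorphism R._≈_ P._≈_ R._∼_ P._≤_)
  where
  module R = RawRelation R
  module P = Poset P

IsPrism : Permutation′ n → Set₁
IsPrism w = Σ (Poset 0ℓ 0ℓ 0ℓ) λ X → B w ≅ ×-poset 𝟚 X

-- The pair (a , c) in calibX prescribes x_a = c, and in calibY it
-- prescribes y_a = c; the index a ranges over 0, …, k + 1, with x₀ = y₀ = 0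
-- and x_{k+1} = y_{k+1} = n + 1.
record CalibratedMeshPattern : Set where
  constructor calibrated
  field
    {k}           : ℕ
    p             : Permutation′ k
    mesh          : List (Fin (ℕ.suc k) × Fin (ℕ.suc k))
    calibX calibY : List (Fin (2 ℕ.+ k) × ℤ)

-- Applied to z, the sequence 0, z₁, …, z_k, n + 1 indexed by 0, …, k + 1.
bordered : ∀ {k} → Vec (Fin n) k → Fin (2 ℕ.+ k) → ℕ
bordered {n} z = lookup (0 ∷ (map (ℕ.suc ∘ toℕ) z ∷ʳ ℕ.suc n))

-- The number represented by j lies strictly between z_a and z_{a+1}.
Between : ∀ {k} → Vec (Fin n) k → Fin (ℕ.suc k) → Fin n → Set
Between z a j =
  bordered z (inject₁ a) ℕ.< ℕ.suc (toℕ j) × ℕ.suc (toℕ j) ℕ.< bordered z (suc a)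

record Occurrence (w : Permutation′ n) (π : CalibratedMeshPattern) : Set where
  open CalibratedMeshPattern π

  field
    x y          : Vec (Fin n) k
    x-increasing : Linked _<_ x
    same-order   : ∀ i j →
      (p ⟨$⟩ʳ i < p ⟨$⟩ʳ j) ⇔ (w ⟨$⟩ʳ lookup x i < w ⟨$⟩ʳ lookup x j)
    y-increasing : Linked _<_ y
    y-values     : ∀ v → (v ∈ y) ⇔ (v ∈ map (w ⟨$⟩ʳ_) x)
    mesh-empty   : All (λ (a , b) →
      ¬ ∃ λ j → Between x a j × Between y b (w ⟨$⟩ʳ j)) mesh
    x-calibrated : All (λ (a , c) → + bordered x a ≡ c) calibX
    y-calibrated : All (λ (b , c) → + bordered y b ≡ c) calibY

infix 4 _Contains_
_Contains_ : Permutation′ n → CalibratedMeshPattern → Set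
_Contains_ = Occurrence

-- A permutation from its one-line notation and that of its inverse.
oneLine : ∀ {k} (v v⁻¹ : Vec (Fin k) k)
          {_ : True (all? λ i → lookup v (lookup v⁻¹ i) ≟ i)}
          {_ : True (all? λ i → lookup v⁻¹ (lookup v i) ≟ i)} →
          Permutation′ k
oneLine v v⁻¹ {l} {r} =
  permutation (lookup v) (lookup v⁻¹) (toWitness l) (toWitness r)

-- The numbers 1, …, k in one-line notation are the elements 0F, …, of Fin k.
21ₚ : Permutation′ 2
21ₚ = oneLine (1F ∷ 0F ∷ []) (1F ∷ 0F ∷ [])

4123ₚ 2341ₚ 3142ₚ 2413ₚ : Permutation′ 4
4123ₚ = oneLine (3F ∷ 0F ∷ 1F ∷ 2F ∷ []) (1F ∷ 2F ∷ 3F ∷ 0F ∷ [])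
2341ₚ = oneLine (1F ∷ 2F ∷ 3F ∷ 0F ∷ []) (3F ∷ 0F ∷ 1F ∷ 2F ∷ [])
3142ₚ = oneLine (2F ∷ 0F ∷ 3F ∷ 1F ∷ []) (1F ∷ 3F ∷ 0F ∷ 2F ∷ [])
2413ₚ = oneLine (1F ∷ 3F ∷ 0F ∷ 2F ∷ []) (2F ∷ 0F ∷ 3F ∷ 1F ∷ [])

R U D : List (Fin 5 × Fin 5)
R = cartesianProduct (allFin 5) (2F ∷ []) ++ cartesianProduct (2F ∷ []) (allFin 5)
U = cartesianProduct (0F ∷ 1F ∷ 2F ∷ []) (3F ∷ 4F ∷ [])
D = cartesianProduct (3F ∷ 4F ∷ []) (0F ∷ 1F ∷ 2F ∷ [])

prismPatterns : ℤ → List CalibratedMeshPattern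
prismPatterns i =
    calibrated 21ₚ ((0F , 1F) ∷ (1F , 1F) ∷ (2F , 1F) ∷ (2F , 0F) ∷ [])
      ((2F , i +ℤ 1ℤ) ∷ []) ((2F , i +ℤ 1ℤ) ∷ [])
  ∷ calibrated 21ₚ ((1F , 0F) ∷ (1F , 1F) ∷ (1F , 2F) ∷ (0F , 2F) ∷ [])
      ((2F , i +ℤ 1ℤ) ∷ []) ((2F , i +ℤ 1ℤ) ∷ [])
  ∷ calibrated 21ₚ ((0F , 1F) ∷ (1F , 1F) ∷ (2F , 1F) ∷ (0F , 2F) ∷ [])
      ((1F , i) ∷ []) ((1F , i) ∷ [])
  ∷ calibrated 21ₚ ((1F , 0F) ∷ (1F , 1F) ∷ (1F , 2F) ∷ (2F , 0F) ∷ [])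
      ((1F , i) ∷ []) ((1F , i) ∷ [])
  ∷ calibrated 4123ₚ (R ++ D) ((2F , i) ∷ []) ((2F , i) ∷ [])
  ∷ calibrated 2341ₚ (R ++ U) ((2F , i) ∷ []) ((2F , i) ∷ [])
  ∷ calibrated 3142ₚ (R ++ U ++ D) ((2F , i) ∷ []) ((2F , i) ∷ [])
  ∷ calibrated 2413ₚ (R ++ U ++ D) ((2F , i) ∷ []) ((2F , i) ∷ [])
  ∷ []

{-# OPTIONS --safe #-}

-- Write s for the transposition of i and i + 1. Given an isomorphism
-- B(w) ≅ 2 × X, the atom over the least element of X is some s, so the
-- elements above s form a copy of those not above it, and the largest w′ of
-- the latter is covered by w. Thus w = w′ t for a transposition t, and w
-- carries a single position j ≤ i to a value above i and a single position
-- k > i back. A neighbour s′ of s cannot have both s s′ and s′ s below w,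
-- since the two would lie over the same element of X; so s′ occurs only on
-- one side of s. For the two neighbours of s this says
-- (j = i or w(k) = i) and (k = i + 1 or w(j) = i + 1),
-- and according to which of these four equations hold, w contains one of
-- the eight patterns. Conversely, these conditions allow w to be written as
-- a reduced word p s q where p and q avoid s, and the letters below s occur
-- only in p or only in q, as do those above s; such factorizations are
-- unique, and B(w) ≅ 2 × (B(p) × B(q)).
--
-- Bruhat order is handled through the tableau criterion on words in
-- adjacent transpositions of ℕ: u ⪯ w iff, for all p and q, u takes no more
-- values below q at positions from p on than w does.

module Submission where

open import Defs
open import Data.Bool.Base as Bool using (Bool; true; false; b≤b; f≤t)
open import Data.Bool.Properties as Boolₚ using () renaming (≤-poset to 𝟚)
open import Data.Empty using (⊥; ⊥-elim)
open import Data.Fin.Base as Fin using (Fin; zero; suc; toℕ; inject₁)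
open import Data.Fin.Permutation using (Permutation′; _≈_; _∘ₚ_; _⟨$⟩ʳ_; _⟨$⟩ˡ_)
import Data.Fin.Permutation as Perm
open import Data.Fin.Patterns using (0F; 1F; 2F; 3F)
import Data.Fin.Properties as Finₚ
open import Data.Integer using (ℤ; 1ℤ)
import Data.Integer.Base as ℤ
open import Data.List.Properties using (length-++; unfold-reverse; filter-accept; filter-reject)
open import Data.List.Relation.Binary.Equality.Propositional using (≋⇒≡)
open import Data.List.Relation.Binary.Sublist.Heterogeneous.Properties using (toPointwise; length-mono-≤; ++⁺)
open import Data.List.Relation.Binary.Sublist.Propositional.Properties using (All-resp-⊆)
open import Data.List.Base as List using (List; []; _∷_; _++_; length)
open import Data.List.Relation.Binary.Sublist.Propositional
  using (_⊆_; []; _∷_; _∷ʳ_; ⊆-refl; ⊆-trans; minimum; from∈)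
open import Data.List.Membership.Propositional using (_∈_)
open import Data.List.Relation.Unary.All as All using (All; []; _∷_)
import Data.List.Relation.Unary.All.Properties as Allₚ
open import Data.List.Relation.Unary.Any using (Any; here; there)
import Data.List.Relation.Unary.Any.Properties as Anyₚ
import Data.List.Membership.DecPropositional as DecMembership
import Data.Product.Properties as Productₚ
import Data.Integer.Properties as ℤₚ
open import Data.Nat.Base as ℕ using (ℕ; zero; suc; pred; _+_; _≤_; _<_; z≤n; s≤s)
open import Data.Nat.Properties as ℕₚ using (≤-trans; ≤-refl; ≤-reflexive)
open import Data.Product using (Σ; ∃; ∃₂; _×_; _,_; proj₁; proj₂)
open import Data.Product.Relation.Binary.Pointwise.NonDependent using (×-poset)
open import Data.Sum as Sum using (_⊎_; inj₁; inj₂; [_,_]′)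
import Data.Vec.Base as Vec
open import Data.Vec.Base using (Vec; []; _∷_)
import Data.Vec.Membership.Propositional as Vec∈
open import Data.Vec.Membership.Propositional.Properties using (∈-lookup; ∈-map⁺)
open import Data.Vec.Properties using (lookup-map)
open import Data.Vec.Relation.Unary.Any as VecAny using ()
import Data.Vec.Relation.Unary.Any.Properties as VecAnyₚ
open import Data.Vec.Relation.Unary.Linked using (Linked; []; [-]; _∷_)
open import Data.Vec.Relation.Unary.Linked.Properties using (lookup⁺)
open import Function using (_⇔_; mk⇔; Equivalence; _∘_; case_of_)
open import Function.Definitions using (Injective; Surjective)
open import Level using (0ℓ)
open import Relation.Binary.Bundles using (Poset)
open import Relation.Binary.Definitions using (tri<; tri≈; tri>)
open import Relation.Binary.Morphism.Structures using (IsOrderIsomorphism)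
open import Relation.Binary.PropositionalEquality
  using (_≡_; _≢_; _≗_; refl; sym; trans; cong; cong₂; subst; subst₂)
open import Relation.Nullary using (¬_; Dec; yes; no; contradiction)
open import Relation.Nullary.Decidable using (dec-true; dec-false; from-yes; True; toWitness; _→-dec_; _×-dec_; _⊎-dec_)

-- Permutations are handled through their inverses because prepending the letter `i` to a word
-- composes the inverse with `sw i` on the right. This alters a single column of the table of
-- counts, so the lifting property of Bruhat order becomes an inequality about one column. Working
-- on all of ℕ keeps bounds out of it.
--
-- The four equations come from the order of letters, of which the rightmost acts first. A position
-- j < i carried above i must cross at the lower neighbour s′ and then at s, which makes s s′ a
-- subword; a position beyond i carried to a value below i makes s′ s a subword. Excluding one of
-- the two gives j = i or w(k) = i, and the upper neighbour is symmetric.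
--
-- A pattern may shade only one of the two quadrants that forbid further crossings of i. One is
-- enough: once the values at j and k are exchanged, either half says that the permutation or its
-- inverse preserves the numbers up to i.

-- Adjacent transpositions of ℕ

sw : ℕ → ℕ → ℕ
sw zero    zero          = 1
sw zero    (suc zero)    = 0
sw zero    (suc (suc x)) = suc (suc x)
sw (suc i) zero          = 0
sw (suc i) (suc x)       = suc (sw i x)

sw-involutive : ∀ i x → sw i (sw i x) ≡ x
sw-involutive zero    zero          = refl
sw-involutive zero    (suc zero)    = refl
sw-involutive zero    (suc (suc x)) = refl
sw-involutive (suc i) zero          = refl
sw-involutive (suc i) (suc x)       = cong suc (sw-involutive i x)

sw-injective : ∀ i → Injective _≡_ _≡_ (sw i)
sw-injective i {x} {y} eq =
  trans (sym (sw-involutive i x)) (trans (cong (sw i) eq) (sw-involutive i y))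

sw-i : ∀ i → sw i i ≡ suc i
sw-i zero    = refl
sw-i (suc i) = cong suc (sw-i i)

sw-1+i : ∀ i → sw i (suc i) ≡ i
sw-1+i zero    = refl
sw-1+i (suc i) = cong suc (sw-1+i i)

sw-< : ∀ {i x} → x < i → sw i x ≡ x
sw-< {suc i} {zero}  x<i       = refl
sw-< {suc i} {suc x} (s≤s x<i) = cong suc (sw-< x<i)

sw-> : ∀ {i x} → suc i < x → sw i x ≡ x
sw-> {zero}  {suc zero}    (s≤s ())
sw-> {zero}  {suc (suc x)} i<x       = refl
sw-> {suc i} {suc x}       (s≤s i<x) = cong suc (sw-> i<x)

data SwView (i : ℕ) : ℕ → Set where
  below : ∀ {x} → x < i → SwView i x
  lower : SwView i i
  upper : SwView i (suc i)
  above : ∀ {x} → suc i < x → SwView i x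

swView : ∀ i x → SwView i x
swView zero    zero          = lower
swView zero    (suc zero)    = upper
swView zero    (suc (suc x)) = above (s≤s (s≤s z≤n))
swView (suc i) zero          = below (s≤s z≤n)
swView (suc i) (suc x) with swView i x
... | below x<i = below (s≤s x<i)
... | lower     = lower
... | upper     = upper
... | above i<x = above (s≤s i<x)

sw-preserves-≤ : ∀ {i t x} → i ≢ t → x ≤ t → sw i x ≤ t
sw-preserves-≤ {i} {t} {x} i≢t x≤t with swView i x
... | below x<i = subst (_≤ t) (sym (sw-< x<i)) x≤t
... | lower     = subst (_≤ t) (sym (sw-i i)) (ℕₚ.≤∧≢⇒< x≤t i≢t)
... | upper     = subst (_≤ t) (sym (sw-1+i i)) (ℕₚ.<⇒≤ x≤t)
... | above i<x = subst (_≤ t) (sym (sw-> i<x)) x≤t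

sw-preserves-> : ∀ {i t x} → i ≢ t → t < x → t < sw i x
sw-preserves-> {i} {t} {x} i≢t t<x = ℕₚ.≰⇒> λ le →
  ℕₚ.<⇒≱ t<x (subst (_≤ t) (sw-involutive i x) (sw-preserves-≤ i≢t le))

-- Bruhat order on permutations of ℕ

-- The indicator of `p ≤ x`, as a number so that counts are sums of it.
δ : ℕ → ℕ → ℕ
δ zero    x       = 1
δ (suc p) zero    = 0
δ (suc p) (suc x) = δ p x

δ-mono : ∀ p {x y} → x ≤ y → δ p x ≤ δ p y
δ-mono zero    x≤y       = ≤-refl
δ-mono (suc p) z≤n       = z≤n
δ-mono (suc p) (s≤s x≤y) = δ-mono p x≤y

δ≤1 : ∀ p x → δ p x ≤ 1
δ≤1 zero    x       = ≤-refl
δ≤1 (suc p) zero    = z≤n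
δ≤1 (suc p) (suc x) = δ≤1 p x

δ-≤ : ∀ {p x} → p ≤ x → δ p x ≡ 1
δ-≤ z≤n       = refl
δ-≤ (s≤s p≤x) = δ-≤ p≤x

δ-> : ∀ {p x} → x < p → δ p x ≡ 0
δ-> {suc p} {zero}  x<p       = refl
δ-> {suc p} {suc x} (s≤s x<p) = δ-> x<p

δ≡0⇒< : ∀ {p x} → δ p x ≡ 0 → x < p
δ≡0⇒< {p} {x} eq with p ℕₚ.≤? x
... | no  p≰x = ℕₚ.≰⇒> p≰x
... | yes p≤x = case trans (sym eq) (δ-≤ p≤x) of λ ()

δ≡1⇒≤ : ∀ {p x} → δ p x ≡ 1 → p ≤ x
δ≡1⇒≤ {p} {x} eq with p ℕₚ.≤? x
... | yes p≤x = p≤x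
... | no  p≰x = case trans (sym eq) (δ-> (ℕₚ.≰⇒> p≰x)) of λ ()

-- For f the inverse of a permutation u, R# f p q counts the positions ≥ p
-- at which u takes a value < q.
R# : (ℕ → ℕ) → ℕ → ℕ → ℕ
R# f p zero    = 0
R# f p (suc q) = R# f p q + δ p (f q)

R#-cong : ∀ {f g} → f ≗ g → ∀ p q → R# f p q ≡ R# g p q
R#-cong f≗g p zero    = refl
R#-cong f≗g p (suc q) = cong₂ _+_ (R#-cong f≗g p q) (cong (δ p) (f≗g q))

R#≡0⇒< : ∀ {f p} q → R# f p q ≡ 0 → ∀ {v} → v < q → f v < p
R#≡0⇒< {f} {p} (suc q) eq {v} (s≤s v≤q) with ℕₚ.m≤n⇒m<n∨m≡n v≤q
... | inj₁ v<q  = R#≡0⇒< q (ℕₚ.m+n≡0⇒m≡0 _ eq) v<q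
... | inj₂ refl = δ≡0⇒< (ℕₚ.m+n≡0⇒n≡0 (R# f p q) eq)

<⇒R#≡0 : ∀ {f p} q → (∀ {v} → v < q → f v < p) → R# f p q ≡ 0
<⇒R#≡0 zero    f<p = refl
<⇒R#≡0 (suc q) f<p =
  cong₂ _+_ (<⇒R#≡0 q (f<p ∘ ℕₚ.m<n⇒m<1+n)) (δ-> (f<p ≤-refl))

R#-sw-≤ : ∀ f i p q → q ≤ i → R# (f ∘ sw i) p q ≡ R# f p q
R#-sw-≤ f i p zero    q≤i = refl
R#-sw-≤ f i p (suc q) q<i =
  cong₂ _+_ (R#-sw-≤ f i p q (ℕₚ.<⇒≤ q<i)) (cong (δ p ∘ f) (sw-< q<i))

R#-sw-1+i : ∀ f i p → R# (f ∘ sw i) p (suc i) ≡ R# f p i + δ p (f (suc i))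
R#-sw-1+i f i p = cong₂ _+_ (R#-sw-≤ f i p i ≤-refl) (cong (δ p ∘ f) (sw-i i))

R#-sw-2+i : ∀ f i p → R# f p i + δ p (f (suc i)) + δ p (f i) ≡ R# f p (suc (suc i))
R#-sw-2+i f i p = trans (ℕₚ.+-assoc r _ _)
  (trans (cong (r +_) (ℕₚ.+-comm _ (δ p (f i)))) (sym (ℕₚ.+-assoc r _ _)))
  where r = R# f p i

-- At `q ≡ 2 + i` both exchanged summands have been counted, so the sum is restored; later columns
-- add equal terms.
R#-sw-> : ∀ f i p q → suc i < q → R# (f ∘ sw i) p q ≡ R# f p q
R#-sw-> f i p (suc q) (s≤s i<q) with ℕₚ.m≤n⇒m<n∨m≡n i<q
... | inj₁ 1+i<q = cong₂ _+_ (R#-sw-> f i p q 1+i<q) (cong (δ p ∘ f) (sw-> 1+i<q))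
... | inj₂ refl  = trans
  (cong₂ _+_ (R#-sw-1+i f i p) (cong (δ p ∘ f) (sw-1+i i))) (R#-sw-2+i f i p)

R#-sw-≢ : ∀ f i p q → q ≢ suc i → R# (f ∘ sw i) p q ≡ R# f p q
R#-sw-≢ f i p q q≢ with ℕₚ.<-cmp q (suc i)
... | tri< (s≤s q≤i) _ _ = R#-sw-≤ f i p q q≤i
... | tri≈ _ q≡ _        = contradiction q≡ q≢
... | tri> _ _ q>        = R#-sw-> f i p q q>

-- Bruhat order, in terms of the inverse permutations.
infix 4 _≤ᴿ_
_≤ᴿ_ : (ℕ → ℕ) → (ℕ → ℕ) → Set
f ≤ᴿ g = ∀ p q → R# f p q ≤ R# g p q

≤ᴿ-reflexive : ∀ {f g} → f ≗ g → f ≤ᴿ g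
≤ᴿ-reflexive f≗g p q = ≤-reflexive (R#-cong f≗g p q)

≤ᴿ-trans : ∀ {f g h} → f ≤ᴿ g → g ≤ᴿ h → f ≤ᴿ h
≤ᴿ-trans f≤g g≤h p q = ≤-trans (f≤g p q) (g≤h p q)

-- Equal tables have equal differences of consecutive columns, and these are the indicators
-- `δ p (f v)` and `δ p (g v)`. The rows `p ≡ f v` and `p ≡ g v` give the two inequalities.
≤ᴿ-antisym : ∀ {f g} → f ≤ᴿ g → g ≤ᴿ f → f ≗ g
≤ᴿ-antisym {f} {g} f≤g g≤f v =
  ℕₚ.≤-antisym (δ≡1⇒≤ (trans (sym (δ-eq (f v))) (δ-≤ {f v} {f v} ≤-refl)))
               (δ≡1⇒≤ (trans (δ-eq (g v)) (δ-≤ {g v} {g v} ≤-refl)))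
  where
  R#-eq : ∀ p q → R# f p q ≡ R# g p q
  R#-eq p q = ℕₚ.≤-antisym (f≤g p q) (g≤f p q)
  δ-eq : ∀ p → δ p (f v) ≡ δ p (g v)
  δ-eq p = ℕₚ.+-cancelˡ-≡ (R# g p v) _ _
    (trans (cong (_+ δ p (f v)) (sym (R#-eq p v))) (R#-eq p (suc v)))

-- If `f v < v`, then `f` fixes `f v` by strong induction, and injectivity contradicts `f v < v`.
injective∧≤⇒id : ∀ {f : ℕ → ℕ} → Injective _≡_ _≡_ f → (∀ v → f v ≤ v) → ∀ v → f v ≡ v
injective∧≤⇒id {f} inj f≤ v = go (suc v) v ≤-refl
  where
  go : ∀ n v → v < n → f v ≡ v
  go (suc n) v (s≤s v≤n) with ℕₚ.m≤n⇒m<n∨m≡n (f≤ v)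
  ... | inj₂ eq   = eq
  ... | inj₁ fv<v = contradiction (inj (go n (f v) (ℕₚ.<-≤-trans fv<v v≤n))) (ℕₚ.<⇒≢ fv<v)

≤ᴿ-id : ∀ {f} → Injective _≡_ _≡_ f → f ≤ᴿ (λ x → x) → ∀ v → f v ≡ v
≤ᴿ-id {f} inj f≤id = injective∧≤⇒id inj λ v → ℕₚ.≤-pred
  -- The identity takes no value below `suc v` at a position from `suc v` on, so this entry vanishes
  -- for `f` too.
  (R#≡0⇒< (suc v)
    (ℕₚ.n≤0⇒n≡0 (≤-trans (f≤id (suc v) (suc v))
      (≤-reflexive (<⇒R#≡0 {λ x → x} (suc v) (λ v<q → v<q))))) ≤-refl)

≤ᴿ-except : ∀ {f g} i → (∀ p q → q ≢ suc i → R# f p q ≤ R# g p q) →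
            (∀ p → R# f p (suc i) ≤ R# g p (suc i)) → f ≤ᴿ g
≤ᴿ-except i off at p q with q ℕₚ.≟ suc i
... | yes refl = at p
... | no  q≢   = off p q q≢

private
  -- Here `a` and `a′` are the entries of two tables in column `i`, and `x`, `y`, `α`, `β` the
  -- indicators added in the next two columns. As `x ≤ 1`, only `β ≡ 0` needs the entry in column
  -- `2 + i`, and then `α` vanishes as well.
  up : ∀ a a′ {x y α β} → a ≤ a′ → a + x + y ≤ a′ + α + β → x ≤ 1 → α ≤ β →
       a + x ≤ a′ + β
  up a a′ {x} {y} {α} {suc β} a≤a′ _ x≤1 _ =
    ℕₚ.+-mono-≤ a≤a′ (≤-trans x≤1 (s≤s z≤n))
  up a a′ {x} {y} {α} {zero} _ le _ z≤n =
    ≤-trans (ℕₚ.m≤m+n (a + x) y) (≤-trans le (≤-reflexive (ℕₚ.+-identityʳ (a′ + 0))))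

  -- Only `x ≡ 1` is at stake. Then `y` is positive too, and one unit is cancelled against `β ≤ 1`.
  down : ∀ a a′ {x y α β} → a ≤ a′ → a + y + x ≤ a′ + α + β → x ≤ y → β ≤ 1 → x ≤ 1 →
         a + x ≤ a′ + α
  down a a′ {zero} a≤a′ _ _ _ _ = ℕₚ.+-mono-≤ a≤a′ z≤n
  down a a′ {suc x} {suc y} {α} {β} _ le _ β≤1 (s≤s z≤n) = ℕₚ.+-cancelʳ-≤ 1 (a + 1) (a′ + α)
    (≤-trans (ℕₚ.+-monoˡ-≤ 1 (ℕₚ.+-monoʳ-≤ a (s≤s (z≤n {y}))))
      (≤-trans le (ℕₚ.+-monoʳ-≤ (a′ + α) β≤1)))

  2+i≢1+i : ∀ {i : ℕ} → suc (suc i) ≢ suc i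
  2+i≢1+i ()

-- Throughout, only the entries in column suc i change under composition
-- with sw i, and they are squeezed between those in columns i and 2 + i.
≤ᴿ-up : ∀ {f g} i → g i < g (suc i) → f ≤ᴿ g → f ≤ᴿ g ∘ sw i
≤ᴿ-up {f} {g} i asc f≤g = ≤ᴿ-except i
  (λ p q q≢ → ≤-trans (f≤g p q) (≤-reflexive (sym (R#-sw-≢ g i p q q≢))))
  (λ p → ≤-trans
    (up (R# f p i) (R# g p i) (f≤g p i) (f≤g p (suc (suc i))) (δ≤1 p _) (δ-mono p (ℕₚ.<⇒≤ asc)))
    (≤-reflexive (sym (R#-sw-1+i g i p))))

≤ᴿ-up-both : ∀ {f g} i → g i < g (suc i) → f ≤ᴿ g → f ∘ sw i ≤ᴿ g ∘ sw i
≤ᴿ-up-both {f} {g} i asc f≤g = ≤ᴿ-except i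
  (λ p q q≢ → subst₂ _≤_ (sym (R#-sw-≢ f i p q q≢)) (sym (R#-sw-≢ g i p q q≢)) (f≤g p q))
  (λ p → subst₂ _≤_ (sym (R#-sw-1+i f i p)) (sym (R#-sw-1+i g i p))
    (up (R# f p i) (R# g p i) (f≤g p i)
      (≤-trans (≤-reflexive (R#-sw-2+i f i p)) (f≤g p (suc (suc i))))
      (δ≤1 p _) (δ-mono p (ℕₚ.<⇒≤ asc))))

-- With `≤ᴿ-down-both`, this strips a leading letter `i` from the upper word: the lower permutation
-- is kept if it ascends at `i` and loses its own `i` if it descends.
≤ᴿ-down : ∀ {f g} i → f i ≤ f (suc i) → f ≤ᴿ g ∘ sw i → f ≤ᴿ g
≤ᴿ-down {f} {g} i asc f≤g = ≤ᴿ-except i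
  off
  (λ p → down (R# f p i) (R# g p i) (off p i (ℕₚ.<⇒≢ (ℕₚ.n<1+n i)))
    (≤-trans (≤-reflexive (R#-sw-2+i f i p)) (off p (suc (suc i)) 2+i≢1+i))
    (δ-mono p asc) (δ≤1 p _) (δ≤1 p _))
  where
  off : ∀ p q → q ≢ suc i → R# f p q ≤ R# g p q
  off p q q≢ = ≤-trans (f≤g p q) (≤-reflexive (R#-sw-≢ g i p q q≢))

≤ᴿ-down-both : ∀ {f g} i → f (suc i) ≤ f i → f ≤ᴿ g ∘ sw i → f ∘ sw i ≤ᴿ g
≤ᴿ-down-both {f} {g} i desc f≤g = ≤ᴿ-except i
  (λ p q q≢ → ≤-trans (≤-reflexive (R#-sw-≢ f i p q q≢)) (off p q q≢))
  (λ p → ≤-trans (≤-reflexive (R#-sw-1+i f i p))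
    (down (R# f p i) (R# g p i) (off p i (ℕₚ.<⇒≢ (ℕₚ.n<1+n i)))
      (off p (suc (suc i)) 2+i≢1+i) (δ-mono p desc) (δ≤1 p _) (δ≤1 p _)))
  where
  off : ∀ p q → q ≢ suc i → R# f p q ≤ R# g p q
  off p q q≢ = ≤-trans (f≤g p q) (≤-reflexive (R#-sw-≢ g i p q q≢))

-- Words in adjacent transpositions

Word : ℕ → Set
Word m = List (Fin m)

private
  variable
    m n : ℕ

act : Word m → ℕ → ℕ
act []      = λ x → x
act (i ∷ c) = sw (toℕ i) ∘ act c

act⁻ : Word m → ℕ → ℕ
act⁻ []      = λ x → x
act⁻ (i ∷ c) = act⁻ c ∘ sw (toℕ i)

act-act⁻ : ∀ (c : Word m) x → act c (act⁻ c x) ≡ x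
act-act⁻ []      x = refl
act-act⁻ (i ∷ c) x =
  trans (cong (sw (toℕ i)) (act-act⁻ c (sw (toℕ i) x))) (sw-involutive (toℕ i) x)

act⁻-act : ∀ (c : Word m) x → act⁻ c (act c x) ≡ x
act⁻-act []      x = refl
act⁻-act (i ∷ c) x =
  trans (cong (act⁻ c) (sw-involutive (toℕ i) (act c x))) (act⁻-act c x)

act-injective : ∀ (c : Word m) → Injective _≡_ _≡_ (act c)
act-injective c {x} {y} eq =
  trans (sym (act⁻-act c x)) (trans (cong (act⁻ c) eq) (act⁻-act c y))

act⁻-injective : ∀ (c : Word m) → Injective _≡_ _≡_ (act⁻ c)
act⁻-injective c {x} {y} eq =
  trans (sym (act-act⁻ c x)) (trans (cong (act c) eq) (act-act⁻ c y))

act⇒act⁻ : ∀ (a b : Word m) → act a ≗ act b → act⁻ a ≗ act⁻ b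
act⇒act⁻ a b eq x = act-injective a
  (trans (act-act⁻ a x) (sym (trans (eq (act⁻ b x)) (act-act⁻ b x))))

act⁻⇒act : ∀ (a b : Word m) → act⁻ a ≗ act⁻ b → act a ≗ act b
act⁻⇒act a b eq x = act⁻-injective a
  (trans (act⁻-act a x) (sym (trans (eq (act b x)) (act⁻-act b x))))

act-++ : ∀ (a b : Word m) x → act (a ++ b) x ≡ act a (act b x)
act-++ []      b x = refl
act-++ (i ∷ a) b x = cong (sw (toℕ i)) (act-++ a b x)

act-preserves-≤ : ∀ {t} {c : Word m} → All (λ i → toℕ i ≢ t) c →
                  ∀ {x} → x ≤ t → act c x ≤ t
act-preserves-≤ []       x≤t = x≤t
act-preserves-≤ (i≢ ∷ c) x≤t = sw-preserves-≤ i≢ (act-preserves-≤ c x≤t)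

act-preserves-> : ∀ {t} {c : Word m} → All (λ i → toℕ i ≢ t) c →
                  ∀ {x} → t < x → t < act c x
act-preserves-> []       t<x = t<x
act-preserves-> (i≢ ∷ c) t<x = sw-preserves-> i≢ (act-preserves-> c t<x)

act⁻-preserves-≤ : ∀ {t} {c : Word m} → All (λ i → toℕ i ≢ t) c →
                   ∀ {x} → x ≤ t → act⁻ c x ≤ t
act⁻-preserves-≤ {c = c} ≢t {x} x≤t = ℕₚ.≮⇒≥ λ t<y →
  ℕₚ.<⇒≱ (subst (_ <_) (act-act⁻ c x) (act-preserves-> ≢t t<y)) x≤t

act⁻-preserves-> : ∀ {t} {c : Word m} → All (λ i → toℕ i ≢ t) c →
                   ∀ {x} → t < x → t < act⁻ c x
act⁻-preserves-> {c = c} ≢t {x} t<x = ℕₚ.≰⇒> λ y≤t →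
  ℕₚ.<⇒≱ t<x (subst (_≤ _) (act-act⁻ c x) (act-preserves-≤ ≢t y≤t))

act-fixes-≤ : ∀ {t} {c : Word m} → All (λ i → t < toℕ i) c → ∀ {x} → x ≤ t → act c x ≡ x
act-fixes-≤ []        x≤t = refl
act-fixes-≤ (t<i ∷ c) x≤t =
  trans (cong (sw _) (act-fixes-≤ c x≤t)) (sw-< (ℕₚ.≤-<-trans x≤t t<i))

act-fixes-> : ∀ {t} {c : Word m} → All (λ i → toℕ i < t) c → ∀ {x} → t < x → act c x ≡ x
act-fixes-> []        t<x = refl
act-fixes-> (i<t ∷ c) t<x =
  trans (cong (sw _) (act-fixes-> c t<x)) (sw-> (ℕₚ.≤-<-trans i<t t<x))

-- Words all of whose letters increase the number of inversions.
data Asc {m} : Word m → Set where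
  []  : Asc []
  _∷_ : ∀ {i c} → act⁻ c (toℕ i) < act⁻ c (suc (toℕ i)) → Asc c → Asc (i ∷ c)

⊆⇒≤ᴿ : ∀ {a b : Word m} → Asc b → a ⊆ b → act⁻ a ≤ᴿ act⁻ b
⊆⇒≤ᴿ []           []              = λ _ _ → ≤-refl
⊆⇒≤ᴿ (asc ∷ ascs) (i ∷ʳ a⊆b)      = ≤ᴿ-up (toℕ i) asc (⊆⇒≤ᴿ ascs a⊆b)
⊆⇒≤ᴿ (asc ∷ ascs) (_∷_ {x = i} refl a⊆b) = ≤ᴿ-up-both (toℕ i) asc (⊆⇒≤ᴿ ascs a⊆b)

-- A greedy reading of `b` from the left: the letter `i` is kept exactly when `f` descends there. In
-- particular `f` turns out to be a product of letters.
≤ᴿ⇒⊆ : ∀ {b : Word m} {f} → Asc b → Injective _≡_ _≡_ f → f ≤ᴿ act⁻ b →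
       ∃ λ a → a ⊆ b × Asc a × act⁻ a ≗ f
≤ᴿ⇒⊆ {b = []} [] inj f≤ = [] , [] , [] , λ x → sym (≤ᴿ-id inj f≤ x)
≤ᴿ⇒⊆ {b = i ∷ c} {f} (_ ∷ ascs) inj f≤ with f (suc (toℕ i)) ℕₚ.<? f (toℕ i)
... | no  asc  =
  let a , a⊆c , asc-a , eq = ≤ᴿ⇒⊆ ascs inj (≤ᴿ-down {g = act⁻ c} (toℕ i) (ℕₚ.≮⇒≥ asc) f≤)
  in a , i ∷ʳ a⊆c , asc-a , eq
... | yes desc =
  let a , a⊆c , asc-a , eq = ≤ᴿ⇒⊆ ascs (sw-injective (toℕ i) ∘ inj)
                               (≤ᴿ-down-both {g = act⁻ c} (toℕ i) (ℕₚ.<⇒≤ desc) f≤)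
  in i ∷ a , refl ∷ a⊆c
   , subst₂ _<_ (sym (trans (eq _) (cong f (sw-i (toℕ i)))))
                (sym (trans (eq _) (cong f (sw-1+i (toℕ i))))) desc ∷ asc-a
   , λ x → trans (eq (sw (toℕ i) x)) (cong f (sw-involutive (toℕ i) x))

-- The deletion property: if `i` in front of an ascending word `a` is a descent, the product of
-- `i ∷ a` lies below that of `a` and is already spelled by a subword of `a`.
asc-subword : ∀ (b : Word m) → ∃ λ a → a ⊆ b × Asc a × act⁻ a ≗ act⁻ b
asc-subword []      = [] , [] , [] , λ _ → refl
asc-subword (i ∷ b) with asc-subword b
... | a , a⊆b , asc-a , eq with ℕₚ.<-cmp (act⁻ a (toℕ i)) (act⁻ a (suc (toℕ i)))
... | tri< asc _ _  = i ∷ a , refl ∷ a⊆b , asc ∷ asc-a , λ x → eq (sw (toℕ i) x)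
... | tri≈ _ same _ = contradiction (act⁻-injective a same) (ℕₚ.<⇒≢ (ℕₚ.n<1+n _))
... | tri> _ _ desc =
  let c , c⊆a , asc-c , eq′ = ≤ᴿ⇒⊆ asc-a (sw-injective (toℕ i) ∘ act⁻-injective a)
        (≤ᴿ-down {g = act⁻ a} (toℕ i)
          (subst₂ _≤_ (sym (cong (act⁻ a) (sw-i (toℕ i))))
                      (sym (cong (act⁻ a) (sw-1+i (toℕ i)))) (ℕₚ.<⇒≤ desc))
          (≤ᴿ-reflexive λ _ → refl))
  in c , i ∷ʳ ⊆-trans c⊆a a⊆b , asc-c , λ x → trans (eq′ x) (eq (sw (toℕ i) x))

⊆∧length⇒≡ : ∀ {a b : Word m} → a ⊆ b → length b ≤ length a → a ≡ b
⊆∧length⇒≡ a⊆b ≤a = ≋⇒≡ (toPointwise (ℕₚ.≤-antisym (length-mono-≤ a⊆b) ≤a) a⊆b)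

-- The product of the tail `a` lies strictly below that of `i ∷ a`, so inside an ascending subword
-- `c` of `b` it is spelled by a proper subword `d`. Induction compares `a` with `d`.
asc-minimal : ∀ {a : Word m} → Asc a → ∀ (b : Word m) → act⁻ a ≗ act⁻ b → length a ≤ length b
asc-minimal []                        b eq = z≤n
asc-minimal {a = i ∷ a} (asc ∷ asc-a) b eq =
  let c , c⊆b , asc-c , c≗b = asc-subword b in
  let d , d⊆c , _ , d≗a = ≤ᴿ⇒⊆ asc-c (act⁻-injective a)
        (≤ᴿ-trans (≤ᴿ-up {g = act⁻ a} (toℕ i) asc λ _ _ → ≤-refl)
                  (≤ᴿ-reflexive λ x → trans (eq x) (sym (c≗b x))))
      d≢c : d ≢ c
      d≢c d≡c = ℕₚ.<⇒≢ asc (trans (sym (d≗a _)) (trans (cong (λ e → act⁻ e (toℕ i)) d≡c)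
        (trans (c≗b _) (trans (sym (eq _)) (cong (act⁻ a) (sw-i (toℕ i)))))))
  in ≤-trans (s≤s (asc-minimal asc-a d (λ x → sym (d≗a x))))
       (≤-trans (ℕₚ.≰⇒> (d≢c ∘ ⊆∧length⇒≡ d⊆c)) (length-mono-≤ c⊆b))

asc-++ʳ : ∀ (a : Word m) {b} → Asc (a ++ b) → Asc b
asc-++ʳ []      asc       = asc
asc-++ʳ (i ∷ a) (_ ∷ asc) = asc-++ʳ a asc

-- `Asc` constrains suffixes, so a prefix needs minimality: an ascending subword of `a` with the
-- same product may replace `a` in front of `b`, and then it cannot be shorter.
asc-++ˡ : ∀ (a : Word m) {b} → Asc (a ++ b) → Asc a
asc-++ˡ a {b} asc with asc-subword a
... | c , c⊆a , asc-c , c≗a = subst Asc (⊆∧length⇒≡ c⊆a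
  (ℕₚ.+-cancelʳ-≤ (length b) _ _
    (subst₂ _≤_ (length-++ a {b}) (length-++ c {b})
      (asc-minimal asc (c ++ b) (act⇒act⁻ (a ++ b) (c ++ b) λ x →
        trans (act-++ a b x) (trans (sym (act⁻⇒act c a c≗a (act b x))) (sym (act-++ c b x)))))))) asc-c

-- The single letter is a subword of `b`, and its own table is nonzero here, since it takes the
-- value `toℕ i` at position `suc (toℕ i)`.
∈⇒crossing : ∀ {i} {b : Word m} → Asc b → i ∷ [] ⊆ b → R# (act⁻ b) (suc (toℕ i)) (suc (toℕ i)) ≢ 0
∈⇒crossing {i = i} asc i∈b eq =
  ℕₚ.<-irrefl refl (subst (_< suc (toℕ i)) (sw-i (toℕ i))
    (R#≡0⇒< {sw (toℕ i)} (suc (toℕ i))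
      (ℕₚ.n≤0⇒n≡0 (≤-trans (⊆⇒≤ᴿ asc i∈b (suc (toℕ i)) (suc (toℕ i))) (≤-reflexive eq))) ≤-refl))

preserves-≤⇒avoids : ∀ {t} {b : Word m} → Asc b → (∀ {x} → x ≤ t → act⁻ b x ≤ t) →
                     All (λ i → toℕ i ≢ t) b
preserves-≤⇒avoids {b = b} asc pres = All.tabulate λ { {i} i∈b refl →
  ∈⇒crossing asc (from∈ i∈b) (<⇒R#≡0 (suc (toℕ i)) λ { (s≤s v≤i) → s≤s (pres v≤i) }) }

-- The chain property of Bruhat order. It suffices to remember that the two
-- permutations of the cover differ at two positions j and k.
Step : Word m → Word m → Set
Step {m} a b = ∃ λ (c : Word m) → act⁻ a ≤ᴿ act⁻ c × act⁻ c ≤ᴿ act⁻ b × ¬ (act⁻ a ≗ act⁻ c) ×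
  ∃₂ λ j k → ∀ z → (act⁻ a z ≡ j ⊎ act⁻ a z ≡ k) ⊎ act⁻ c z ≡ act⁻ a z

≤ᴿ-sw² : ∀ {f g} i → f ∘ sw i ∘ sw i ≤ᴿ g → f ≤ᴿ g
≤ᴿ-sw² {f} i = ≤ᴿ-trans (≤ᴿ-reflexive λ x → cong f (sym (sw-involutive i x)))

-- If `i` is an ascent of `a`, then `i ∷ a` is the required step. Otherwise a step from `i ∷ a`
-- towards the remaining word is lifted back by `i`. This fails only if the step ends in a
-- permutation with a descent at `i`; then `a` itself lies below the remaining word, and the
-- induction applies to it directly.
chain : ∀ (a : Word m) {b} → Asc b → act⁻ a ≤ᴿ act⁻ b → ¬ (act⁻ a ≗ act⁻ b) → Step a b
chain a [] a≤b a≢b = contradiction (≤ᴿ-id (act⁻-injective a) a≤b) a≢b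
chain {m} a {i ∷ b} (asc ∷ asc-b) a≤ib a≢ib
  with ℕₚ.<-cmp (act⁻ a (toℕ i)) (act⁻ a (suc (toℕ i)))
... | tri≈ _ same _ = contradiction (act⁻-injective a same) (ℕₚ.<⇒≢ (ℕₚ.n<1+n _))
... | tri< asc-a _ _ = i ∷ a
  , ≤ᴿ-up {g = act⁻ a} (toℕ i) asc-a (λ _ _ → ≤-refl)
  , ≤ᴿ-up-both {g = act⁻ b} (toℕ i) asc (≤ᴿ-down {g = act⁻ b} (toℕ i) (ℕₚ.<⇒≤ asc-a) a≤ib)
  , (λ eq → ℕₚ.<⇒≢ asc-a (trans (eq _) (cong (act⁻ a) (sw-i (toℕ i)))))
  , act⁻ a (toℕ i) , act⁻ a (suc (toℕ i)) , differ
  where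
  differ : ∀ z → (act⁻ a z ≡ act⁻ a (toℕ i) ⊎ act⁻ a z ≡ act⁻ a (suc (toℕ i))) ⊎
                 act⁻ a (sw (toℕ i) z) ≡ act⁻ a z
  differ z with swView (toℕ i) z
  ... | below z<i = inj₂ (cong (act⁻ a) (sw-< z<i))
  ... | lower     = inj₁ (inj₁ refl)
  ... | upper     = inj₁ (inj₂ refl)
  ... | above i<z = inj₂ (cong (act⁻ a) (sw-> i<z))
... | tri> _ _ desc = lift (chain (i ∷ a) asc-b sa≤b sa≢b)
  where
  s  = sw (toℕ i)
  ss = sw-involutive (toℕ i)
  f  = act⁻ a

  sa≤b : f ∘ s ≤ᴿ act⁻ b
  sa≤b = ≤ᴿ-down-both {g = act⁻ b} (toℕ i) (ℕₚ.<⇒≤ desc) a≤ib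

  sa≢b : ¬ (f ∘ s ≗ act⁻ b)
  sa≢b eq = a≢ib λ x → trans (cong f (sym (ss x))) (eq (s x))

  sa-asc : (f ∘ s) (toℕ i) ≤ (f ∘ s) (suc (toℕ i))
  sa-asc = subst₂ _≤_ (cong f (sym (sw-i (toℕ i)))) (cong f (sym (sw-1+i (toℕ i)))) (ℕₚ.<⇒≤ desc)

  fromBelow : Step a b → Step a (i ∷ b)
  fromBelow (c , a≤c , c≤b , rest) = c , a≤c , ≤ᴿ-up (toℕ i) asc c≤b , rest

  lift : Step (i ∷ a) b → Step a (i ∷ b)
  lift (c , sa≤c , c≤b , sa≢c , j , k , differ)
    with ℕₚ.<-cmp (act⁻ c (toℕ i)) (act⁻ c (suc (toℕ i)))
  ... | tri≈ _ same _ = contradiction (act⁻-injective c same) (ℕₚ.<⇒≢ (ℕₚ.n<1+n _))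
  ... | tri< asc-c _ _ = i ∷ c
    , ≤ᴿ-sw² (toℕ i) (≤ᴿ-up-both {g = act⁻ c} (toℕ i) asc-c sa≤c)
    , ≤ᴿ-up-both {g = act⁻ b} (toℕ i) asc c≤b
    , (λ eq → sa≢c λ x → trans (eq (s x)) (cong (act⁻ c) (ss x)))
    , j , k , differ′
    where
    differ′ : ∀ z → (f z ≡ j ⊎ f z ≡ k) ⊎ act⁻ c (s z) ≡ f z
    differ′ z = subst (λ y → (f y ≡ j ⊎ f y ≡ k) ⊎ act⁻ c (s z) ≡ f y) (ss z) (differ (s z))
  ... | tri> _ _ desc-c = fromBelow (chain a asc-b (≤ᴿ-trans a≤c c≤b) a≢b)
    where
    c≗ssc : act⁻ c ≗ act⁻ c ∘ s ∘ s
    c≗ssc x = cong (act⁻ c) (sym (ss x))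

    a≤c : f ≤ᴿ act⁻ c
    a≤c = ≤ᴿ-sw² (toℕ i) (≤ᴿ-trans
      (≤ᴿ-up-both {g = act⁻ c ∘ s} (toℕ i)
        (subst₂ _<_ (cong (act⁻ c) (sym (sw-i (toℕ i)))) (cong (act⁻ c) (sym (sw-1+i (toℕ i)))) desc-c)
        (≤ᴿ-down {g = act⁻ c ∘ s} (toℕ i) sa-asc (≤ᴿ-trans sa≤c (≤ᴿ-reflexive c≗ssc))))
      (≤ᴿ-reflexive (sym ∘ c≗ssc)))

    a≢b : ¬ (f ≗ act⁻ b)
    a≢b eq = ℕₚ.<-asym desc (subst₂ _<_ (sym (eq _)) (sym (eq _)) asc)

-- Words for the permutations of `Fin n`

toℕ-transpose : ∀ (j : Fin n) x →
  toℕ (Perm.transpose (inject₁ j) (suc j) ⟨$⟩ʳ x) ≡ sw (toℕ j) (toℕ x)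
toℕ-transpose zero    zero          = refl
toℕ-transpose zero    (suc zero)    = refl
toℕ-transpose zero    (suc (suc x)) = refl
toℕ-transpose (suc j) zero          = refl
toℕ-transpose (suc j) (suc x)       =
  trans (cong toℕ (Perm.lift₀-transpose (inject₁ j) (suc j) (suc x))) (cong suc (toℕ-transpose j x))

toℕ-⟦⟧ : ∀ n (b : Word (pred n)) x → toℕ (⟦_⟧ {n} b ⟨$⟩ʳ x) ≡ act b (toℕ x)
toℕ-⟦⟧ n       []      x = refl
toℕ-⟦⟧ (suc n) (i ∷ b) x =
  trans (toℕ-transpose i (⟦ b ⟧ ⟨$⟩ʳ x)) (cong (sw (toℕ i)) (toℕ-⟦⟧ (suc n) b x))

act-fixes-≥n : ∀ n (b : Word (pred n)) {x} → n ≤ x → act b x ≡ x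
act-fixes-≥n zero    []        n≤x = refl
act-fixes-≥n (suc n) b {suc x} (s≤s n≤x) =
  act-fixes-> (All.universal (λ i → Finₚ.toℕ<n i) b) (s≤s n≤x)

-- A word carrying `0` to the given element: the letter `zero` acts first and moves `0` to `1`, from
-- where the shifted word continues.
cycle : Fin (suc n) → Word n
cycle         zero    = []
cycle {suc n} (suc y) = List.map suc (cycle y) ++ zero ∷ []

act-map-suc : ∀ (b : Word m) x → act (List.map suc b) (suc x) ≡ suc (act b x)
act-map-suc []      x = refl
act-map-suc (i ∷ b) x = cong (sw (suc (toℕ i))) (act-map-suc b x)

act-map-suc-0 : ∀ (b : Word m) → act (List.map suc b) 0 ≡ 0
act-map-suc-0 []      = refl
act-map-suc-0 (i ∷ b) = cong (sw (suc (toℕ i))) (act-map-suc-0 b)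

act-cycle : ∀ (y : Fin (suc n)) → act (cycle y) 0 ≡ toℕ y
act-cycle         zero    = refl
act-cycle {suc n} (suc y) = trans (act-++ (List.map suc (cycle y)) _ 0)
  (trans (act-map-suc (cycle y) 0) (cong suc (act-cycle y)))

-- Dividing `w` on the left by a word that carries `0` to its image leaves a permutation fixing `0`,
-- which is a smaller permutation with all letters shifted.
extend-words : (∀ (w : Permutation′ (suc n)) → ∃ λ b → ⟦ b ⟧ ≈ w) →
               ∀ (w : Permutation′ (suc (suc n))) → ∃ λ b → ⟦ b ⟧ ≈ w
extend-words {n} rec w = c ++ List.map suc b , λ x → Finₚ.toℕ-injective (eq x)
  where
  c  = cycle (w ⟨$⟩ʳ zero)
  w₀ = ⟦_⟧ {suc (suc n)} c
  w′ = w ∘ₚ Perm.flip w₀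

  w₀∘w′ : ∀ x → w₀ ⟨$⟩ʳ (w′ ⟨$⟩ʳ x) ≡ w ⟨$⟩ʳ x
  w₀∘w′ x = Perm.inverseʳ w₀

  w₀0 : w₀ ⟨$⟩ʳ zero ≡ w ⟨$⟩ʳ zero
  w₀0 = Finₚ.toℕ-injective (trans (toℕ-⟦⟧ (suc (suc n)) c zero) (act-cycle (w ⟨$⟩ʳ zero)))

  w′0 : w′ ⟨$⟩ʳ zero ≡ zero
  w′0 = trans (cong (w₀ ⟨$⟩ˡ_) (sym w₀0)) (Perm.inverseˡ w₀)

  tail = rec (Perm.remove zero w′)
  b    = proj₁ tail

  act-b : ∀ x → act (List.map suc b) (toℕ x) ≡ toℕ (w′ ⟨$⟩ʳ x)
  act-b zero    = trans (act-map-suc-0 b) (cong toℕ (sym w′0))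
  act-b (suc x) = trans (act-map-suc b (toℕ x)) (trans
    (cong suc (trans (sym (toℕ-⟦⟧ (suc n) b x)) (cong toℕ (proj₂ tail x))))
    (cong toℕ (Perm.lift₀-remove w′ w′0 (suc x))))

  eq : ∀ x → toℕ (⟦_⟧ {suc (suc n)} (c ++ List.map suc b) ⟨$⟩ʳ x) ≡ toℕ (w ⟨$⟩ʳ x)
  eq x = trans (toℕ-⟦⟧ (suc (suc n)) (c ++ List.map suc b) x) (trans (act-++ c _ (toℕ x))
    (trans (cong (act c) (act-b x)) (trans (sym (toℕ-⟦⟧ (suc (suc n)) c (w′ ⟨$⟩ʳ x))) (cong toℕ (w₀∘w′ x)))))

∃-word : ∀ n (w : Permutation′ n) → ∃ λ b → ⟦ b ⟧ ≈ w
∃-word zero        w = [] , λ ()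
∃-word (suc zero)    w = [] , λ { zero → sym (Fin1 (w ⟨$⟩ʳ zero)) }
  where
  Fin1 : ∀ (x : Fin 1) → x ≡ zero
  Fin1 zero = refl
∃-word (suc (suc n)) w = extend-words (∃-word (suc n)) w

-- Bruhat order on the permutations of `Fin n`

module Bruhat (n : ℕ) where

  private
    variable
      u v w : Permutation′ n

  ⟪_⟫ : Word (pred n) → Permutation′ n
  ⟪ b ⟫ = ⟦ b ⟧

  toℕ-⟪⟫ : ∀ b x → toℕ (⟪ b ⟫ ⟨$⟩ʳ x) ≡ act b (toℕ x)
  toℕ-⟪⟫ = toℕ-⟦⟧ n

  ≈⇒act : ∀ (a b : Word (pred n)) → ⟪ a ⟫ ≈ ⟪ b ⟫ → act a ≗ act b
  ≈⇒act a b a≈b x with x ℕₚ.<? n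
  ... | no  x≥n = trans (act-fixes-≥n n a (ℕₚ.≮⇒≥ x≥n)) (sym (act-fixes-≥n n b (ℕₚ.≮⇒≥ x≥n)))
  ... | yes x<n = subst (λ y → act a y ≡ act b y) (Finₚ.toℕ-fromℕ< x<n)
    (trans (sym (toℕ-⟪⟫ a x′)) (trans (cong toℕ (a≈b x′)) (toℕ-⟪⟫ b x′)))
    where x′ = Fin.fromℕ< x<n

  act⇒≈ : ∀ (a b : Word (pred n)) → act a ≗ act b → ⟪ a ⟫ ≈ ⟪ b ⟫
  act⇒≈ a b eq x = Finₚ.toℕ-injective
    (trans (toℕ-⟪⟫ a x) (trans (eq (toℕ x)) (sym (toℕ-⟪⟫ b x))))

  ≈⇒act⁻ : ∀ (a b : Word (pred n)) → ⟪ a ⟫ ≈ ⟪ b ⟫ → act⁻ a ≗ act⁻ b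
  ≈⇒act⁻ a b a≈b = act⇒act⁻ a b (≈⇒act a b a≈b)

  act⁻⇒≈ : ∀ (a b : Word (pred n)) → act⁻ a ≗ act⁻ b → ⟪ a ⟫ ≈ ⟪ b ⟫
  act⁻⇒≈ a b eq = act⇒≈ a b (act⁻⇒act a b eq)

  ∃-asc : ∀ w → ∃ λ b → Asc b × ⟪ b ⟫ ≈ w
  ∃-asc w =
    let b , b≈w = ∃-word n w
        a , _ , asc , a≗b = asc-subword b
    in a , asc , λ x → trans (act⁻⇒≈ a b a≗b x) (b≈w x)

  asc⇒reduced : ∀ {b : Word (pred n)} → Asc b → ⟪ b ⟫ ≈ w → IsReducedWord b w
  asc⇒reduced {w = w} {b = b} asc b≈w = record
    { product = b≈w
    ; minimal = λ c c≈w → asc-minimal asc c (≈⇒act⁻ b c (λ x → trans (b≈w x) (sym (c≈w x))))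
    }

  reduced⇒asc : ∀ {b : Word (pred n)} → IsReducedWord b w → Asc b
  reduced⇒asc {b = b} red =
    let a , a⊆b , asc , a≗b = asc-subword b
    in subst Asc (⊆∧length⇒≡ a⊆b
         (IsReducedWord.minimal red a (λ x → trans (act⁻⇒≈ a b a≗b x) (IsReducedWord.product red x)))) asc

  ⪯⇒≤ᴿ : ∀ (a b : Word (pred n)) → ⟪ a ⟫ ≈ u → ⟪ b ⟫ ≈ w → u ⪯ w → act⁻ a ≤ᴿ act⁻ b
  ⪯⇒≤ᴿ a b a≈u b≈w (a′ , b′ , ra , rb , a′⊆b′) =
    ≤ᴿ-trans (≤ᴿ-reflexive (≈⇒act⁻ a a′ (λ x → trans (a≈u x) (sym (IsReducedWord.product ra x)))))
      (≤ᴿ-trans (⊆⇒≤ᴿ (reduced⇒asc rb) a′⊆b′)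
        (≤ᴿ-reflexive (≈⇒act⁻ b′ b (λ x → trans (IsReducedWord.product rb x) (sym (b≈w x))))))

  -- Ascending words with the same products supply the reduced words that `_⪯_` demands. Bruhat
  -- order is thus a comparison of tables, from which transitivity and antisymmetry are inherited.
  ≤ᴿ⇒⪯ : ∀ (a b : Word (pred n)) → ⟪ a ⟫ ≈ u → ⟪ b ⟫ ≈ w → act⁻ a ≤ᴿ act⁻ b → u ⪯ w
  ≤ᴿ⇒⪯ a b a≈u b≈w a≤b =
    let b′ , _ , asc-b′ , b′≗b = asc-subword b in
    let a′ , a′⊆b′ , asc-a′ , a′≗a = ≤ᴿ⇒⊆ asc-b′ (act⁻-injective a)
          (≤ᴿ-trans a≤b (≤ᴿ-reflexive (sym ∘ b′≗b)))
    in a′ , b′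
     , asc⇒reduced asc-a′ (λ x → trans (act⁻⇒≈ a′ a a′≗a x) (a≈u x))
     , asc⇒reduced asc-b′ (λ x → trans (act⁻⇒≈ b′ b b′≗b x) (b≈w x))
     , a′⊆b′

  ⊆⇒⪯ : ∀ {a b : Word (pred n)} → Asc b → a ⊆ b → ⟪ a ⟫ ≈ u → ⟪ b ⟫ ≈ w → u ⪯ w
  ⊆⇒⪯ {a = a} {b} asc-b a⊆b a≈u b≈w = ≤ᴿ⇒⪯ a b a≈u b≈w (⊆⇒≤ᴿ asc-b a⊆b)

  -- `_⪯_` offers a subword of one particular reduced word of `w`; through the tables, `u` is found
  -- inside whatever word `b` is at hand.
  ⪯⇒⊆ : ∀ (b : Word (pred n)) → ⟪ b ⟫ ≈ w → u ⪯ w → ∃ λ a → a ⊆ b × Asc a × ⟪ a ⟫ ≈ u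
  ⪯⇒⊆ b b≈w u⪯w@(a , _ , ra , _) =
    let b′ , b′⊆b , asc-b′ , b′≗b = asc-subword b in
    let a′ , a′⊆b′ , asc-a′ , a′≗a = ≤ᴿ⇒⊆ asc-b′ (act⁻-injective a)
          (⪯⇒≤ᴿ a b′ (IsReducedWord.product ra) (λ x → trans (act⁻⇒≈ b′ b b′≗b x) (b≈w x)) u⪯w)
    in a′ , ⊆-trans a′⊆b′ b′⊆b , asc-a′
     , λ x → trans (act⁻⇒≈ a′ a a′≗a x) (IsReducedWord.product ra x)

  ⪯-reflexive : u ≈ v → u ⪯ v
  ⪯-reflexive {u = u} u≈v =
    let a , asc , a≈u = ∃-asc u
    in a , a , asc⇒reduced asc a≈u , asc⇒reduced asc (λ x → trans (a≈u x) (u≈v x)) , ⊆-refl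

  ⪯-trans : u ⪯ v → v ⪯ w → u ⪯ w
  ⪯-trans u⪯v@(a , b , ra , rb , _) v⪯w@(_ , c , _ , rc , _) = ≤ᴿ⇒⪯ a c (product ra) (product rc)
    (≤ᴿ-trans (⪯⇒≤ᴿ a b (product ra) (product rb) u⪯v) (⪯⇒≤ᴿ b c (product rb) (product rc) v⪯w))
    where open IsReducedWord

  ⪯-antisym : u ⪯ v → v ⪯ u → u ≈ v
  ⪯-antisym u⪯v@(a , b , ra , rb , _) v⪯u x = trans (sym (product ra x)) (trans
    (act⁻⇒≈ a b (≤ᴿ-antisym (⪯⇒≤ᴿ a b (product ra) (product rb) u⪯v)
                            (⪯⇒≤ᴿ b a (product rb) (product ra) v⪯u)) x) (product rb x))
    where open IsReducedWord

  B-poset : Permutation′ n → Poset 0ℓ 0ℓ 0ℓ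
  B-poset w = record
    { Carrier        = ∃ (_⪯ w)
    ; _≈_            = λ u v → proj₁ u ≈ proj₁ v
    ; _≤_            = λ u v → proj₁ u ⪯ proj₁ v
    ; isPartialOrder = record
      { isPreorder = record
        { isEquivalence = record
          { refl  = λ _ → refl
          ; sym   = λ u≈v x → sym (u≈v x)
          ; trans = λ u≈v v≈w x → trans (u≈v x) (v≈w x)
          }
        ; reflexive = λ {u} {v} → ⪯-reflexive {u = proj₁ u} {v = proj₁ v}
        ; trans     = ⪯-trans
        }
      ; antisym = ⪯-antisym
      }
    }

-- Factorizations p s q

⊆-++⁻ : ∀ {a} {A : Set a} (ys : List A) {xs zs} → xs ⊆ ys ++ zs →
        ∃₂ λ ys′ zs′ → ys′ ⊆ ys × zs′ ⊆ zs × xs ≡ ys′ ++ zs′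
⊆-++⁻ []       xs⊆                = [] , _ , [] , xs⊆ , refl
⊆-++⁻ (y ∷ ys) (.y ∷ʳ xs⊆)        =
  let ys′ , zs′ , ys′⊆ , zs′⊆ , eq = ⊆-++⁻ ys xs⊆
  in ys′ , zs′ , y ∷ʳ ys′⊆ , zs′⊆ , eq
⊆-++⁻ (y ∷ ys) (refl ∷ xs⊆) =
  let ys′ , zs′ , ys′⊆ , zs′⊆ , eq = ⊆-++⁻ ys xs⊆
  in y ∷ ys′ , zs′ , refl ∷ ys′⊆ , zs′⊆ , cong (y ∷_) eq

-- `sw S` moves only `S` and `suc S`. Hence on a side where `e` is the identity, so is `d`, except
-- perhaps at the one moved point; that point stays on its side and, `d` being injective, has only
-- its own place left.
sw-intertwiner : ∀ S {d e : ℕ → ℕ} → Injective _≡_ _≡_ d →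
  (∀ {x} → x ≤ S → d x ≤ S) → (∀ {x} → S < x → S < d x) →
  (∀ {x} → x ≤ S → d x ≡ x) ⊎ (∀ {x} → x ≤ S → e x ≡ x) →
  (∀ {x} → S < x → d x ≡ x) ⊎ (∀ {x} → S < x → e x ≡ x) →
  (∀ x → d (sw S x) ≡ sw S (e x)) → ∀ x → d x ≡ x
sw-intertwiner S {d} {e} d-inj d-≤ d-> low high de x with x ℕₚ.≤? S
... | yes x≤S = fixLow low x≤S
  where
  fixLow : (∀ {x} → x ≤ S → d x ≡ x) ⊎ (∀ {x} → x ≤ S → e x ≡ x) → ∀ {x} → x ≤ S → d x ≡ x
  fixLow (inj₁ d-fix) x≤S = d-fix x≤S
  fixLow (inj₂ e-fix) {x} x≤S = [ fix< , (λ { refl → fixS }) ]′ (ℕₚ.m≤n⇒m<n∨m≡n x≤S)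
    where
    fix< : ∀ {x} → x < S → d x ≡ x
    fix< {x} x<S = trans (cong d (sym (sw-< x<S))) (trans (de x)
      (trans (cong (sw S) (e-fix (ℕₚ.<⇒≤ x<S))) (sw-< x<S)))
    fixS : d S ≡ S
    fixS with ℕₚ.m≤n⇒m<n∨m≡n (d-≤ (≤-refl {S}))
    ... | inj₁ dS<S = d-inj (fix< dS<S)
    ... | inj₂ dS≡S = dS≡S
... | no x≰S = fixHigh high (ℕₚ.≰⇒> x≰S)
  where
  fixHigh : (∀ {x} → S < x → d x ≡ x) ⊎ (∀ {x} → S < x → e x ≡ x) → ∀ {x} → S < x → d x ≡ x
  fixHigh (inj₁ d-fix) S<x = d-fix S<x
  fixHigh (inj₂ e-fix) {x} S<x = [ fix> , (λ { refl → fixS }) ]′ (ℕₚ.m≤n⇒m<n∨m≡n S<x)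
    where
    fix> : ∀ {x} → suc S < x → d x ≡ x
    fix> {x} S<x = trans (cong d (sym (sw-> S<x))) (trans (de x)
      (trans (cong (sw S) (e-fix (ℕₚ.<⇒≤ S<x))) (sw-> S<x)))
    fixS : d (suc S) ≡ suc S
    fixS with ℕₚ.m≤n⇒m<n∨m≡n (d-> (ℕₚ.n<1+n S))
    ... | inj₁ dS>S = d-inj (fix> dS>S)
    ... | inj₂ dS≡S = sym dS≡S

opt : ∀ {m} → Fin m → Bool → Word m
opt s false = []
opt s true  = s ∷ []

⊆-opt⁻ : ∀ {m} (s : Fin m) e {a} → a ⊆ opt s e → ∃ λ e′ → e′ Bool.≤ e × a ≡ opt s e′
⊆-opt⁻ s false []          = false , b≤b , refl
⊆-opt⁻ s true  (.s ∷ʳ [])  = false , f≤t , refl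
⊆-opt⁻ s true  (refl ∷ []) = true , b≤b , refl

opt-mono : ∀ {m} (s : Fin m) {e e′} → e Bool.≤ e′ → opt s e ⊆ opt s e′
opt-mono s f≤t = s ∷ʳ []
opt-mono s b≤b = ⊆-refl

record Factorization {n} (w : Permutation′ n) : Set where
  field
    s        : Fin (pred n)
    p q      : Word (pred n)
    p-avoids : All (λ i → toℕ i ≢ toℕ s) p
    q-avoids : All (λ i → toℕ i ≢ toℕ s) q
    low      : All (λ i → toℕ s < toℕ i) p ⊎ All (λ i → toℕ s < toℕ i) q
    high     : All (λ i → toℕ i < toℕ s) p ⊎ All (λ i → toℕ i < toℕ s) q
    asc      : Asc (p ++ s ∷ q)
    product  : ⟦ p ++ s ∷ q ⟧ ≈ w

module FactorizationPrism {n} {w : Permutation′ n} (F : Factorization w) where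
  open Factorization F
  open Bruhat n

  S = toℕ s

  join : Word (pred n) → Bool → Word (pred n) → Word (pred n)
  join a e c = a ++ opt s e ++ c

  sw? : Bool → ℕ → ℕ
  sw? e = act (opt s e)

  act-join : ∀ a e c x → act (join a e c) x ≡ act a (sw? e (act c x))
  act-join a e c x = trans (act-++ a _ x) (cong (act a) (act-++ (opt s e) c x))

  module _ {a a′ c c′ : Word (pred n)} (a⊆p : a ⊆ p) (a′⊆p : a′ ⊆ p) (c⊆q : c ⊆ q) (c′⊆q : c′ ⊆ q) where
    private
      -- Cancelling `a′` on the left and `c` on the right turns equality of two joins with the same
      -- middle into `d s ≡ s e`, or `d ≡ e` if `s` is absent. By `low` and `high`, on each side of
      -- `s` one of `d` and `e` is the identity.
      d e : ℕ → ℕ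
      d = act⁻ a′ ∘ act a
      e = act c′ ∘ act⁻ c

      a-avoids  = All-resp-⊆ a⊆p p-avoids
      a′-avoids = All-resp-⊆ a′⊆p p-avoids
      c-avoids  = All-resp-⊆ c⊆q q-avoids
      c′-avoids = All-resp-⊆ c′⊆q q-avoids

      fixed : ∀ (b b′ : Word (pred n)) {x} → act b x ≡ x → act b′ x ≡ x → act⁻ b (act b′ x) ≡ x
      fixed b b′ {x} bx b′x = trans (cong (act⁻ b) (trans b′x (sym bx))) (act⁻-act b x)

      fixed⁻ : ∀ (b b′ : Word (pred n)) {x} → act b x ≡ x → act b′ x ≡ x → act b (act⁻ b′ x) ≡ x
      fixed⁻ b b′ {x} bx b′x =
        trans (cong (act b ∘ act⁻ b′) (sym b′x)) (trans (cong (act b) (act⁻-act b′ x)) bx)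

      low′ : (∀ {x} → x ≤ S → d x ≡ x) ⊎ (∀ {x} → x ≤ S → e x ≡ x)
      low′ = Sum.map
        (λ >S x≤ → fixed a′ a (act-fixes-≤ (All-resp-⊆ a′⊆p >S) x≤) (act-fixes-≤ (All-resp-⊆ a⊆p >S) x≤))
        (λ >S x≤ → fixed⁻ c′ c (act-fixes-≤ (All-resp-⊆ c′⊆q >S) x≤) (act-fixes-≤ (All-resp-⊆ c⊆q >S) x≤))
        low

      high′ : (∀ {x} → S < x → d x ≡ x) ⊎ (∀ {x} → S < x → e x ≡ x)
      high′ = Sum.map
        (λ <S S<x → fixed a′ a (act-fixes-> (All-resp-⊆ a′⊆p <S) S<x) (act-fixes-> (All-resp-⊆ a⊆p <S) S<x))
        (λ <S S<x → fixed⁻ c′ c (act-fixes-> (All-resp-⊆ c′⊆q <S) S<x) (act-fixes-> (All-resp-⊆ c⊆q <S) S<x))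
        high

      intertwine : ∀ b → act (join a b c) ≗ act (join a′ b c′) → ∀ x → d (sw? b x) ≡ sw? b (e x)
      intertwine b eq x = trans (cong (act⁻ a′) (trans
          (trans (cong (act a ∘ sw? b) (sym (act-act⁻ c x))) (sym (act-join a b c (act⁻ c x))))
          (trans (eq (act⁻ c x)) (act-join a′ b c′ (act⁻ c x)))))
        (act⁻-act a′ _)

      d≗id : ∀ b → act (join a b c) ≗ act (join a′ b c′) → ∀ x → d x ≡ x
      d≗id true  eq = sw-intertwiner S (act-injective a ∘ act⁻-injective a′)
        (λ x≤ → act⁻-preserves-≤ a′-avoids (act-preserves-≤ a-avoids x≤))
        (λ S<x → act⁻-preserves-> a′-avoids (act-preserves-> a-avoids S<x))
        low′ high′ (intertwine true eq)
      d≗id false eq x with x ℕₚ.≤? S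
      ... | yes x≤S = [ (λ fix → fix x≤S) , (λ fix → trans (intertwine false eq x) (fix x≤S)) ]′ low′
      ... | no  x≰S = [ (λ fix → fix (ℕₚ.≰⇒> x≰S))
                      , (λ fix → trans (intertwine false eq x) (fix (ℕₚ.≰⇒> x≰S))) ]′ high′

    -- Only products containing s carry the position that c sends to S across S.
    crossing-differs : ¬ (act (join a true c) ≗ act (join a′ false c′))
    crossing-differs eq = ℕₚ.<⇒≱ crosses
      (subst (_≤ S) (sym (trans (eq z) (act-join a′ false c′ z)))
        (act-preserves-≤ a′-avoids (act-preserves-≤ c′-avoids (act⁻-preserves-≤ c-avoids (≤-refl {S})))))
      where
      z = act⁻ c S
      crosses : S < act (join a true c) z
      crosses = subst (S <_)
        (sym (trans (act-join a true c z) (cong (act a) (trans (cong (sw S) (act-act⁻ c S)) (sw-i S)))))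
        (act-preserves-> a-avoids ≤-refl)

    join-injective : ∀ b → act (join a b c) ≗ act (join a′ b c′) → act a ≗ act a′ × act c ≗ act c′
    join-injective b eq = a≗a′ , λ x → act-injective (opt s b) (act-injective a
      (trans (sym (act-join a b c x)) (trans (eq x) (trans (act-join a′ b c′ x) (sym (a≗a′ _))))))
      where
      a≗a′ : act a ≗ act a′
      a≗a′ x = trans (sym (act-act⁻ a′ (act a x))) (cong (act a′) (d≗id b eq x))

  join-unique : ∀ {a a′ c c′} → a ⊆ p → a′ ⊆ p → c ⊆ q → c′ ⊆ q → ∀ e e′ →
    ⟪ join a e c ⟫ ≈ ⟪ join a′ e′ c′ ⟫ → e ≡ e′ × ⟪ a ⟫ ≈ ⟪ a′ ⟫ × ⟪ c ⟫ ≈ ⟪ c′ ⟫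
  join-unique {a} {a′} {c} {c′} a⊆p a′⊆p c⊆q c′⊆q e e′ eq = go e e′ (≈⇒act (join a e c) (join a′ e′ c′) eq)
    where
    go : ∀ e e′ → act (join a e c) ≗ act (join a′ e′ c′) → e ≡ e′ × ⟪ a ⟫ ≈ ⟪ a′ ⟫ × ⟪ c ⟫ ≈ ⟪ c′ ⟫
    same : ∀ e → act (join a e c) ≗ act (join a′ e c′) → e ≡ e × ⟪ a ⟫ ≈ ⟪ a′ ⟫ × ⟪ c ⟫ ≈ ⟪ c′ ⟫
    same e eq = let a≗ , c≗ = join-injective a⊆p a′⊆p c⊆q c′⊆q e eq
                in refl , act⇒≈ a a′ a≗ , act⇒≈ c c′ c≗
    go false false eq = same false eq
    go true  true  eq = same true eq
    go true  false eq = contradiction eq (crossing-differs a⊆p a′⊆p c⊆q c′⊆q)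
    go false true  eq = contradiction (sym ∘ eq) (crossing-differs a′⊆p a⊆p c′⊆q c⊆q)

  record Factor (u : Permutation′ n) : Set where
    field
      left right  : Word (pred n)
      hasS        : Bool
      left⊆p      : left ⊆ p
      right⊆q     : right ⊆ q
      factor-asc  : Asc (join left hasS right)
      factor-prod : ⟪ join left hasS right ⟫ ≈ u

    left-asc : Asc left
    left-asc = asc-++ˡ left factor-asc

    right-asc : Asc right
    right-asc = asc-++ʳ (opt s hasS) (asc-++ʳ left factor-asc)

  open Factor

  factor : ∀ {u} → u ⪯ w → Factor u
  factor u⪯w with ⪯⇒⊆ (p ++ s ∷ q) product u⪯w
  ... | a , a⊆b , asc-a , a≈u with ⊆-++⁻ p a⊆b
  ...   | p′ , _ , p′⊆p , sq⊆ , refl with ⊆-++⁻ (s ∷ []) sq⊆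
  ...     | _ , q′ , s⊆ , q′⊆q , refl with ⊆-opt⁻ s true s⊆
  ...       | e , _ , refl = record
    { left = p′ ; right = q′ ; hasS = e ; left⊆p = p′⊆p ; right⊆q = q′⊆q
    ; factor-asc = asc-a ; factor-prod = a≈u }

  p-asc : Asc p
  p-asc = asc-++ˡ p asc

  q-asc : Asc q
  q-asc = asc-++ʳ (s ∷ []) (asc-++ʳ p asc)

  X : Poset 0ℓ 0ℓ 0ℓ
  X = ×-poset (B-poset ⟪ p ⟫) (B-poset ⟪ q ⟫)

  private
    module 2×X = Poset (×-poset 𝟚 X)

  module _ {u v : Permutation′ n} (Fu : Factor u) (Fv : Factor v) where

    -- `u` is found inside the word chosen for `v`, which splits it into subwords of the three
    -- parts; by uniqueness these agree with the parts chosen for `u`.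
    factor-mono : u ⪯ v → hasS Fu Bool.≤ hasS Fv ×
      (⟪ left Fu ⟫ ⪯ ⟪ left Fv ⟫ × ⟪ right Fu ⟫ ⪯ ⟪ right Fv ⟫)
    factor-mono u⪯v with ⪯⇒⊆ _ (factor-prod Fv) u⪯v
    ... | a , a⊆b , asc-a , a≈u with ⊆-++⁻ (left Fv) a⊆b
    ...   | p′ , _ , p′⊆ , sq⊆ , refl with ⊆-++⁻ (opt s (hasS Fv)) sq⊆
    ...     | _ , q′ , s⊆ , q′⊆ , refl with ⊆-opt⁻ s (hasS Fv) s⊆
    ...       | e , e≤ , refl
      with join-unique (left⊆p Fu) (⊆-trans p′⊆ (left⊆p Fv)) (right⊆q Fu) (⊆-trans q′⊆ (right⊆q Fv))
             (hasS Fu) e (λ x → trans (factor-prod Fu x) (sym (a≈u x)))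
    ...         | refl , p≈ , q≈ =
      e≤ , ⊆⇒⪯ (left-asc Fv) p′⊆ (λ x → sym (p≈ x)) (λ _ → refl)
         , ⊆⇒⪯ (right-asc Fv) q′⊆ (λ x → sym (q≈ x)) (λ _ → refl)

    factor-cancel : hasS Fu Bool.≤ hasS Fv →
      ⟪ left Fu ⟫ ⪯ ⟪ left Fv ⟫ → ⟪ right Fu ⟫ ⪯ ⟪ right Fv ⟫ → u ⪯ v
    factor-cancel e≤ l⪯ r⪯ =
      let l , l⊆ , _ , l≈ = ⪯⇒⊆ (left Fv) (λ _ → refl) l⪯
          r , r⊆ , _ , r≈ = ⪯⇒⊆ (right Fv) (λ _ → refl) r⪯
          eq : act (join l (hasS Fu) r) ≗ act (join (left Fu) (hasS Fu) (right Fu))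
          eq x = trans (act-join l (hasS Fu) r x) (trans
            (trans (≈⇒act l (left Fu) l≈ _)
              (cong (act (left Fu) ∘ sw? (hasS Fu)) (≈⇒act r (right Fu) r≈ x)))
            (sym (act-join (left Fu) (hasS Fu) (right Fu) x)))
      in ⊆⇒⪯ (factor-asc Fv) (++⁺ l⊆ (++⁺ (opt-mono s e≤) r⊆))
           (λ x → trans (act⇒≈ (join l (hasS Fu) r) (join (left Fu) (hasS Fu) (right Fu)) eq x) (factor-prod Fu x)) (factor-prod Fv)

  φ : ∃ (_⪯ w) → 2×X.Carrier
  φ (u , u⪯w) = hasS f
    , (⟪ left f ⟫ , ⊆⇒⪯ p-asc (left⊆p f) (λ _ → refl) (λ _ → refl))
    , (⟪ right f ⟫ , ⊆⇒⪯ q-asc (right⊆q f) (λ _ → refl) (λ _ → refl))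
    where f = factor u⪯w

  isPrism : IsPrism w
  isPrism = X , φ , record
    { isOrderMonomorphism = record
      { isOrderHomomorphism = record
        -- `φ` depends on the proof of `u ⪯ w` through the subword found, so congruence is drawn
        -- from monotonicity in both directions.
        { cong = λ {x} {y} x≈y →
            let ⪯xy = ⪯-reflexive {u = proj₁ x} {v = proj₁ y} x≈y
                ⪯yx = ⪯-reflexive {u = proj₁ y} {v = proj₁ x} (sym ∘ x≈y)
            in 2×X.antisym {φ x} {φ y} (φ-mono x y ⪯xy) (φ-mono y x ⪯yx)
        ; mono = λ {x} {y} → φ-mono x y
        }
      ; injective = λ {x} {y} φx≈φy → ⪯-antisym
          (φ-cancel x y (2×X.reflexive {φ x} {φ y} φx≈φy))
          (φ-cancel y x (2×X.reflexive {φ y} {φ x} (2×X.Eq.sym {φ x} {φ y} φx≈φy)))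
      ; cancel = λ {x} {y} → φ-cancel x y
      }
    ; surjective = surj
    }
    where
    φ-mono : ∀ x y → proj₁ x ⪯ proj₁ y → 2×X._≤_ (φ x) (φ y)
    φ-mono (_ , x⪯w) (_ , y⪯w) = factor-mono (factor x⪯w) (factor y⪯w)

    φ-cancel : ∀ x y → 2×X._≤_ (φ x) (φ y) → proj₁ x ⪯ proj₁ y
    φ-cancel (_ , x⪯w) (_ , y⪯w) (e≤ , l⪯ , r⪯) =
      factor-cancel (factor x⪯w) (factor y⪯w) e≤ l⪯ r⪯

    surj : Surjective (λ u v → proj₁ u ≈ proj₁ v) (2×X._≈_) φ
    surj (e , (u , u⪯p) , (v , v⪯q)) =
      surjAt e (⪯⇒⊆ p (λ _ → refl) u⪯p) (⪯⇒⊆ q (λ _ → refl) v⪯q)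
      where
      surjAt : ∀ e → (∃ λ a → a ⊆ p × Asc a × ⟪ a ⟫ ≈ u) → (∃ λ c → c ⊆ q × Asc c × ⟪ c ⟫ ≈ v) →
        ∃ λ x → ∀ {z} → proj₁ z ≈ proj₁ x →
          proj₁ (φ z) ≡ e × proj₁ (proj₁ (proj₂ (φ z))) ≈ u × proj₁ (proj₂ (proj₂ (φ z))) ≈ v
      surjAt e (a , a⊆p , _ , a≈u) (c , c⊆q , _ , c≈v) =
        (⟪ join a e c ⟫
        , ⊆⇒⪯ asc (++⁺ a⊆p (++⁺ (opt-mono s (Boolₚ.≤-maximum e)) c⊆q)) (λ _ → refl) product)
        -- The parts found for `z` need not be the words `a` and `c`; uniqueness identifies their
        -- products.
        , λ {z} z≈ →
          let f = factor (proj₂ z)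
              e≡ , l≈ , r≈ = join-unique (left⊆p f) a⊆p (right⊆q f) c⊆q (hasS f) e
                               (λ x → trans (factor-prod f x) (z≈ x))
          in e≡ , (λ x → trans (l≈ x) (a≈u x)) , (λ x → trans (r≈ x) (c≈v x))

-- Either of Rest≤ and Rest> implies the other, by counting.
record Crossing {n} (w : Permutation′ n) : Set where
  field
    i        : ℕ
    j k      : Fin n
    j≤i      : toℕ j ≤ i
    i<k      : i < toℕ k
    i<wj     : i < toℕ (w ⟨$⟩ʳ j)
    wk≤i     : toℕ (w ⟨$⟩ʳ k) ≤ i
    lowSide  : toℕ j ≡ i ⊎ toℕ (w ⟨$⟩ʳ k) ≡ i
    highSide : toℕ k ≡ suc i ⊎ toℕ (w ⟨$⟩ʳ j) ≡ suc i

  Rest≤ Rest> : Set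
  Rest≤ = ∀ x → toℕ x ≤ i → x ≢ j → toℕ (w ⟨$⟩ʳ x) ≤ i
  Rest> = ∀ x → i < toℕ x → x ≢ k → i < toℕ (w ⟨$⟩ʳ x)

-- From a crossing to a factorization

act-∷ʳ : ∀ {m} (c : Word m) l x → act (c List.∷ʳ l) x ≡ act c (sw (toℕ l) x)
act-∷ʳ c l x = act-++ c (l ∷ []) x

act-reverse : ∀ {m} (c : Word m) x → act (List.reverse c) x ≡ act⁻ c x
act-reverse []      x = refl
act-reverse (l ∷ c) x = trans (cong (λ d → act d x) (unfold-reverse l c))
  (trans (act-∷ʳ (List.reverse c) l x) (act-reverse c (sw (toℕ l) x)))

below-letters above-letters : ∀ {m} → ℕ → Word m → Word m
below-letters i = List.filter (λ l → toℕ l ℕₚ.<? i)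
above-letters i = List.filter (λ l → i ℕₚ.<? toℕ l)

-- A word without `i` keeps such a point on its side, where the letters above `i` never move it.
act-below : ∀ {m} i {c : Word m} → All (λ l → toℕ l ≢ i) c → ∀ {x} → x ≤ i →
            act (below-letters i c) x ≡ act c x
act-below i []                x≤i = refl
act-below i (_∷_ {l} {c} l≢i c≢i) x≤i with toℕ l ℕₚ.<? i
... | yes l<i rewrite filter-accept (λ l → toℕ l ℕₚ.<? i) {xs = c} l<i = cong (sw (toℕ l)) (act-below i c≢i x≤i)
... | no  l≮i rewrite filter-reject (λ l → toℕ l ℕₚ.<? i) {xs = c} l≮i = trans (act-below i c≢i x≤i) (sym (sw-< (ℕₚ.≤-<-trans (act-preserves-≤ c≢i x≤i)
                  (ℕₚ.≤∧≢⇒< (ℕₚ.≮⇒≥ l≮i) (l≢i ∘ sym)))))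

act-above : ∀ {m} i {c : Word m} → All (λ l → toℕ l ≢ i) c → ∀ {x} → i < x →
            act (above-letters i c) x ≡ act c x
act-above i []                i<x = refl
act-above i (_∷_ {l} {c} l≢i c≢i) i<x with i ℕₚ.<? toℕ l
... | yes i<l rewrite filter-accept (λ l → i ℕₚ.<? toℕ l) {xs = c} i<l = cong (sw (toℕ l)) (act-above i c≢i i<x)
... | no  i≮l rewrite filter-reject (λ l → i ℕₚ.<? toℕ l) {xs = c} i≮l = trans (act-above i c≢i i<x) (sym (sw-> (ℕₚ.≤-<-trans
                  (ℕₚ.≤∧≢⇒< (ℕₚ.≮⇒≥ i≮l) l≢i) (act-preserves-> c≢i i<x))))

module _ {n : ℕ} where
  open Bruhat n

  -- An ascending word avoids `i` once its inverse preserves `x ≤ i`. If it is `v` that does so, a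
  -- word for the inverse of `v` is read backwards; if `v` preserves `i < x`, its inverse preserves
  -- the complement.
  preserves⇒avoiding-word : ∀ (v : Permutation′ n) i →
    (∀ x → toℕ x ≤ i → toℕ (v ⟨$⟩ʳ x) ≤ i) ⊎ (∀ x → i < toℕ x → i < toℕ (v ⟨$⟩ʳ x)) →
    ∃ λ c → ⟪ c ⟫ ≈ v × All (λ l → toℕ l ≢ i) c
  preserves⇒avoiding-word v i (inj₁ pres) =
    let c , asc , c≈v⁻¹ = ∃-asc (Perm.flip v)
        c⁻≗v : ∀ x → act⁻ c (toℕ x) ≡ toℕ (v ⟨$⟩ʳ x)
        c⁻≗v x = trans (cong (act⁻ c) (sym (trans (sym (toℕ-⟪⟫ c (v ⟨$⟩ʳ x)))
          (cong toℕ (trans (c≈v⁻¹ (v ⟨$⟩ʳ x)) (Perm.inverseˡ v)))))) (act⁻-act c _)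
        pres⁻ : ∀ {x} → x ≤ i → act⁻ c x ≤ i
        pres⁻ {x} x≤i = case x ℕₚ.<? n of λ
          { (yes x<n) → subst (λ y → act⁻ c y ≤ i) (Finₚ.toℕ-fromℕ< x<n)
              (subst (_≤ i) (sym (c⁻≗v (Fin.fromℕ< x<n)))
                (pres _ (subst (_≤ i) (sym (Finₚ.toℕ-fromℕ< x<n)) x≤i)))
          ; (no x≮n) → subst (_≤ i) (trans (sym (act⁻-act c x))
              (cong (act⁻ c) (act-fixes-≥n n c (ℕₚ.≮⇒≥ x≮n)))) x≤i
          }
    in List.reverse c
     , (λ x → Finₚ.toℕ-injective (trans (toℕ-⟪⟫ (List.reverse c) x)
         (trans (act-reverse c (toℕ x)) (c⁻≗v x))))
     , All.tabulate (All.lookup (preserves-≤⇒avoids asc pres⁻) ∘ Anyₚ.reverse⁻)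
  preserves⇒avoiding-word v i (inj₂ pres) =
    let c , asc , c≈v = ∃-asc v
        pres> : ∀ {x} → i < x → i < act c x
        pres> {x} i<x = case x ℕₚ.<? n of λ
          { (yes x<n) → subst (λ y → i < act c y) (Finₚ.toℕ-fromℕ< x<n)
              (subst (i <_) (trans (cong toℕ (sym (c≈v _))) (toℕ-⟪⟫ c _))
                (pres _ (subst (i <_) (sym (Finₚ.toℕ-fromℕ< x<n)) i<x)))
          ; (no x≮n) → subst (i <_) (sym (act-fixes-≥n n c (ℕₚ.≮⇒≥ x≮n))) i<x
          }
    in c , c≈v , preserves-≤⇒avoids asc λ {x} x≤i → ℕₚ.≮⇒≥ λ i<y →
         ℕₚ.<⇒≱ (subst (i <_) (act-act⁻ c x) (pres> i<y)) x≤i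

  module _ {w : Permutation′ n} (C : Crossing w) where
    open Crossing C

    private
      -- Exchanging the values at `j` and `k` undoes the crossing of `i`.
      v : Permutation′ n
      v = Perm.transpose j k ∘ₚ w

      k≢j : k ≢ j
      k≢j refl = ℕₚ.<⇒≱ i<k j≤i

      vj : v ⟨$⟩ʳ j ≡ w ⟨$⟩ʳ k
      vj rewrite dec-true (j Finₚ.≟ j) refl = refl

      vk : v ⟨$⟩ʳ k ≡ w ⟨$⟩ʳ j
      vk rewrite dec-false (k Finₚ.≟ j) k≢j | dec-true (k Finₚ.≟ k) refl = refl

      v-rest : ∀ {x} → x ≢ j → x ≢ k → v ⟨$⟩ʳ x ≡ w ⟨$⟩ʳ x
      v-rest {x} x≢j x≢k
        rewrite dec-false (x Finₚ.≟ j) x≢j | dec-false (x Finₚ.≟ k) x≢k = refl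

      v-pres : Rest≤ ⊎ Rest> →
        (∀ x → toℕ x ≤ i → toℕ (v ⟨$⟩ʳ x) ≤ i) ⊎ (∀ x → i < toℕ x → i < toℕ (v ⟨$⟩ʳ x))
      v-pres (inj₁ rest) = inj₁ λ x x≤i → case x Finₚ.≟ j of λ
        { (yes refl) → subst (λ y → toℕ y ≤ i) (sym vj) wk≤i
        ; (no x≢j)   → subst (λ y → toℕ y ≤ i)
            (sym (v-rest x≢j λ { refl → ℕₚ.<⇒≱ i<k x≤i })) (rest x x≤i x≢j)
        }
      v-pres (inj₂ rest) = inj₂ λ x i<x → case x Finₚ.≟ k of λ
        { (yes refl) → subst (λ y → i < toℕ y) (sym vk) i<wj
        ; (no x≢k)   → subst (λ y → i < toℕ y)
            (sym (v-rest (λ { refl → ℕₚ.<⇒≱ i<x j≤i }) x≢k)) (rest x i<x x≢k)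
        }

      s : Fin (pred n)
      s = Fin.fromℕ< (ℕₚ.<-≤-trans i<k (ℕₚ.pred-mono-≤ (Finₚ.toℕ<n k)))

      toℕ-s : toℕ s ≡ i
      toℕ-s = Finₚ.toℕ-fromℕ< _

    module _ (c : Word (pred n)) (c≈v : ⟪ c ⟫ ≈ v) (c≢i : All (λ l → toℕ l ≢ i) c) where
      private
        act-c : ∀ x → act c (toℕ x) ≡ toℕ (v ⟨$⟩ʳ x)
        act-c x = trans (sym (toℕ-⟪⟫ c x)) (cong toℕ (c≈v x))

        cj : act c (toℕ j) ≡ toℕ (w ⟨$⟩ʳ k)
        cj = trans (act-c j) (cong toℕ vj)

        ck : act c (toℕ k) ≡ toℕ (w ⟨$⟩ʳ j)
        ck = trans (act-c k) (cong toℕ vk)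

        -- The letters below i may stay to the left of s if j = i; otherwise
        -- they go to its right, where they move j to i. Similarly above i.
        below-split : ∃₂ λ (l r : Word (pred n)) → All (λ t → toℕ t < i) l × All (λ t → toℕ t < i) r ×
          (l ≡ [] ⊎ r ≡ []) × act r (toℕ j) ≡ i × (∀ {x} → x ≤ i → act l (act r x) ≡ act c x)
        below-split = case lowSide of λ
          { (inj₁ j≡i)  → c₁ , [] , c₁<i , [] , inj₂ refl , j≡i , λ {x} x≤i → act-below i c≢i x≤i
          ; (inj₂ wk≡i) → [] , c₁ , [] , c₁<i , inj₁ refl
                        , trans (act-below i c≢i j≤i) (trans cj wk≡i) , λ {x} x≤i → act-below i c≢i x≤i
          }
          where
          c₁   = below-letters i c
          c₁<i = Allₚ.all-filter (λ l → toℕ l ℕₚ.<? i) c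

        above-split : ∃₂ λ (l r : Word (pred n)) → All (λ t → i < toℕ t) l × All (λ t → i < toℕ t) r ×
          (l ≡ [] ⊎ r ≡ []) × act r (toℕ k) ≡ suc i × (∀ {x} → i < x → act l (act r x) ≡ act c x)
        above-split = case highSide of λ
          { (inj₁ k≡1+i)  → c₂ , [] , c₂>i , [] , inj₂ refl , k≡1+i , λ {x} i<x → act-above i c≢i i<x
          ; (inj₂ wj≡1+i) → [] , c₂ , [] , c₂>i , inj₁ refl
                          , trans (act-above i c≢i i<k) (trans ck wj≡1+i) , λ {x} i<x → act-above i c≢i i<x
          }
          where
          c₂   = above-letters i c
          c₂>i = Allₚ.all-filter (λ l → i ℕₚ.<? toℕ l) c

      module Assemble
        (l₁ r₁ l₂ r₂ : Word (pred n))
        (l₁< : All (λ t → toℕ t < i) l₁) (r₁< : All (λ t → toℕ t < i) r₁)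
        (l₂> : All (λ t → i < toℕ t) l₂) (r₂> : All (λ t → i < toℕ t) r₂)
        (one₁ : l₁ ≡ [] ⊎ r₁ ≡ []) (one₂ : l₂ ≡ [] ⊎ r₂ ≡ [])
        (r₁j : act r₁ (toℕ j) ≡ i) (r₂k : act r₂ (toℕ k) ≡ suc i)
        (l₁r₁ : ∀ {x} → x ≤ i → act l₁ (act r₁ x) ≡ act c x)
        (l₂r₂ : ∀ {x} → i < x → act l₂ (act r₂ x) ≡ act c x)
        where

        p₀ q₀ : Word (pred n)
        p₀ = l₁ ++ l₂
        q₀ = r₁ ++ r₂

        private
          -- When `sw i` acts, `r₁` and `r₂` have brought `j` to `i` and `k` to `suc i` and all
          -- other points elsewhere, so it exchanges just these two, which turns `v` back into `w`.
          eval : ∀ x → act l₁ (act l₂ (sw i (act r₁ (act r₂ (toℕ x))))) ≡ toℕ (w ⟨$⟩ʳ x)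
          eval x with toℕ x ℕₚ.≤? i
          ... | yes x≤i rewrite act-fixes-≤ r₂> x≤i with x Finₚ.≟ j
          ...   | yes refl rewrite r₁j | sw-i i = trans
            (cong (act l₁) (trans (cong (act l₂) (sym r₂k)) (l₂r₂ i<k)))
            (trans (act-fixes-> l₁< (act-preserves-> c≢i i<k)) ck)
          ...   | no x≢j = trans
            (cong (act l₁) (trans (cong (act l₂) (sw-< r₁x<i)) (act-fixes-≤ l₂> (ℕₚ.<⇒≤ r₁x<i))))
            (trans (l₁r₁ x≤i) (trans (act-c x)
              (cong toℕ (v-rest x≢j λ { refl → ℕₚ.<⇒≱ i<k x≤i }))))
            where
            r₁x<i : act r₁ (toℕ x) < i
            r₁x<i = ℕₚ.≤∧≢⇒< (act-preserves-≤ (All.map ℕₚ.<⇒≢ r₁<) x≤i)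
              λ eq → x≢j (Finₚ.toℕ-injective (act-injective r₁ (trans eq (sym r₁j))))
          eval x | no x≰i rewrite act-fixes-> r₁< (act-preserves-> {c = r₂} (All.map ℕₚ.>⇒≢ r₂>) (ℕₚ.≰⇒> x≰i))
            with x Finₚ.≟ k
          ...   | yes refl rewrite r₂k | sw-1+i i = trans
            (cong (act l₁) (trans (act-fixes-≤ l₂> ≤-refl) (sym r₁j)))
            (trans (l₁r₁ j≤i) cj)
          ...   | no x≢k = trans
            (cong (act l₁) (trans (cong (act l₂) (sw-> r₂x>1+i)) (l₂r₂ i<x)))
            (trans (act-fixes-> l₁< (act-preserves-> c≢i i<x)) (trans (act-c x)
              (cong toℕ (v-rest (λ { refl → x≰i j≤i }) x≢k))))
            where
            i<x = ℕₚ.≰⇒> x≰i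
            r₂x>1+i : suc i < act r₂ (toℕ x)
            r₂x>1+i = ℕₚ.≤∧≢⇒< (act-preserves-> (All.map ℕₚ.>⇒≢ r₂>) i<x)
              λ eq → x≢k (Finₚ.toℕ-injective (act-injective r₂ (trans (sym eq) (sym r₂k))))

          b₀≈w : ⟪ p₀ ++ s ∷ q₀ ⟫ ≈ w
          b₀≈w x = Finₚ.toℕ-injective (trans (toℕ-⟪⟫ (p₀ ++ s ∷ q₀) x)
            (trans (act-++ p₀ (s ∷ q₀) (toℕ x)) (trans (act-++ l₁ l₂ _)
              (trans (cong (act l₁ ∘ act l₂) (cong₂ sw toℕ-s (act-++ r₁ r₂ (toℕ x)))) (eval x)))))

          p₀≢i : All (λ t → toℕ t ≢ i) p₀
          p₀≢i = Allₚ.++⁺ (All.map ℕₚ.<⇒≢ l₁<) (All.map ℕₚ.>⇒≢ l₂>)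

          q₀≢i : All (λ t → toℕ t ≢ i) q₀
          q₀≢i = Allₚ.++⁺ (All.map ℕₚ.<⇒≢ r₁<) (All.map ℕₚ.>⇒≢ r₂>)

          no-low : All (λ t → i < toℕ t) p₀ ⊎ All (λ t → i < toℕ t) q₀
          no-low = case one₁ of λ { (inj₁ refl) → inj₁ l₂> ; (inj₂ refl) → inj₂ r₂> }

          no-high : All (λ t → toℕ t < i) p₀ ⊎ All (λ t → toℕ t < i) q₀
          no-high = case one₂ of λ
            { (inj₁ refl) → inj₁ (Allₚ.++⁺ l₁< []) ; (inj₂ refl) → inj₂ (Allₚ.++⁺ r₁< []) }

          s-needed : ∀ {p q} → All (λ t → toℕ t ≢ i) p → All (λ t → toℕ t ≢ i) q → ¬ (⟪ p ++ q ⟫ ≈ w)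
          s-needed {p} {q} p≢i q≢i pq≈w = ℕₚ.<⇒≱ i<wj (subst (_≤ i)
            (trans (sym (toℕ-⟪⟫ (p ++ q) j)) (cong toℕ (pq≈w j)))
            (act-preserves-≤ (Allₚ.++⁺ p≢i q≢i) j≤i))

        factorization : Factorization w
        -- An ascending subword inherits every condition on letters. It cannot lose `s`, without
        -- which nothing would carry `j` past `i`.
        factorization with asc-subword (p₀ ++ s ∷ q₀)
        ... | a , a⊆ , asc-a , a≗ with ⊆-++⁻ p₀ a⊆
        ...   | p , _ , p⊆ , (.s ∷ʳ q⊆)  , refl = contradiction
          (λ x → trans (act⁻⇒≈ (p ++ _) (p₀ ++ s ∷ q₀) a≗ x) (b₀≈w x))
          (s-needed (All-resp-⊆ p⊆ p₀≢i) (All-resp-⊆ q⊆ q₀≢i))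
        ...   | p , .(s ∷ _) , p⊆ , (_∷_ {xs = q} refl q⊆) , refl = record
          { s = s ; p = p ; q = q
          ; p-avoids = subst (λ i → All (λ t → toℕ t ≢ i) p) (sym toℕ-s) (All-resp-⊆ p⊆ p₀≢i)
          ; q-avoids = subst (λ i → All (λ t → toℕ t ≢ i) q) (sym toℕ-s) (All-resp-⊆ q⊆ q₀≢i)
          ; low  = subst (λ i → All (λ t → i < toℕ t) p ⊎ All (λ t → i < toℕ t) q) (sym toℕ-s)
                     (Sum.map (All-resp-⊆ p⊆) (All-resp-⊆ q⊆) no-low)
          ; high = subst (λ i → All (λ t → toℕ t < i) p ⊎ All (λ t → toℕ t < i) q) (sym toℕ-s)
                     (Sum.map (All-resp-⊆ p⊆) (All-resp-⊆ q⊆) no-high)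
          ; asc  = asc-a
          ; product = λ x → trans (act⁻⇒≈ (p ++ s ∷ q) (p₀ ++ s ∷ q₀) a≗ x) (b₀≈w x)
          }

      crossing-factorization : Factorization w
      crossing-factorization =
        let l₁ , r₁ , l₁< , r₁< , one₁ , r₁j , l₁r₁ = below-split
            l₂ , r₂ , l₂> , r₂> , one₂ , r₂k , l₂r₂ = above-split
        in Assemble.factorization l₁ r₁ l₂ r₂ l₁< r₁< l₂> r₂> one₁ one₂ r₁j r₂k l₁r₁ l₂r₂

    crossing⇒prism : Rest≤ ⊎ Rest> → IsPrism w
    crossing⇒prism rest =
      let c , c≈v , c≢i = preserves⇒avoiding-word v i (v-pres rest)
      in FactorizationPrism.isPrism (crossing-factorization c c≈v c≢i)

-- The isomorphism of a prism

sw-asc : ∀ {g i} → g ≢ i → sw g i < sw g (suc i)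
sw-asc g≢i = ℕₚ.≤-<-trans (sw-preserves-≤ g≢i ≤-refl) (sw-preserves-> g≢i ≤-refl)

-- sw i raises i, and no other adjacent transposition carries anything across i.
sw-index-injective : ∀ {g i} → sw g ≗ sw i → g ≡ i
sw-index-injective {g} {i} eq with g ℕₚ.≟ i
... | yes g≡i = g≡i
... | no  g≢i = contradiction (sw-preserves-≤ g≢i (≤-refl {i}))
  (ℕₚ.<⇒≱ (≤-reflexive (sym (trans (eq i) (sw-i i)))))

sw-noncommuting : ∀ i → ¬ (∀ x → sw i (sw (suc i) x) ≡ sw (suc i) (sw i x))
sw-noncommuting i eq = ℕₚ.<⇒≢ (ℕₚ.n<1+n (suc i)) (trans (sym left) (trans (eq i) right))
  where
  left : sw i (sw (suc i) i) ≡ suc i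
  left = trans (cong (sw i) (sw-< (ℕₚ.n<1+n i))) (sw-i i)
  right : sw (suc i) (sw i i) ≡ suc (suc i)
  right = trans (cong (sw (suc i)) (sw-i i)) (sw-i (suc i))

Adjacent : ℕ → ℕ → Set
Adjacent g h = g ≡ suc h ⊎ h ≡ suc g

adjacent-noncommuting : ∀ {g h} → Adjacent g h → ¬ (∀ x → sw g (sw h x) ≡ sw h (sw g x))
adjacent-noncommuting {h = h} (inj₁ refl) eq = sw-noncommuting h (sym ∘ eq)
adjacent-noncommuting {g}     (inj₂ refl) eq = sw-noncommuting g eq

adjacent⇒≢ : ∀ {g h} → Adjacent g h → g ≢ h
adjacent⇒≢ (inj₁ refl) = ℕₚ.>⇒≢ (ℕₚ.n<1+n _)
adjacent⇒≢ (inj₂ refl) = ℕₚ.<⇒≢ (ℕₚ.n<1+n _)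

HasPair : ∀ {m} → ℕ → ℕ → Word m → Set
HasPair g h b = ∃₂ λ γ η → toℕ γ ≡ g × toℕ η ≡ h × γ ∷ η ∷ [] ⊆ b

has-letter? : ∀ {m} h (c : Word m) → (∃ λ η → toℕ η ≡ h × η ∷ [] ⊆ c) ⊎ All (λ l → toℕ l ≢ h) c
has-letter? h []      = inj₂ []
has-letter? h (l ∷ c) with toℕ l ℕₚ.≟ h
... | yes l≡h = inj₁ (l , l≡h , refl ∷ minimum c)
... | no  l≢h = Sum.map (λ { (η , η≡h , η∈c) → η , η≡h , l ∷ʳ η∈c }) (l≢h ∷_) (has-letter? h c)

skip-pair : ∀ {m g h l} {c : Word m} → HasPair g h c → HasPair g h (l ∷ c)
skip-pair {l = l} (γ , η , γ≡ , η≡ , sub) = γ , η , γ≡ , η≡ , l ∷ʳ sub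

-- To pass from `h` or below to beyond `g`, a point has to be moved by the letter `h` and afterwards
-- by the letter `g`. Letters act from the right, so `g` then stands before `h`.
pair-≤ : ∀ {m g h} → h < g → (b : Word m) → HasPair g h b ⊎ (∀ {x} → x ≤ h → act b x ≤ g)
pair-≤ h<g [] = inj₂ λ x≤h → ℕₚ.<⇒≤ (ℕₚ.≤-<-trans x≤h h<g)
pair-≤ {g = g} {h} h<g (l ∷ c) with toℕ l ℕₚ.≟ g
... | no  l≢g  = Sum.map skip-pair (λ pres x≤h → sw-preserves-≤ l≢g (pres x≤h)) (pair-≤ h<g c)
... | yes refl = Sum.map (λ { (η , η≡h , η∈c) → l , η , refl , η≡h , refl ∷ η∈c })
  (λ c≢h x≤h → let cx<l = ℕₚ.≤-<-trans (act-preserves-≤ c≢h x≤h) h<g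
               in subst (_≤ toℕ l) (sym (sw-< cx<l)) (ℕₚ.<⇒≤ cx<l))
  (has-letter? h c)

pair-> : ∀ {m g h} → g < h → (b : Word m) → HasPair g h b ⊎ (∀ {x} → h < x → g < act b x)
pair-> g<h [] = inj₂ (ℕₚ.<-trans g<h)
pair-> {g = g} {h} g<h (l ∷ c) with toℕ l ℕₚ.≟ g
... | no  l≢g  = Sum.map skip-pair (λ pres h<x → sw-preserves-> l≢g (pres h<x)) (pair-> g<h c)
... | yes refl = Sum.map (λ { (η , η≡h , η∈c) → l , η , refl , η≡h , refl ∷ η∈c })
  (λ c≢h h<x → let l<cx = ℕₚ.≤-<-trans g<h (act-preserves-> c≢h h<x)
               in subst (toℕ l <_) (sym (sw-> l<cx)) (ℕₚ.<-trans (ℕₚ.n<1+n _) l<cx))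
  (has-letter? h c)

subwords-of-pair : ∀ {A : Set} {x y : A} {a} → a ⊆ x ∷ y ∷ [] →
  (a ≡ [] ⊎ a ≡ x ∷ []) ⊎ (a ≡ y ∷ [] ⊎ a ≡ x ∷ y ∷ [])
subwords-of-pair (_ ∷ʳ _ ∷ʳ [])    = inj₁ (inj₁ refl)
subwords-of-pair (_ ∷ʳ refl ∷ [])  = inj₂ (inj₁ refl)
subwords-of-pair (refl ∷ _ ∷ʳ [])  = inj₁ (inj₂ refl)
subwords-of-pair (refl ∷ refl ∷ []) = inj₂ (inj₂ refl)

module PrismCrossing {n} {w : Permutation′ n} (X : Poset 0ℓ 0ℓ 0ℓ)
  (φ : ∃ (_⪯ w) → Bool × Poset.Carrier X)
  (iso : IsOrderIsomorphism (λ u v → proj₁ u ≈ proj₁ v) (Poset._≈_ (×-poset 𝟚 X))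
           (λ u v → proj₁ u ⪯ proj₁ v) (Poset._≤_ (×-poset 𝟚 X)) φ)
  (b : Word (pred n)) (asc-b : Asc b) (b≈w : ⟦ b ⟧ ≈ w)
  where

  open Bruhat n

  private
    module X = Poset X

    BW : Set
    BW = ∃ (_⪯ w)

    e-of : BW → Bool
    e-of u = proj₁ (φ u)

    x-of : BW → X.Carrier
    x-of u = proj₂ (φ u)

    mono : ∀ (u v : BW) → proj₁ u ⪯ proj₁ v → e-of u Bool.≤ e-of v × x-of u X.≤ x-of v
    mono u v = IsOrderIsomorphism.mono iso {u} {v}

    cancel : ∀ (u v : BW) → e-of u Bool.≤ e-of v → x-of u X.≤ x-of v → proj₁ u ⪯ proj₁ v
    cancel u v e≤ x≤ = IsOrderIsomorphism.cancel iso {u} {v} (e≤ , x≤)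

    cong-φ : ∀ (u v : BW) → proj₁ u ≈ proj₁ v → e-of u ≡ e-of v × x-of u X.≈ x-of v
    cong-φ u v = IsOrderIsomorphism.cong iso {u} {v}

    inj : ∀ (u v : BW) → e-of u ≡ e-of v → x-of u X.≈ x-of v → proj₁ u ≈ proj₁ v
    inj u v e≡ x≈ = IsOrderIsomorphism.injective iso {u} {v} (e≡ , x≈)

    pre : ∀ e x → ∃ λ (u : BW) → e-of u ≡ e × x-of u X.≈ x
    pre e x = let u , eq = IsOrderIsomorphism.surjective iso (e , x) in u , eq {u} (λ _ → refl)

    elem : ∀ a → a ⊆ b → BW
    elem a a⊆b = ⟪ a ⟫ , ⊆⇒⪯ asc-b a⊆b (λ _ → refl) b≈w

    sub : ∀ a c (a⊆b : a ⊆ b) (c⊆b : c ⊆ b) → Asc c → a ⊆ c →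
          proj₁ (elem a a⊆b) ⪯ proj₁ (elem c c⊆b)
    sub a c _ _ asc-c a⊆c = ⊆⇒⪯ asc-c a⊆c (λ _ → refl) (λ _ → refl)

    bot : BW
    bot = elem [] (minimum b)

    x₀ : X.Carrier
    x₀ = x-of bot

    bot-≤ : ∀ (u : BW) → proj₁ bot ⪯ proj₁ u
    bot-≤ (_ , _ , _ , ra , _) = ⊆⇒⪯ (reduced⇒asc ra) (minimum _) (λ _ → refl) (IsReducedWord.product ra)

    -- By surjectivity `x` is the second coordinate of some element, and the identity lies below
    -- that element.
    x₀≤ : ∀ x → x₀ X.≤ x
    x₀≤ x = let u , _ , x≈ = pre true x
            in X.trans (proj₂ (mono bot u (bot-≤ u))) (X.reflexive x≈)

    ≤false : ∀ {e} → e Bool.≤ false → e ≡ false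
    ≤false b≤b = refl

    true≤ : ∀ {e} → true Bool.≤ e → e ≡ true
    true≤ b≤b = refl

    e-bot : e-of bot ≡ false
    e-bot = let u , e≡ , _ = pre false x₀
            in ≤false (subst (e-of bot Bool.≤_) e≡ (proj₁ (mono bot u (bot-≤ u))))

    letter≉id : ∀ (l : Fin (pred n)) → ¬ (⟪ l ∷ [] ⟫ ≈ ⟪ [] ⟫)
    letter≉id l eq = ℕₚ.<⇒≢ (ℕₚ.n<1+n (toℕ l))
      (trans (sym (≈⇒act (l ∷ []) [] eq (toℕ l))) (sw-i (toℕ l)))

    -- The atom of B w lying over the atom (true , x₀) is a letter s.
    atom : ∃ λ s → Σ (s ∷ [] ⊆ b) λ s⊆b → e-of (elem (s ∷ []) s⊆b) ≡ true × x-of (elem (s ∷ []) s⊆b) X.≈ x₀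
    atom with pre true x₀
    ... | u , e≡ , x≈ with ⪯⇒⊆ b b≈w (proj₂ u)
    ...   | [] , _ , _ , []≈u = contradiction
      (trans (sym e-bot) (trans (proj₁ (cong-φ bot u []≈u)) e≡)) λ ()
    ...   | s ∷ a , sa⊆b , asc , sa≈u = s , s⊆b , e-t (e-of t) refl , x≈x₀
      where
      s⊆b : s ∷ [] ⊆ b
      s⊆b = ⊆-trans (refl ∷ minimum a) sa⊆b
      t = elem (s ∷ []) s⊆b
      t⪯u : proj₁ t ⪯ proj₁ u
      t⪯u = ⊆⇒⪯ asc (refl ∷ minimum a) (λ _ → refl) sa≈u
      x≈x₀ : x-of t X.≈ x₀
      x≈x₀ = X.antisym (X.trans (proj₂ (mono t u t⪯u)) (X.reflexive x≈)) (x₀≤ _)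
      e-t : ∀ e → e-of t ≡ e → e-of t ≡ true
      e-t true  eq = eq
      e-t false eq = contradiction (inj t bot (trans eq (sym e-bot)) x≈x₀) (letter≉id s)

  module Atom (s : Fin (pred n)) (s∈b : s ∷ [] ⊆ b)
    (e-t : e-of (elem (s ∷ []) s∈b) ≡ true) (x-t : x-of (elem (s ∷ []) s∈b) X.≈ x₀) where
   private
    S : ℕ
    S = toℕ s

    t : BW
    t = elem (s ∷ []) s∈b

    -- The letter `s` lies below `b` and already crosses `S`, so the count of crossings is not zero
    -- for `b`.
    crosses : ¬ (∀ x → S < x → S < act b x)
    crosses pres = ∈⇒crossing asc-b s∈b (<⇒R#≡0 (suc S) λ { {y} (s≤s y≤S) → s≤s (ℕₚ.≮⇒≥ λ S<z →
      ℕₚ.<⇒≱ (subst (S <_) (act-act⁻ b y) (pres _ S<z)) y≤S) })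

    top : BW
    top = w , ⪯-reflexive {u = w} {v = w} (λ _ → refl)

    e-top : e-of top ≡ true
    e-top = true≤ (subst (Bool._≤ e-of top) e-t (proj₁ (mono t top (proj₂ t))))

    -- s g and g s would both lie over (true , x), where (false , x) is the image of g.
    module _ (g : Fin (pred n)) (g-adj : Adjacent S (toℕ g)) (g∈b : g ∷ [] ⊆ b) where
      private
        G : BW
        G = elem (g ∷ []) g∈b

        asc-letter : ∀ (l : Fin (pred n)) → Asc (l ∷ [])
        asc-letter l = ℕₚ.n<1+n (toℕ l) ∷ []

        -- Otherwise `G` would lie above the atom `t`, while a letter has only the identity and
        -- itself below it.
        e-G : ∀ e → e-of G ≡ e → e-of G ≡ false
        e-G false eq = eq
        e-G true  eq = contradiction (cancel t G (subst (e-of t Bool.≤_) (trans e-t (sym eq)) b≤b)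
          (X.trans (X.reflexive x-t) (x₀≤ _))) t⋠G
          where
          t⋠G : ¬ (proj₁ t ⪯ proj₁ G)
          t⋠G t⪯G with ⪯⇒⊆ (g ∷ []) (λ _ → refl) t⪯G
          ... | .[] , (.g ∷ʳ []) , _ , []≈s = letter≉id s (sym ∘ []≈s)
          ... | .(g ∷ []) , (refl ∷ []) , _ , g≈s =
            adjacent⇒≢ g-adj (sym (sw-index-injective (≈⇒act (g ∷ []) (s ∷ []) g≈s)))

        -- The element over `(false , x-of h)` lies below `h`, so it is a subword of `c`. The
        -- identity would force `G` down to `x₀` and make it the identity, and words containing `s`
        -- lie over `true`; only `g` remains.
        lies-over : ∀ c (c⊆b : c ⊆ b) → Asc c → s ∷ [] ⊆ c → g ∷ [] ⊆ c →
          (∀ {a} → a ⊆ c → (a ≡ [] ⊎ a ≡ s ∷ []) ⊎ (a ≡ g ∷ [] ⊎ a ≡ c)) →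
          e-of (elem c c⊆b) ≡ true × x-of (elem c c⊆b) X.≈ x-of G
        lies-over c c⊆b asc-c s∈c g∈c subwords = e-h , x-h
          where
          h = elem c c⊆b

          e-h : e-of h ≡ true
          e-h = true≤ (subst (Bool._≤ e-of h) e-t
            (proj₁ (mono t h (sub (s ∷ []) c s∈b c⊆b asc-c s∈c))))

          G≤h : x-of G X.≤ x-of h
          G≤h = proj₂ (mono G h (sub (g ∷ []) c g∈b c⊆b asc-c g∈c))

          via-subword : ∀ (v : BW) → e-of v ≡ false → x-of v X.≈ x-of h → ∀ {a} → ⟪ a ⟫ ≈ proj₁ v →
            (a ≡ [] ⊎ a ≡ s ∷ []) ⊎ (a ≡ g ∷ [] ⊎ a ≡ c) → x-of h X.≈ x-of G
          via-subword v e≡ x≈ a≈v (inj₁ (inj₁ refl)) = contradiction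
            (inj G bot (trans (e-G _ refl) (sym e-bot)) (X.antisym
              (X.trans G≤h (X.reflexive (X.Eq.trans (X.Eq.sym x≈)
                (X.Eq.sym (proj₂ (cong-φ bot v a≈v)))))) (x₀≤ _)))
            (letter≉id g)
          via-subword v e≡ x≈ a≈v (inj₁ (inj₂ refl)) = contradiction
            (trans (sym e-t) (trans (proj₁ (cong-φ t v a≈v)) e≡)) λ ()
          via-subword v e≡ x≈ a≈v (inj₂ (inj₁ refl)) =
            X.Eq.trans (X.Eq.sym x≈) (X.Eq.sym (proj₂ (cong-φ G v a≈v)))
          via-subword v e≡ x≈ a≈v (inj₂ (inj₂ refl)) = contradiction
            (trans (sym e-h) (trans (proj₁ (cong-φ h v a≈v)) e≡)) λ ()

          x-h : x-of h X.≈ x-of G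
          x-h =
            let v , e≡ , x≈ = pre false (x-of h)
                v⪯h = cancel v h (subst₂ Bool._≤_ (sym e≡) (sym e-h) f≤t) (X.reflexive x≈)
                a , a⊆c , _ , a≈v = ⪯⇒⊆ c (λ _ → refl) v⪯h
            in via-subword v e≡ x≈ {a} a≈v (subwords a⊆c)

      not-both : s ∷ g ∷ [] ⊆ b → g ∷ s ∷ [] ⊆ b → ⊥
      not-both sg⊆b gs⊆b =
        let e₁ , x₁ = lies-over (s ∷ g ∷ []) sg⊆b
              (sw-asc (adjacent⇒≢ g-adj ∘ sym) ∷ asc-letter g)
              (refl ∷ minimum _) (s ∷ʳ ⊆-refl) subwords-of-pair
            e₂ , x₂ = lies-over (g ∷ s ∷ []) gs⊆b
              (sw-asc (adjacent⇒≢ g-adj) ∷ asc-letter s)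
              (g ∷ʳ ⊆-refl) (refl ∷ minimum _)
              (λ a⊆ → case subwords-of-pair a⊆ of λ
                { (inj₁ (inj₁ eq)) → inj₁ (inj₁ eq) ; (inj₁ (inj₂ eq)) → inj₂ (inj₁ eq)
                ; (inj₂ (inj₁ eq)) → inj₁ (inj₂ eq) ; (inj₂ (inj₂ eq)) → inj₂ (inj₂ eq) })
        in adjacent-noncommuting g-adj (≈⇒act (s ∷ g ∷ []) (g ∷ s ∷ [])
             (inj (elem (s ∷ g ∷ []) sg⊆b) (elem (g ∷ s ∷ []) gs⊆b)
               (trans e₁ (sym e₂)) (X.Eq.trans x₁ (X.Eq.sym x₂))))

    no-both-pairs : ∀ g → Adjacent S g → HasPair S g b → HasPair g S b → ⊥
    no-both-pairs g adj (s₁ , g₁ , s₁≡ , refl , sg) (g₂ , s₂ , g₂≡ , s₂≡ , gs)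
      with Finₚ.toℕ-injective s₁≡ | Finₚ.toℕ-injective s₂≡ | Finₚ.toℕ-injective g₂≡
    ... | refl | refl | refl = not-both g₁ adj (⊆-trans (s ∷ʳ ⊆-refl) sg) sg gs

   -- w′ is the largest element of B w avoiding s, and w covers it.
   module Cover (w′ : BW) (e-w′ : e-of w′ ≡ false) (x-w′ : x-of w′ X.≈ x-of top)
     (a′ : Word (pred n)) (a′⊆b : a′ ⊆ b) (asc-a′ : Asc a′) (a′≈w′ : ⟪ a′ ⟫ ≈ proj₁ w′) where

    a′-avoids : All (λ l → toℕ l ≢ S) a′
    a′-avoids = All.tabulate λ {l} l∈a′ l≡S → contradiction
      (trans (sym (true≤ (subst (Bool._≤ e-of w′) e-t (proj₁ (mono t w′
        (⊆⇒⪯ asc-a′ (from∈ (subst (_∈ a′) (Finₚ.toℕ-injective l≡S) l∈a′)) (λ _ → refl) a′≈w′))))))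
        e-w′) λ ()

    a′≢b : ¬ (act⁻ a′ ≗ act⁻ b)
    a′≢b eq = contradiction
      (trans (sym e-w′) (trans (proj₁ (cong-φ w′ top λ x →
        trans (sym (a′≈w′ x)) (trans (act⁻⇒≈ a′ b eq x) (b≈w x)))) e-top)) λ ()

    -- The chain property gives a `c` strictly above `w′` and below `w`. Its second coordinate is
    -- squeezed to that of the top, so its first must be `true`, and `c` is `w` itself.
    cover : ∃₂ λ j k → ∀ x → (x ≡ j ⊎ x ≡ k) ⊎ act b x ≡ act a′ x
    cover with chain a′ asc-b (⊆⇒≤ᴿ asc-b a′⊆b) a′≢b
    ... | c , a′≤c , c≤b , a′≢c , j , k , differ = j , k , differ′
      where
      u : BW
      u = ⟪ c ⟫ , ≤ᴿ⇒⪯ c b (λ _ → refl) b≈w c≤b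

      w′⪯u : proj₁ w′ ⪯ proj₁ u
      w′⪯u = ≤ᴿ⇒⪯ a′ c a′≈w′ (λ _ → refl) a′≤c

      x≈ : x-of u X.≈ x-of top
      x≈ = X.antisym (proj₂ (mono u top (proj₂ u)))
             (X.trans (X.reflexive (X.Eq.sym x-w′)) (proj₂ (mono w′ u w′⪯u)))

      c≗b : ∀ e → e-of u ≡ e → act⁻ c ≗ act⁻ b
      c≗b true  eq = ≈⇒act⁻ c b λ x →
        trans (inj u top (trans eq (sym e-top)) x≈ x) (sym (b≈w x))
      c≗b false eq = contradiction (≈⇒act⁻ a′ c λ x →
        trans (a′≈w′ x) (inj w′ u (trans e-w′ (sym eq)) (X.Eq.trans x-w′ (X.Eq.sym x≈)) x)) a′≢c

      differ′ : ∀ x → (x ≡ j ⊎ x ≡ k) ⊎ act b x ≡ act a′ x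
      differ′ x with differ (act a′ x)
      ... | inj₁ at = inj₁ (subst (λ y → y ≡ j ⊎ y ≡ k) (act⁻-act a′ x) at)
      ... | inj₂ eq = inj₂ (trans (cong (act b) (trans (sym (act⁻-act a′ x))
              (trans (sym eq) (c≗b (e-of u) refl (act a′ x))))) (act-act⁻ b (act a′ x)))

    private
      act-a′≤ : ∀ {x} → x ≤ S → act a′ x ≤ S
      act-a′≤ = act-preserves-≤ a′-avoids

      act-a′> : ∀ {x} → S < x → S < act a′ x
      act-a′> = act-preserves-> a′-avoids

      -- `y` is where `a′` takes the value `act b x`; if `b` and `a′` agree at `y`, injectivity of
      -- `b` gives `y ≡ x`.
      origin : ∀ {J K} → (∀ x → (x ≡ J ⊎ x ≡ K) ⊎ act b x ≡ act a′ x) →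
               ∀ x → ∃ λ y → act a′ y ≡ act b x × (y ≡ J ⊎ y ≡ K ⊎ y ≡ x)
      origin differ x with act⁻ a′ (act b x) | act-act⁻ a′ (act b x)
      ... | y | eq with differ y
      ...   | inj₁ (inj₁ y≡J) = y , eq , inj₁ y≡J
      ...   | inj₁ (inj₂ y≡K) = y , eq , inj₂ (inj₁ y≡K)
      ...   | inj₂ same       = y , eq , inj₂ (inj₂ (act-injective b (trans same eq)))

    module _ {J K : ℕ} (differ : ∀ x → (x ≡ J ⊎ x ≡ K) ⊎ act b x ≡ act a′ x) (J≤S : J ≤ S) (S<K : S < K) where
      private
        rest≤ : ∀ {x} → x ≤ S → x ≢ J → act b x ≤ S
        rest≤ {x} x≤S x≢J with differ x
        ... | inj₁ (inj₁ x≡J)  = contradiction x≡J x≢J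
        ... | inj₁ (inj₂ refl) = contradiction x≤S (ℕₚ.<⇒≱ S<K)
        ... | inj₂ eq          = subst (_≤ S) (sym eq) (act-a′≤ x≤S)

        rest> : ∀ {x} → S < x → x ≢ K → S < act b x
        rest> {x} S<x x≢K with differ x
        ... | inj₁ (inj₁ refl) = contradiction J≤S (ℕₚ.<⇒≱ S<x)
        ... | inj₁ (inj₂ x≡K)  = contradiction x≡K x≢K
        ... | inj₂ eq          = subst (S <_) (sym eq) (act-a′> S<x)

        -- Some position beyond `S` crosses, and `rest>` leaves only `K`.
        bK≤S : act b K ≤ S
        bK≤S = ℕₚ.≮⇒≥ λ S<bK → crosses λ x S<x → case x ℕₚ.≟ K of λ
          { (yes refl) → S<bK ; (no x≢K) → rest> S<x x≢K }

        a′J≡bK : act a′ J ≡ act b K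
        a′J≡bK with origin differ K
        ... | .J , eq , inj₁ refl        = eq
        ... | .K , eq , inj₂ (inj₁ refl) = contradiction (act-a′> S<K) (ℕₚ.≤⇒≯ (subst (_≤ S) (sym eq) bK≤S))
        ... | .K , eq , inj₂ (inj₂ refl) = contradiction (act-a′> S<K) (ℕₚ.≤⇒≯ (subst (_≤ S) (sym eq) bK≤S))

        a′J≢bJ : act a′ J ≢ act b J
        a′J≢bJ eq = ℕₚ.<⇒≱ S<K (subst (_≤ S) (act-injective b (trans (sym eq) a′J≡bK)) J≤S)

        S<bJ : S < act b J
        S<bJ with origin differ J
        ... | .J , eq , inj₁ refl        = contradiction eq a′J≢bJ
        ... | .K , eq , inj₂ (inj₁ refl) = subst (S <_) eq (act-a′> S<K)
        ... | .J , eq , inj₂ (inj₂ refl) = contradiction eq a′J≢bJ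

        -- Let `z` be the letter just below `S`. If `J ≤ z`, carrying `J` past `S` puts `S` before
        -- `z` in `b`; if `act b K ≤ z`, carrying `K` down puts `z` before `S`. The two cannot both
        -- occur. For `S ≡ 0` there is no such letter, and `J ≡ 0` is forced.
        low : J ≡ S ⊎ act b K ≡ S
        low = go S refl
          where
          go : ∀ z → z ≡ S → J ≡ S ⊎ act b K ≡ S
          go zero    0≡S = inj₁ (trans (ℕₚ.n≤0⇒n≡0 (subst (J ≤_) (sym 0≡S) J≤S)) 0≡S)
          go (suc z) z+1≡S = case pair-≤ z<S b of λ
            { (inj₂ pres) → inj₁ (ℕₚ.≤-antisym J≤S (subst (_≤ J) z+1≡S
                (ℕₚ.≰⇒> λ J≤z → ℕₚ.<⇒≱ S<bJ (pres J≤z))))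
            ; (inj₁ sz)   → case pair-> z<S b of λ
              { (inj₁ zs)   → ⊥-elim (no-both-pairs z (inj₁ (sym z+1≡S)) sz zs)
              ; (inj₂ pres) → inj₂ (ℕₚ.≤-antisym bK≤S (subst (_≤ act b K) z+1≡S (pres S<K)))
              }
            }
            where z<S = ≤-reflexive z+1≡S

        high : K ≡ suc S ⊎ act b J ≡ suc S
        high = case pair-≤ (ℕₚ.n<1+n S) b of λ
          { (inj₂ pres) → inj₂ (ℕₚ.≤-antisym (pres J≤S) S<bJ)
          ; (inj₁ zs)   → case pair-> (ℕₚ.n<1+n S) b of λ
            { (inj₁ sz)   → ⊥-elim (no-both-pairs (suc S) (inj₂ refl) sz zs)
            ; (inj₂ pres) → inj₁ (ℕₚ.≤-antisym (ℕₚ.≮⇒≥ λ 1+S<K → ℕₚ.<⇒≱ (pres 1+S<K) bK≤S) S<K)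
            }
          }

        toℕ-w : ∀ x → toℕ (w ⟨$⟩ʳ x) ≡ act b (toℕ x)
        toℕ-w x = trans (cong toℕ (sym (b≈w x))) (toℕ-⟪⟫ b x)

        K<n : K < n
        K<n = ℕₚ.≰⇒> λ n≤K → ℕₚ.<⇒≱ S<K (subst (_≤ S) (act-fixes-≥n n b n≤K) bK≤S)

        crossingAt : ∀ (j k : Fin n) → toℕ j ≡ J → toℕ k ≡ K →
                     Σ (Crossing w) λ C → Crossing.Rest≤ C × Crossing.Rest> C
        crossingAt j k j≡ k≡ = record
          { i = S ; j = j ; k = k
          ; j≤i = subst (_≤ S) (sym j≡) J≤S
          ; i<k = subst (S <_) (sym k≡) S<K
          ; i<wj = subst (S <_) (sym wj≡) S<bJ
          ; wk≤i = subst (_≤ S) (sym wk≡) bK≤S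
          ; lowSide = Sum.map (trans j≡) (trans wk≡) low
          ; highSide = Sum.map (trans k≡) (trans wj≡) high
          }
          , (λ x x≤S x≢j → subst (_≤ S) (sym (toℕ-w x))
              (rest≤ x≤S λ x≡J → x≢j (Finₚ.toℕ-injective (trans x≡J (sym j≡)))))
          , (λ x S<x x≢k → subst (S <_) (sym (toℕ-w x))
              (rest> S<x λ x≡K → x≢k (Finₚ.toℕ-injective (trans x≡K (sym k≡)))))
          where
          wj≡ : toℕ (w ⟨$⟩ʳ j) ≡ act b J
          wj≡ = trans (toℕ-w j) (cong (act b) j≡)
          wk≡ : toℕ (w ⟨$⟩ʳ k) ≡ act b K
          wk≡ = trans (toℕ-w k) (cong (act b) k≡)

      crossing : Σ (Crossing w) λ C → Crossing.Rest≤ C × Crossing.Rest> C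
      crossing = crossingAt (Fin.fromℕ< J<n) (Fin.fromℕ< K<n) (Finₚ.toℕ-fromℕ< J<n) (Finₚ.toℕ-fromℕ< K<n)
        where
        J<n : J < n
        J<n = ℕₚ.<-trans (ℕₚ.≤-<-trans J≤S S<K) K<n

    -- Two positions on the same side of `S` would leave `b` without a crossing, since `a′` has
    -- none.
    cover-crossing : Σ (Crossing w) λ C → Crossing.Rest≤ C × Crossing.Rest> C
    cover-crossing with cover
    ... | j , k , differ with j ℕₚ.≤? S | k ℕₚ.≤? S
    ...   | yes j≤S | no  k≰S = crossing differ j≤S (ℕₚ.≰⇒> k≰S)
    ...   | no  j≰S | yes k≤S = crossing (Sum.map₁ Sum.swap ∘ differ) k≤S (ℕₚ.≰⇒> j≰S)
    ...   | yes j≤S | yes k≤S = contradiction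
      (λ x S<x → [ (λ { (inj₁ refl) → contradiction j≤S (ℕₚ.<⇒≱ S<x)
                      ; (inj₂ refl) → contradiction k≤S (ℕₚ.<⇒≱ S<x) })
                 , (λ eq → subst (S <_) (sym eq) (act-a′> S<x)) ]′ (differ x))
      crosses
    ...   | no  j≰S | no  k≰S = contradiction
      (λ x S<x → case origin differ x of λ
        { (_ , eq , inj₁ refl)        → subst (S <_) eq (act-a′> (ℕₚ.≰⇒> j≰S))
        ; (_ , eq , inj₂ (inj₁ refl)) → subst (S <_) eq (act-a′> (ℕₚ.≰⇒> k≰S))
        ; (_ , eq , inj₂ (inj₂ refl)) → subst (S <_) eq (act-a′> S<x) })
      crosses

  prism-crossing : Σ (Crossing w) λ C → Crossing.Rest≤ C × Crossing.Rest> C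
  prism-crossing =
    let s , s∈b , e-t , x-t = atom
        w′ , e-w′ , x-w′ = pre false (x-of (w , ⪯-reflexive {u = w} {v = w} (λ _ → refl)))
        a′ , a′⊆b , asc-a′ , a′≈w′ = ⪯⇒⊆ b b≈w (proj₂ w′)
    in Atom.Cover.cover-crossing s s∈b e-t x-t w′ e-w′ x-w′ a′ a′⊆b asc-a′ a′≈w′

prism⇒crossing : ∀ {n} {w : Permutation′ n} → IsPrism w →
                 Σ (Crossing w) λ C → Crossing.Rest≤ C × Crossing.Rest> C
prism⇒crossing {n} {w} (X , φ , iso) =
  let b , asc-b , b≈w = Bruhat.∃-asc n w
  in PrismCrossing.prism-crossing X φ iso b asc-b b≈w

-- Mesh patterns

strictly-monotone⇒≤ : ∀ {k} {h : Fin k → Fin k} → (∀ {a b} → a Fin.< b → h a Fin.< h b) →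
                      ∀ a → toℕ a ≤ toℕ (h a)
strictly-monotone⇒≤ {k} {h} h-mono a = go (toℕ a) a refl
  where
  go : ∀ m a → toℕ a ≡ m → m ≤ toℕ (h a)
  go zero    a eq = z≤n
  go (suc m) a eq = ℕₚ.≤-<-trans (go m a′ toℕ-a′) (h-mono (≤-reflexive (trans (cong suc toℕ-a′) (sym eq))))
    where
    m<k = ℕₚ.<-trans (≤-reflexive (sym eq)) (Finₚ.toℕ<n a)
    a′ : Fin k
    a′ = Fin.fromℕ< m<k
    toℕ-a′ : toℕ a′ ≡ m
    toℕ-a′ = Finₚ.toℕ-fromℕ< m<k

module _ {k n} {f g : Fin k → Fin n}
  (f-mono : ∀ {a b} → a Fin.< b → f a Fin.< f b) (g-mono : ∀ {a b} → a Fin.< b → g a Fin.< g b) where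

  -- Writing `g a` as `f (h a)` makes `h` strictly increasing, hence `a ≤ h a`.
  monotone-subimage⇒≤ : (∀ a → ∃ λ b → g a ≡ f b) → ∀ a → toℕ (f a) ≤ toℕ (g a)
  monotone-subimage⇒≤ g⊆f a = subst (λ z → toℕ (f a) ≤ toℕ z) (sym (proj₂ (g⊆f a)))
    (f-mono-≤ (strictly-monotone⇒≤ h-mono a))
    where
    h : Fin k → Fin k
    h a = proj₁ (g⊆f a)

    f-mono-≤ : ∀ {a b} → a Fin.≤ b → f a Fin.≤ f b
    f-mono-≤ a≤b with ℕₚ.m≤n⇒m<n∨m≡n a≤b
    ... | inj₁ a<b = ℕₚ.<⇒≤ (f-mono a<b)
    ... | inj₂ a≡b = ≤-reflexive (cong (toℕ ∘ f) (Finₚ.toℕ-injective a≡b))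

    h-mono : ∀ {a b} → a Fin.< b → h a Fin.< h b
    h-mono {a} {b} a<b = ℕₚ.≰⇒> λ hb≤ha → ℕₚ.<⇒≱ (g-mono a<b)
      (subst₂ Fin._≤_ (sym (proj₂ (g⊆f b))) (sym (proj₂ (g⊆f a))) (f-mono-≤ hb≤ha))

monotone-unique : ∀ {k n} {f g : Fin k → Fin n} →
  (∀ {a b} → a Fin.< b → f a Fin.< f b) → (∀ {a b} → a Fin.< b → g a Fin.< g b) →
  (∀ a → ∃ λ b → g a ≡ f b) → (∀ a → ∃ λ b → f a ≡ g b) → f ≗ g
monotone-unique f-mono g-mono g⊆f f⊆g a = Finₚ.toℕ-injective
  (ℕₚ.≤-antisym (monotone-subimage⇒≤ f-mono g-mono g⊆f a) (monotone-subimage⇒≤ g-mono f-mono f⊆g a))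

module _ {n : ℕ} where

  private
    bordered-linked : ∀ {k} lo (z : Vec (Fin n) k) →
      lo < Vec.lookup (Vec.map (suc ∘ toℕ) z Vec.∷ʳ suc n) zero → Linked Fin._<_ z →
      Linked _<_ (lo ∷ (Vec.map (suc ∘ toℕ) z Vec.∷ʳ suc n))
    bordered-linked lo []            lo< z↗         = lo< ∷ [-]
    bordered-linked lo (z ∷ [])      lo< z↗         = lo< ∷ s≤s (Finₚ.toℕ<n z) ∷ [-]
    bordered-linked lo (z ∷ z′ ∷ zs) lo< (z< ∷ zs↗) = lo< ∷ bordered-linked (suc (toℕ z)) (z′ ∷ zs) (s≤s z<) zs↗

    0<first : ∀ {k} (z : Vec (Fin n) k) → 0 < Vec.lookup (Vec.map (suc ∘ toℕ) z Vec.∷ʳ suc n) zero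
    0<first []      = s≤s z≤n
    0<first (z ∷ _) = s≤s z≤n

    lookup-point : ∀ {k} (z : Vec (Fin n) k) c →
      Vec.lookup (Vec.map (suc ∘ toℕ) z Vec.∷ʳ suc n) (inject₁ c) ≡ suc (toℕ (Vec.lookup z c))
    lookup-point (z ∷ zs) zero    = refl
    lookup-point (z ∷ zs) (suc c) = lookup-point zs c

    locate-from : ∀ {k} lo (z : Vec (Fin n) k) (v : Fin n) → lo < suc (toℕ v) →
      let walls = lo ∷ (Vec.map (suc ∘ toℕ) z Vec.∷ʳ suc n) in
      (∃ λ c → v ≡ Vec.lookup z c) ⊎
      (∃ λ a → Vec.lookup walls (inject₁ a) < suc (toℕ v) × suc (toℕ v) < Vec.lookup walls (suc a))
    locate-from lo []       v lo<v = inj₂ (zero , lo<v , s≤s (Finₚ.toℕ<n v))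
    locate-from lo (z ∷ zs) v lo<v with ℕₚ.<-cmp (toℕ v) (toℕ z)
    ... | tri< v<z _ _ = inj₂ (zero , lo<v , s≤s v<z)
    ... | tri≈ _ v≡z _ = inj₁ (zero , Finₚ.toℕ-injective v≡z)
    ... | tri> _ _ z<v = Sum.map (λ { (c , eq) → suc c , eq }) (λ { (a , between) → suc a , between })
                           (locate-from (suc (toℕ z)) zs v (s≤s z<v))

  bordered-point : ∀ {k} (z : Vec (Fin n) k) c → bordered z (suc (inject₁ c)) ≡ suc (toℕ (Vec.lookup z c))
  bordered-point = lookup-point

  locate : ∀ {k} (z : Vec (Fin n) k) v → (∃ λ c → v ≡ Vec.lookup z c) ⊎ (∃ λ a → Between z a v)
  locate z v = locate-from 0 z v (s≤s z≤n)

  module _ {k} {z : Vec (Fin n) k} (z↗ : Linked Fin._<_ z) where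

    bordered-mono-< : ∀ {a b} → a Fin.< b → bordered z a < bordered z b
    bordered-mono-< = lookup⁺ ℕₚ.<-trans (bordered-linked 0 z (0<first z) z↗)

    bordered-mono-≤ : ∀ {a b} → toℕ a ≤ toℕ b → bordered z a ≤ bordered z b
    bordered-mono-≤ {a} {b} a≤b with ℕₚ.m≤n⇒m<n∨m≡n a≤b
    ... | inj₁ a<b = ℕₚ.<⇒≤ (bordered-mono-< {a} {b} a<b)
    ... | inj₂ a≡b = ≤-reflexive (cong (bordered z) (Finₚ.toℕ-injective a≡b))

    bordered-cancel-< : ∀ {a b} → bordered z a < bordered z b → toℕ a < toℕ b
    bordered-cancel-< {a} {b} lt = ℕₚ.≰⇒> λ b≤a → ℕₚ.<⇒≱ lt (bordered-mono-≤ {b} {a} b≤a)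

    point-not-between : ∀ a c → ¬ Between z a (Vec.lookup z c)
    point-not-between a c (a<c , c<a) = ℕₚ.<⇒≱ (bordered-cancel-< {inject₁ a} {suc (inject₁ c)} a<c′)
      (subst₂ _≤_ refl (sym (Finₚ.toℕ-inject₁ a)) (ℕₚ.≤-pred (bordered-cancel-< {suc (inject₁ c)} {suc a} c<a′)))
      where
      a<c′ = subst (bordered z (inject₁ a) <_) (sym (bordered-point z c)) a<c
      c<a′ = subst (_< bordered z (suc a)) (sym (bordered-point z c)) c<a

    lookup-mono-< : ∀ {a b} → a Fin.< b → Vec.lookup z a Fin.< Vec.lookup z b
    lookup-mono-< = lookup⁺ ℕₚ.<-trans z↗

    between-left-of : ∀ {a v} ι → bordered z ι ≤ suc (toℕ v) → Between z a v → toℕ ι ≤ toℕ a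
    between-left-of {a} ι ι≤v (_ , v<a) = ℕₚ.≤-pred (bordered-cancel-< {ι} {suc a} (ℕₚ.≤-<-trans ι≤v v<a))

    between-right-of : ∀ {a v} ι → suc (toℕ v) ≤ bordered z ι → Between z a v → toℕ a < toℕ ι
    between-right-of {a} ι v≤ι (a<v , _) = subst (_< toℕ ι) (Finₚ.toℕ-inject₁ a)
      (bordered-cancel-< {inject₁ a} {ι} (ℕₚ.<-≤-trans a<v v≤ι))

consecutive⇒empty : ∀ {n k} {z : Vec (Fin n) k} {a v} →
  bordered z (suc a) ≤ suc (bordered z (inject₁ a)) → ¬ Between z a v
consecutive⇒empty le (a<v , v<a) = ℕₚ.<⇒≱ v<a (≤-trans le a<v)

∈⇒lookup : ∀ {A : Set} {k} {v : A} {xs : Vec A k} → v Vec∈.∈ xs → ∃ λ c → v ≡ Vec.lookup xs c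
∈⇒lookup v∈xs = VecAny.index v∈xs , VecAnyₚ.lookup-index v∈xs

module Extract {n} {w : Permutation′ n} {π} (occ : Occurrence w π) where
  open CalibratedMeshPattern π
  open Occurrence occ

  -- `y` and the values of `w` listed in the order of `p` are increasing enumerations of the same
  -- set, hence equal.
  values : ∀ i → w ⟨$⟩ʳ Vec.lookup x i ≡ Vec.lookup y (p ⟨$⟩ʳ i)
  values i = trans (cong (λ j → w ⟨$⟩ʳ Vec.lookup x j) (sym (Perm.inverseˡ p)))
    (monotone-unique f-mono (lookup-mono-< y-increasing) y⊆f f⊆y (p ⟨$⟩ʳ i))
    where
    f : Fin k → Fin n
    f a = w ⟨$⟩ʳ Vec.lookup x (p ⟨$⟩ˡ a)

    f-mono : ∀ {a b} → a Fin.< b → f a Fin.< f b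
    f-mono {a} {b} a<b = Equivalence.to (same-order (p ⟨$⟩ˡ a) (p ⟨$⟩ˡ b))
      (subst₂ Fin._<_ (sym (Perm.inverseʳ p)) (sym (Perm.inverseʳ p)) a<b)

    y⊆f : ∀ a → ∃ λ b → Vec.lookup y a ≡ f b
    y⊆f a = let c , eq = ∈⇒lookup (Equivalence.to (y-values (Vec.lookup y a)) (∈-lookup a y))
            in p ⟨$⟩ʳ c , trans eq (trans (lookup-map c (w ⟨$⟩ʳ_) x)
                 (cong (λ j → w ⟨$⟩ʳ Vec.lookup x j) (sym (Perm.inverseˡ p))))

    f⊆y : ∀ a → ∃ λ b → f a ≡ Vec.lookup y b
    f⊆y a = ∈⇒lookup (Equivalence.from (y-values (f a)) (∈-map⁺ (w ⟨$⟩ʳ_) (∈-lookup (p ⟨$⟩ˡ a) x)))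

  values⁻ : ∀ {z} c → w ⟨$⟩ʳ z ≡ Vec.lookup y c → z ≡ Vec.lookup x (p ⟨$⟩ˡ c)
  values⁻ {z} c eq = trans (sym (Perm.inverseˡ w)) (trans
    (cong (w ⟨$⟩ˡ_) (trans eq (trans (cong (Vec.lookup y) (sym (Perm.inverseʳ p))) (sym (values (p ⟨$⟩ˡ c))))))
    (Perm.inverseˡ w))

  empty-cell : ∀ {a b z} → (a , b) ∈ mesh → Between x a z → ¬ Between y b (w ⟨$⟩ʳ z)
  empty-cell cell∈ in-x in-y = All.lookup mesh-empty cell∈ (_ , in-x , in-y)

  -- The position of a value in the strip is either that of a point of the occurrence, whose value
  -- lies on a grid line, or in the column of a shaded cell.
  full-row : ∀ b → (∀ a → (a , b) ∈ mesh) → ∀ v → ¬ Between y b v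
  full-row b row v v-in = case locate x z of λ
    { (inj₁ (c , eq)) → point-not-between y-increasing b (p ⟨$⟩ʳ c)
        (subst (Between y b) (trans (sym (Perm.inverseʳ w)) (trans (cong (w ⟨$⟩ʳ_) eq) (values c))) v-in)
    ; (inj₂ (a , z-in)) → empty-cell (row a) z-in (subst (Between y b) (sym (Perm.inverseʳ w)) v-in)
    }
    where z = w ⟨$⟩ˡ v

  full-column : ∀ a → (∀ b → (a , b) ∈ mesh) → ∀ z → ¬ Between x a z
  full-column a column z z-in = case locate y (w ⟨$⟩ʳ z) of λ
    { (inj₁ (c , eq)) → point-not-between x-increasing a (p ⟨$⟩ˡ c) (subst (Between x a) (values⁻ c eq) z-in)
    ; (inj₂ (b , in-y)) → empty-cell (column b) z-in in-y
    }

  -- Inside a fully shaded quadrant, points of `w` can sit only on grid lines, and there they belong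
  -- to the occurrence. So the border lines may be included in the bounds.
  lower-right : ∀ A B → (∀ a b → toℕ A ≤ toℕ a → toℕ b < toℕ B → (a , b) ∈ mesh) →
    ∀ z → bordered x A ≤ suc (toℕ z) → suc (toℕ (w ⟨$⟩ʳ z)) ≤ bordered y B → ∃ λ c → z ≡ Vec.lookup x c
  lower-right A B quadrant z A≤z wz≤B = case locate x z of λ
    { (inj₁ at) → at
    ; (inj₂ (a , in-x)) → case locate y (w ⟨$⟩ʳ z) of λ
      { (inj₁ (c , eq)) → p ⟨$⟩ˡ c , values⁻ c eq
      ; (inj₂ (b , in-y)) → contradiction in-y (empty-cell (quadrant a b
          (between-left-of x-increasing A A≤z in-x) (between-right-of y-increasing B wz≤B in-y)) in-x)
      }
    }

  upper-left : ∀ A B → (∀ a b → toℕ a < toℕ A → toℕ B ≤ toℕ b → (a , b) ∈ mesh) →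
    ∀ z → suc (toℕ z) ≤ bordered x A → bordered y B ≤ suc (toℕ (w ⟨$⟩ʳ z)) → ∃ λ c → z ≡ Vec.lookup x c
  upper-left A B quadrant z z≤A B≤wz = case locate x z of λ
    { (inj₁ at) → at
    ; (inj₂ (a , in-x)) → case locate y (w ⟨$⟩ʳ z) of λ
      { (inj₁ (c , eq)) → p ⟨$⟩ˡ c , values⁻ c eq
      ; (inj₂ (b , in-y)) → contradiction in-y (empty-cell (quadrant a b
          (between-right-of x-increasing A z≤A in-x) (between-left-of y-increasing B B≤wz in-y)) in-x)
      }
    }

consecutive : ∀ {n k} {z : Vec (Fin n) k} → Linked Fin._<_ z → ∀ a {u v} →
  bordered z (inject₁ a) ≡ suc (toℕ u) → bordered z (suc a) ≡ suc (toℕ {n} v) →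
  (∀ t → ¬ Between z a t) → toℕ v ≡ suc (toℕ {n} u)
consecutive {z = z} z↗ a {u} {v} u≡ v≡ empty with ℕₚ.<-cmp (toℕ v) (suc (toℕ u))
... | tri≈ _ eq _ = eq
... | tri< v≤u _ _ = contradiction (bordered-mono-< z↗ {inject₁ a} {suc a} (s≤s (≤-reflexive (Finₚ.toℕ-inject₁ a))))
  (ℕₚ.≤⇒≯ (subst₂ _≤_ (sym v≡) (sym u≡) v≤u))
... | tri> _ _ u+1<v = contradiction
  ( subst₂ _<_ (sym u≡) (cong suc (sym toℕ-t)) ≤-refl
  , subst₂ _<_ (cong suc (sym toℕ-t)) (sym v≡) (s≤s u+1<v)) (empty t)
  where
  t<n = ℕₚ.<-trans u+1<v (Finₚ.toℕ<n v)
  t = Fin.fromℕ< t<n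
  toℕ-t : toℕ t ≡ suc (toℕ u)
  toℕ-t = Finₚ.toℕ-fromℕ< t<n

private
  Cell : ∀ k → Set
  Cell k = Fin (suc k) × Fin (suc k)

  _∈?_ : ∀ {k} (c : Cell k) (cs : List (Cell k)) → Dec (c ∈ cs)
  _∈?_ = DecMembership._∈?_ (Productₚ.≡-dec Finₚ._≟_ Finₚ._≟_)

  row? : ∀ {k} b (m : List (Cell k)) → Dec (∀ a → (a , b) ∈ m)
  row? b m = Finₚ.all? λ a → (a , b) ∈? m

  column? : ∀ {k} a (m : List (Cell k)) → Dec (∀ b → (a , b) ∈ m)
  column? a m = Finₚ.all? λ b → (a , b) ∈? m

  LowerRight UpperLeft : ∀ {k} (A B : Fin (2 + k)) (m : List (Cell k)) → Set
  LowerRight A B m = ∀ a b → toℕ A ≤ toℕ a → toℕ b < toℕ B → (a , b) ∈ m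
  UpperLeft  A B m = ∀ a b → toℕ a < toℕ A → toℕ B ≤ toℕ b → (a , b) ∈ m

  lowerRight? : ∀ {k} A B (m : List (Cell k)) → Dec (LowerRight A B m)
  lowerRight? A B m = Finₚ.all? λ a → Finₚ.all? λ b →
    (toℕ A ℕₚ.≤? toℕ a) →-dec ((toℕ b ℕₚ.<? toℕ B) →-dec ((a , b) ∈? m))

  upperLeft? : ∀ {k} A B (m : List (Cell k)) → Dec (UpperLeft A B m)
  upperLeft? A B m = Finₚ.all? λ a → Finₚ.all? λ b →
    (toℕ a ℕₚ.<? toℕ A) →-dec ((toℕ B ℕₚ.≤? toℕ b) →-dec ((a , b) ∈? m))

  row-in : ∀ {k} b {m : List (Cell k)} {_ : True (row? b m)} → ∀ a → (a , b) ∈ m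
  row-in b {m} {t} = toWitness t

  column-in : ∀ {k} a {m : List (Cell k)} {_ : True (column? a m)} → ∀ b → (a , b) ∈ m
  column-in a {m} {t} = toWitness t

  lower-right-in : ∀ {k} A B {m : List (Cell k)} {_ : True (lowerRight? A B m)} → LowerRight A B m
  lower-right-in A B {m} {t} = toWitness t

  upper-left-in : ∀ {k} A B {m : List (Cell k)} {_ : True (upperLeft? A B m)} → UpperLeft A B m
  upper-left-in A B {m} {t} = toWitness t

-- From a pattern to a crossing

HalfCrossing : ∀ {n} → Permutation′ n → Set
HalfCrossing w = Σ (Crossing w) λ C → Crossing.Rest≤ C ⊎ Crossing.Rest> C

module Patterns21 {n} {w : Permutation′ n} {m cX cY} (occ : Occurrence w (calibrated 21ₚ m cX cY)) where
  open Occurrence occ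
  open Extract occ

  x₁ x₂ y₁ y₂ : Fin n
  x₁ = Vec.lookup x 0F
  x₂ = Vec.lookup x 1F
  y₁ = Vec.lookup y 0F
  y₂ = Vec.lookup y 1F

  private
    x₁<x₂ : toℕ x₁ < toℕ x₂
    x₁<x₂ = lookup-mono-< x-increasing (s≤s z≤n)

    y₁<y₂ : toℕ y₁ < toℕ y₂
    y₁<y₂ = lookup-mono-< y-increasing (s≤s z≤n)

    wx₁ : toℕ (w ⟨$⟩ʳ x₁) ≡ toℕ y₂
    wx₁ = cong toℕ (values 0F)

    wx₂ : toℕ (w ⟨$⟩ʳ x₂) ≡ toℕ y₁
    wx₂ = cong toℕ (values 1F)

  consecutive-x : (∀ b → (1F , b) ∈ m) → toℕ x₂ ≡ suc (toℕ x₁)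
  consecutive-x col = consecutive x-increasing 1F (bordered-point x 0F) (bordered-point x 1F)
    (full-column 1F col)

  consecutive-y : (∀ a → (a , 1F) ∈ m) → toℕ y₂ ≡ suc (toℕ y₁)
  consecutive-y row = consecutive y-increasing 1F (bordered-point y 0F) (bordered-point y 1F)
    (full-row 1F row)

  calibrated-x₁y₁ : bordered x 1F ≡ bordered y 1F → toℕ x₁ ≡ toℕ y₁
  calibrated-x₁y₁ eq = ℕₚ.suc-injective
    (trans (sym (bordered-point x 0F)) (trans eq (bordered-point y 0F)))

  calibrated-x₂y₂ : bordered x 2F ≡ bordered y 2F → toℕ x₂ ≡ toℕ y₂
  calibrated-x₂y₂ eq = ℕₚ.suc-injective
    (trans (sym (bordered-point x 1F)) (trans eq (bordered-point y 1F)))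

  -- The equation shared by patterns (1) and (4): the calibration equates the lines of `x₂` and
  -- `y₂`, or of `x₁` and `y₁`, and the shaded strip makes the remaining step by one.
  half-crossing-> : toℕ x₂ ≡ suc (toℕ y₁) → LowerRight 2F 1F m → HalfCrossing w
  half-crossing-> x₂≡ quadrant = record
    { i = toℕ y₁ ; j = x₁ ; k = x₂
    ; j≤i = ℕₚ.≤-pred (subst (toℕ x₁ <_) x₂≡ x₁<x₂)
    ; i<k = ≤-reflexive (sym x₂≡)
    ; i<wj = subst (toℕ y₁ <_) (sym wx₁) y₁<y₂
    ; wk≤i = ≤-reflexive wx₂
    ; lowSide = inj₂ wx₂
    ; highSide = inj₁ x₂≡
    } , inj₂ λ z i<z z≢x₂ → ℕₚ.≰⇒> λ wz≤i →
      case lower-right 2F 1F quadrant z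
             (≤-trans (≤-reflexive (trans (bordered-point x 1F) (cong suc x₂≡))) (s≤s i<z))
             (≤-trans (s≤s wz≤i) (≤-reflexive (sym (bordered-point y 0F)))) of λ
      { (0F , refl) → ℕₚ.<⇒≱ x₁<x₂ (subst (_≤ toℕ x₁) (sym x₂≡) i<z)
      ; (1F , refl) → z≢x₂ refl
      }

  -- The mirror image, for patterns (2) and (3).
  half-crossing-≤ : toℕ y₂ ≡ suc (toℕ x₁) → UpperLeft 1F 2F m → HalfCrossing w
  half-crossing-≤ y₂≡ quadrant = record
    { i = toℕ x₁ ; j = x₁ ; k = x₂
    ; j≤i = ≤-refl
    ; i<k = x₁<x₂
    ; i<wj = ≤-reflexive (sym (trans wx₁ y₂≡))
    ; wk≤i = ≤-trans (≤-reflexive wx₂) (ℕₚ.≤-pred (subst (toℕ y₁ <_) y₂≡ y₁<y₂))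
    ; lowSide = inj₁ refl
    ; highSide = inj₂ (trans wx₁ y₂≡)
    } , inj₁ λ z z≤i z≢x₁ → ℕₚ.≮⇒≥ λ i<wz →
      case upper-left 1F 2F quadrant z
             (≤-trans (s≤s z≤i) (≤-reflexive (sym (bordered-point x 0F))))
             (≤-trans (≤-reflexive (trans (bordered-point y 1F) (cong suc y₂≡))) (s≤s i<wz)) of λ
      { (0F , refl) → z≢x₁ refl
      ; (1F , refl) → ℕₚ.<⇒≱ x₁<x₂ z≤i
      }

module Patterns4 {n} {w : Permutation′ n} {p : Permutation′ 4} {m cX cY}
  (occ : Occurrence w (calibrated p m cX cY))
  (row : ∀ a → (a , 2F) ∈ m) (column : ∀ b → (2F , b) ∈ m)
  (cal : bordered (Occurrence.x occ) 2F ≡ bordered (Occurrence.y occ) 2F) where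
  open Occurrence occ
  open Extract occ

  private
    X Y : Fin 4 → ℕ
    X c = toℕ (Vec.lookup x c)
    Y c = toℕ (Vec.lookup y c)

    i : ℕ
    i = X 1F

    y₂≡i : Y 1F ≡ i
    y₂≡i = ℕₚ.suc-injective (trans (sym (bordered-point y 1F)) (trans (sym cal) (bordered-point x 1F)))

    x₃≡1+i : X 2F ≡ suc i
    x₃≡1+i = consecutive x-increasing 2F (bordered-point x 1F) (bordered-point x 2F)
      (full-column 2F column)

    y₃≡1+i : Y 2F ≡ suc i
    y₃≡1+i = trans (consecutive y-increasing 2F (bordered-point y 1F) (bordered-point y 2F)
      (full-row 2F row)) (cong suc y₂≡i)

    mono-≤ : ∀ {z : Vec (Fin n) 4} → Linked Fin._<_ z → ∀ {a b} → toℕ a ≤ toℕ b →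
             toℕ (Vec.lookup z a) ≤ toℕ (Vec.lookup z b)
    mono-≤ {z} z↗ {a} {b} a≤b with ℕₚ.m≤n⇒m<n∨m≡n a≤b
    ... | inj₁ a<b = ℕₚ.<⇒≤ (lookup-mono-< z↗ a<b)
    ... | inj₂ a≡b = ≤-reflexive (cong (toℕ ∘ Vec.lookup z) (Finₚ.toℕ-injective a≡b))

    X≤i : ∀ {c} → toℕ c ≤ 1 → X c ≤ i
    X≤i = mono-≤ x-increasing

    X>i : ∀ {c} → 2 ≤ toℕ c → i < X c
    X>i {c} 2≤c = subst (_≤ X c) x₃≡1+i (mono-≤ x-increasing {2F} {c} 2≤c)

    Y≤i : ∀ {c} → toℕ c ≤ 1 → Y c ≤ i
    Y≤i {c} c≤1 = subst (Y c ≤_) y₂≡i (mono-≤ y-increasing {c} {1F} c≤1)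

    Y>i : ∀ {c} → 2 ≤ toℕ c → i < Y c
    Y>i {c} 2≤c = subst (_≤ Y c) y₃≡1+i (mono-≤ y-increasing {2F} {c} 2≤c)

    wX : ∀ c → toℕ (w ⟨$⟩ʳ Vec.lookup x c) ≡ Y (p ⟨$⟩ʳ c)
    wX c = cong toℕ (values c)

  module _ (cj ck : Fin 4)
    (cj≤1 : toℕ cj ≤ 1) (2≤ck : 2 ≤ toℕ ck)
    (2≤pcj : 2 ≤ toℕ (p ⟨$⟩ʳ cj)) (pck≤1 : toℕ (p ⟨$⟩ʳ ck) ≤ 1)
    (low : cj ≡ 1F ⊎ p ⟨$⟩ʳ ck ≡ 1F) (high : ck ≡ 2F ⊎ p ⟨$⟩ʳ cj ≡ 2F) where

    private
      C : Crossing w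
      C = record
        { i = i ; j = Vec.lookup x cj ; k = Vec.lookup x ck
        ; j≤i = X≤i cj≤1
        ; i<k = X>i 2≤ck
        ; i<wj = subst (i <_) (sym (wX cj)) (Y>i 2≤pcj)
        ; wk≤i = subst (_≤ i) (sym (wX ck)) (Y≤i pck≤1)
        ; lowSide = Sum.map (cong X) (λ eq → trans (wX ck) (trans (cong Y eq) y₂≡i)) low
        ; highSide = Sum.map (λ eq → trans (cong X eq) x₃≡1+i)
                             (λ eq → trans (wX cj) (trans (cong Y eq) y₃≡1+i)) high
        }

    -- The quadrant starts at the lines `3F`, which are at `suc i` counted from 0. With its border
    -- it holds every point right of `i` with value at most `i`, and `ck` is the only point of the
    -- pattern there.
    half-crossing-> : (∀ c → 2 ≤ toℕ c → toℕ (p ⟨$⟩ʳ c) ≤ 1 → c ≡ ck) →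
                      LowerRight 3F 3F m → HalfCrossing w
    half-crossing-> unique quadrant = C , inj₂ λ z i<z z≢k → ℕₚ.≰⇒> λ wz≤i →
      let c , z≡ = lower-right 3F 3F quadrant z
            (≤-trans (≤-reflexive (trans (bordered-point x 2F) (cong suc x₃≡1+i))) (s≤s i<z))
            (≤-trans (s≤s (ℕₚ.m≤n⇒m≤1+n wz≤i)) (≤-reflexive (sym (trans (bordered-point y 2F) (cong suc y₃≡1+i)))))
      in z≢k (trans z≡ (cong (Vec.lookup x) (unique c
           (ℕₚ.≰⇒> λ c≤1 → ℕₚ.<⇒≱ i<z (subst (λ z → toℕ z ≤ i) (sym z≡) (X≤i c≤1)))
           (ℕₚ.≮⇒≥ λ 2≤pc → ℕₚ.<⇒≱ (Y>i 2≤pc)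
             (subst (_≤ i) (trans (cong (toℕ ∘ (w ⟨$⟩ʳ_)) z≡) (wX c)) wz≤i)))))

    half-crossing-≤ : (∀ c → toℕ c ≤ 1 → 2 ≤ toℕ (p ⟨$⟩ʳ c) → c ≡ cj) →
                      UpperLeft 3F 3F m → HalfCrossing w
    half-crossing-≤ unique quadrant = C , inj₁ λ z z≤i z≢j → ℕₚ.≮⇒≥ λ i<wz →
      let c , z≡ = upper-left 3F 3F quadrant z
            (≤-trans (s≤s (ℕₚ.m≤n⇒m≤1+n z≤i)) (≤-reflexive (sym (trans (bordered-point x 2F) (cong suc x₃≡1+i)))))
            (≤-trans (≤-reflexive (trans (bordered-point y 2F) (cong suc y₃≡1+i))) (s≤s i<wz))
      in z≢j (trans z≡ (cong (Vec.lookup x) (unique c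
           (ℕₚ.≮⇒≥ λ 2≤c → ℕₚ.<⇒≱ (X>i 2≤c) (subst (λ z → toℕ z ≤ i) z≡ z≤i))
           (ℕₚ.≰⇒> λ pc≤1 → ℕₚ.<⇒≱ i<wz
             (subst (_≤ i) (sym (trans (cong (toℕ ∘ (w ⟨$⟩ʳ_)) z≡) (wX c))) (Y≤i pc≤1))))))

calibration : ∀ {n} {w : Permutation′ n} {k p m} {a : Fin (2 + k)} {c} →
  (occ : Occurrence w (calibrated p m ((a , c) ∷ []) ((a , c) ∷ []))) →
  bordered (Occurrence.x occ) a ≡ bordered (Occurrence.y occ) a
calibration occ with Occurrence.x-calibrated occ | Occurrence.y-calibrated occ
... | x≡c ∷ [] | y≡c ∷ [] = ℤₚ.+-injective (trans x≡c (sym y≡c))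

-- The integer only ties a position line to a value line; the crossing reads its own `i` off the
-- points.
pattern-half-crossing : ∀ {n} {w : Permutation′ n} i → Any (w Contains_) (prismPatterns i) → HalfCrossing w
pattern-half-crossing i (here occ) =
  half-crossing-> (trans (calibrated-x₂y₂ (calibration occ)) (consecutive-y (row-in 1F)))
    (lower-right-in 2F 1F)
  where open Patterns21 occ
pattern-half-crossing i (there (here occ)) =
  half-crossing-≤ (trans (sym (calibrated-x₂y₂ (calibration occ))) (consecutive-x (column-in 1F)))
    (upper-left-in 1F 2F)
  where open Patterns21 occ
pattern-half-crossing i (there (there (here occ))) =
  half-crossing-≤ (trans (consecutive-y (row-in 1F)) (cong suc (sym (calibrated-x₁y₁ (calibration occ)))))
    (upper-left-in 1F 2F)
  where open Patterns21 occ
pattern-half-crossing i (there (there (there (here occ)))) =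
  half-crossing-> (trans (consecutive-x (column-in 1F)) (cong suc (calibrated-x₁y₁ (calibration occ))))
    (lower-right-in 2F 1F)
  where open Patterns21 occ
pattern-half-crossing i (there (there (there (there (here occ))))) =
  -- The first two arguments index `j` and `k`: the one point in the left half with a value in the
  -- upper half, and the one in the right half with a value in the lower half. In 4123 these are the
  -- entries 4 and 2.
  half-crossing-> 0F 2F z≤n (s≤s (s≤s z≤n)) (s≤s (s≤s z≤n)) (s≤s z≤n) (inj₂ refl) (inj₁ refl)
    (from-yes (Finₚ.all? λ c → (2 ℕₚ.≤? toℕ c) →-dec ((toℕ (4123ₚ ⟨$⟩ʳ c) ℕₚ.≤? 1) →-dec (c Finₚ.≟ 2F))))
    (lower-right-in 3F 3F)
  where open Patterns4 occ (row-in 2F) (column-in 2F) (calibration occ)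
pattern-half-crossing i (there (there (there (there (there (here occ)))))) =
  half-crossing-≤ 1F 3F (s≤s z≤n) (s≤s (s≤s z≤n)) (s≤s (s≤s z≤n)) z≤n (inj₁ refl) (inj₂ refl)
    (from-yes (Finₚ.all? λ c → (toℕ c ℕₚ.≤? 1) →-dec ((2 ℕₚ.≤? toℕ (2341ₚ ⟨$⟩ʳ c)) →-dec (c Finₚ.≟ 1F))))
    (upper-left-in 3F 3F)
  where open Patterns4 occ (row-in 2F) (column-in 2F) (calibration occ)
pattern-half-crossing i (there (there (there (there (there (there (here occ))))))) =
  half-crossing-≤ 0F 3F z≤n (s≤s (s≤s z≤n)) (s≤s (s≤s z≤n)) (s≤s z≤n) (inj₂ refl) (inj₂ refl)
    (from-yes (Finₚ.all? λ c → (toℕ c ℕₚ.≤? 1) →-dec ((2 ℕₚ.≤? toℕ (3142ₚ ⟨$⟩ʳ c)) →-dec (c Finₚ.≟ 0F))))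
    (upper-left-in 3F 3F)
  where open Patterns4 occ (row-in 2F) (column-in 2F) (calibration occ)
pattern-half-crossing i (there (there (there (there (there (there (there (here occ)))))))) =
  half-crossing-≤ 1F 2F (s≤s z≤n) (s≤s (s≤s z≤n)) (s≤s (s≤s z≤n)) z≤n (inj₁ refl) (inj₁ refl)
    (from-yes (Finₚ.all? λ c → (toℕ c ℕₚ.≤? 1) →-dec ((2 ℕₚ.≤? toℕ (2413ₚ ⟨$⟩ʳ c)) →-dec (c Finₚ.≟ 1F))))
    (upper-left-in 3F 3F)
  where open Patterns4 occ (row-in 2F) (column-in 2F) (calibration occ)

-- From a crossing to a pattern

build-occurrence : ∀ {n} {w : Permutation′ n} {k} {p : Permutation′ k} {m cX cY} (x y : Vec (Fin n) k) →
  Linked Fin._<_ x → Linked Fin._<_ y →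
  (∀ c → w ⟨$⟩ʳ Vec.lookup x c ≡ Vec.lookup y (p ⟨$⟩ʳ c)) →
  (∀ a b → (a , b) ∈ m → ∀ z → Between x a z → ¬ Between y b (w ⟨$⟩ʳ z)) →
  All (λ (a , c) → ℤ.+ bordered x a ≡ c) cX → All (λ (b , c) → ℤ.+ bordered y b ≡ c) cY →
  Occurrence w (calibrated p m cX cY)
build-occurrence {w = w} {p = p} x y x↗ y↗ values empty calX calY = record
  { x = x ; y = y ; x-increasing = x↗ ; y-increasing = y↗
  ; same-order = λ i j → mk⇔
      (λ pi<pj → subst₂ Fin._<_ (sym (values i)) (sym (values j)) (lookup-mono-< y↗ pi<pj))
      (λ wi<wj → ℕₚ.≰⇒> λ pj≤pi → ℕₚ.<⇒≱ (subst₂ Fin._<_ (values i) (values j) wi<wj)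
        (y-mono-≤ pj≤pi))
  ; y-values = λ v → mk⇔
      (λ v∈y → let c , eq = ∈⇒lookup v∈y in
        subst (Vec∈._∈ Vec.map (w ⟨$⟩ʳ_) x)
          (trans (values (p ⟨$⟩ˡ c)) (trans (cong (Vec.lookup y) (Perm.inverseʳ p)) (sym eq)))
          (∈-map⁺ (w ⟨$⟩ʳ_) (∈-lookup (p ⟨$⟩ˡ c) x)))
      (λ v∈wx → let c , eq = ∈⇒lookup v∈wx in
        subst (Vec∈._∈ y) (sym (trans eq (trans (lookup-map c (w ⟨$⟩ʳ_) x) (values c))))
          (∈-lookup (p ⟨$⟩ʳ c) y))
  ; mesh-empty = All.tabulate λ { {a , b} ab∈m (z , in-x , in-y) → empty a b ab∈m z in-x in-y }
  ; x-calibrated = calX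
  ; y-calibrated = calY
  }
  where
  y-mono-≤ : ∀ {a b} → a Fin.≤ b → Vec.lookup y a Fin.≤ Vec.lookup y b
  y-mono-≤ a≤b with ℕₚ.m≤n⇒m<n∨m≡n a≤b
  ... | inj₁ a<b = ℕₚ.<⇒≤ (lookup-mono-< y↗ a<b)
  ... | inj₂ a≡b = ≤-reflexive (cong (toℕ ∘ Vec.lookup y) (Finₚ.toℕ-injective a≡b))

module CrossingPatterns {n} {w : Permutation′ n} (C : Crossing w)
  (rest≤ : Crossing.Rest≤ C) (rest> : Crossing.Rest> C) where
  open Crossing C

  private
    wʳ wˡ : Fin n → Fin n
    wʳ = w ⟨$⟩ʳ_
    wˡ = w ⟨$⟩ˡ_

    w-injective : ∀ {a b} → wʳ a ≡ wʳ b → a ≡ b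
    w-injective eq = trans (sym (Perm.inverseˡ w)) (trans (cong wˡ eq) (Perm.inverseˡ w))

    k≢j : k ≢ j
    k≢j refl = ℕₚ.<⇒≱ i<k j≤i

    -- A point in such a cell lies right of `i` with value at most `i`, so `rest>` makes it `k`,
    -- which is itself a point of the occurrence. Cells are open, so counted from 0 the line `A` may
    -- be at `i` or beyond and the line `B` at `suc i` or before.
    lower-right-empty : ∀ {l} {x y : Vec (Fin n) l} → Linked Fin._<_ x → Linked Fin._<_ y →
      ∀ c → Vec.lookup x c ≡ k → ∀ A B → suc i ≤ bordered x A → bordered y B ≤ suc (suc i) →
      ∀ {a b} → toℕ A ≤ toℕ a → toℕ b < toℕ B → ∀ z → Between x a z → ¬ Between y b (wʳ z)
    lower-right-empty {x = x} {y} x↗ y↗ c refl A B i<A B≤i {a} {b} A≤a b<B z z-in wz-in =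
      ℕₚ.<⇒≱ (rest> z i<z λ { refl → point-not-between x↗ a c z-in }) wz≤i
      where
      i<z : i < toℕ z
      i<z = ℕₚ.≤-pred (ℕₚ.≤-<-trans (≤-trans i<A (bordered-mono-≤ x↗ {A} {inject₁ a}
        (subst (toℕ A ≤_) (sym (Finₚ.toℕ-inject₁ a)) A≤a))) (proj₁ z-in))
      wz≤i : toℕ (wʳ z) ≤ i
      wz≤i = ℕₚ.≤-pred (ℕₚ.≤-pred (ℕₚ.<-≤-trans (proj₂ wz-in)
        (≤-trans (bordered-mono-≤ y↗ {suc b} {B} b<B) B≤i)))

    upper-left-empty : ∀ {l} {x y : Vec (Fin n) l} → Linked Fin._<_ x → Linked Fin._<_ y →
      ∀ c → Vec.lookup x c ≡ j → ∀ A B → bordered x A ≤ suc (suc i) → suc i ≤ bordered y B →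
      ∀ {a b} → toℕ a < toℕ A → toℕ B ≤ toℕ b → ∀ z → Between x a z → ¬ Between y b (wʳ z)
    upper-left-empty {x = x} {y} x↗ y↗ c refl A B A≤i i<B {a} {b} a<A B≤b z z-in wz-in =
      ℕₚ.<⇒≱ i<wz (rest≤ z z≤i λ { refl → point-not-between x↗ a c z-in })
      where
      z≤i : toℕ z ≤ i
      z≤i = ℕₚ.≤-pred (ℕₚ.≤-pred (ℕₚ.<-≤-trans (proj₂ z-in)
        (≤-trans (bordered-mono-≤ x↗ {suc a} {A} a<A) A≤i)))
      i<wz : i < toℕ (wʳ z)
      i<wz = ℕₚ.≤-pred (ℕₚ.≤-<-trans (≤-trans i<B (bordered-mono-≤ y↗ {B} {inject₁ b}
        (subst (toℕ B ≤_) (sym (Finₚ.toℕ-inject₁ b)) B≤b))) (proj₁ wz-in))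

  -- The patterns count from 1, the crossing from 0.
  iℤ : ℤ
  iℤ = ℤ.+ suc i

  private
    cal-i : ∀ {t : Fin n} → toℕ t ≡ i → ℤ.+ suc (toℕ t) ≡ iℤ
    cal-i eq = cong (ℤ.+_ ∘ suc) eq

    cal-1+i : ∀ {t : Fin n} → toℕ t ≡ suc i → ℤ.+ suc (toℕ t) ≡ iℤ ℤ.+ 1ℤ
    cal-1+i eq = cong (ℤ.+_ ∘ suc) (trans eq (sym (ℕₚ.+-comm i 1)))

    x₂₁ y₂₁ : Vec (Fin n) 2
    x₂₁ = j ∷ k ∷ []
    y₂₁ = wʳ k ∷ wʳ j ∷ []

    x₂₁↗ : Linked Fin._<_ x₂₁
    x₂₁↗ = ℕₚ.≤-<-trans j≤i i<k ∷ [-]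

    y₂₁↗ : Linked Fin._<_ y₂₁
    y₂₁↗ = ℕₚ.≤-<-trans wk≤i i<wj ∷ [-]

    values₂₁ : ∀ c → wʳ (Vec.lookup x₂₁ c) ≡ Vec.lookup y₂₁ (21ₚ ⟨$⟩ʳ c)
    values₂₁ 0F = refl
    values₂₁ 1F = refl

    row₂₁ : toℕ (wʳ k) ≡ i → toℕ (wʳ j) ≡ suc i → ∀ {v} → ¬ Between y₂₁ 1F v
    row₂₁ wk≡ wj≡ = consecutive⇒empty {z = y₂₁} {1F} (s≤s (≤-reflexive (trans wj≡ (cong suc (sym wk≡)))))

    column₂₁ : toℕ j ≡ i → toℕ k ≡ suc i → ∀ {v} → ¬ Between x₂₁ 1F v
    column₂₁ j≡ k≡ = consecutive⇒empty {z = x₂₁} {1F} (s≤s (≤-reflexive (trans k≡ (cong suc (sym j≡)))))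

    lower-right₂₁ : ∀ z → Between x₂₁ 2F z → ¬ Between y₂₁ 0F (wʳ z)
    lower-right₂₁ = lower-right-empty x₂₁↗ y₂₁↗ 1F refl 2F 1F (ℕₚ.m≤n⇒m≤1+n i<k)
      (s≤s (ℕₚ.m≤n⇒m≤1+n wk≤i)) ≤-refl ≤-refl

    upper-left₂₁ : ∀ z → Between x₂₁ 0F z → ¬ Between y₂₁ 2F (wʳ z)
    upper-left₂₁ = upper-left-empty x₂₁↗ y₂₁↗ 0F refl 1F 2F (s≤s (ℕₚ.m≤n⇒m≤1+n j≤i))
      (ℕₚ.m≤n⇒m≤1+n i<wj) ≤-refl ≤-refl

  pattern₁ : toℕ (wʳ k) ≡ i → toℕ (wʳ j) ≡ suc i → toℕ k ≡ suc i → ∃ λ i → Any (w Contains_) (prismPatterns i)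
  pattern₁ wk≡ wj≡ k≡ = iℤ , here (build-occurrence x₂₁ y₂₁ x₂₁↗ y₂₁↗ values₂₁
    (λ { _ _ (here refl) _ _ → row₂₁ wk≡ wj≡
       ; _ _ (there (here refl)) _ _ → row₂₁ wk≡ wj≡
       ; _ _ (there (there (here refl))) _ _ → row₂₁ wk≡ wj≡
       ; _ _ (there (there (there (here refl)))) → lower-right₂₁ })
    (cal-1+i k≡ ∷ []) (cal-1+i wj≡ ∷ []))

  pattern₂ : toℕ j ≡ i → toℕ k ≡ suc i → toℕ (wʳ j) ≡ suc i → ∃ λ i → Any (w Contains_) (prismPatterns i)
  pattern₂ j≡ k≡ wj≡ = iℤ , there (here (build-occurrence x₂₁ y₂₁ x₂₁↗ y₂₁↗ values₂₁
    (λ { _ _ (here refl) _ z-in → contradiction z-in (column₂₁ j≡ k≡)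
       ; _ _ (there (here refl)) _ z-in → contradiction z-in (column₂₁ j≡ k≡)
       ; _ _ (there (there (here refl))) _ z-in → contradiction z-in (column₂₁ j≡ k≡)
       ; _ _ (there (there (there (here refl)))) → upper-left₂₁ })
    (cal-1+i k≡ ∷ []) (cal-1+i wj≡ ∷ [])))

  pattern₃ : toℕ (wʳ k) ≡ i → toℕ (wʳ j) ≡ suc i → toℕ j ≡ i → ∃ λ i → Any (w Contains_) (prismPatterns i)
  pattern₃ wk≡ wj≡ j≡ = iℤ , there (there (here (build-occurrence x₂₁ y₂₁ x₂₁↗ y₂₁↗ values₂₁
    (λ { _ _ (here refl) _ _ → row₂₁ wk≡ wj≡
       ; _ _ (there (here refl)) _ _ → row₂₁ wk≡ wj≡
       ; _ _ (there (there (here refl))) _ _ → row₂₁ wk≡ wj≡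
       ; _ _ (there (there (there (here refl)))) → upper-left₂₁ })
    (cal-i j≡ ∷ []) (cal-i wk≡ ∷ []))))

  pattern₄ : toℕ j ≡ i → toℕ k ≡ suc i → toℕ (wʳ k) ≡ i → ∃ λ i → Any (w Contains_) (prismPatterns i)
  pattern₄ j≡ k≡ wk≡ = iℤ , there (there (there (here (build-occurrence x₂₁ y₂₁ x₂₁↗ y₂₁↗ values₂₁
    (λ { _ _ (here refl) _ z-in → contradiction z-in (column₂₁ j≡ k≡)
       ; _ _ (there (here refl)) _ z-in → contradiction z-in (column₂₁ j≡ k≡)
       ; _ _ (there (there (here refl))) _ z-in → contradiction z-in (column₂₁ j≡ k≡)
       ; _ _ (there (there (there (here refl)))) → lower-right₂₁ })
    (cal-i j≡ ∷ []) (cal-i wk≡ ∷ [])))))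

  private
    i<n : i < n
    i<n = ℕₚ.<-trans i<k (Finₚ.toℕ<n k)

    1+i<n : suc i < n
    1+i<n = ℕₚ.≤-<-trans i<k (Finₚ.toℕ<n k)

    I I⁺ : Fin n
    I  = Fin.fromℕ< i<n
    I⁺ = Fin.fromℕ< 1+i<n

    toℕ-I : toℕ I ≡ i
    toℕ-I = Finₚ.toℕ-fromℕ< i<n

    toℕ-I⁺ : toℕ I⁺ ≡ suc i
    toℕ-I⁺ = Finₚ.toℕ-fromℕ< 1+i<n

    is-I : ∀ {t : Fin n} → toℕ t ≡ i → t ≡ I
    is-I eq = Finₚ.toℕ-injective (trans eq (sym toℕ-I))

    is-I⁺ : ∀ {t : Fin n} → toℕ t ≡ suc i → t ≡ I⁺
    is-I⁺ eq = Finₚ.toℕ-injective (trans eq (sym toℕ-I⁺))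

    -- The cells of the meshes of patterns (5)–(8).
    RUD : Fin 5 → Fin 5 → Set
    RUD a b = (a ≡ 2F ⊎ b ≡ 2F) ⊎ (toℕ a < 3 × 3 ≤ toℕ b) ⊎ (3 ≤ toℕ a × toℕ b < 3)

    RUD? : ∀ (m : List (Fin 5 × Fin 5)) → Dec (All (λ (a , b) → RUD a b) m)
    RUD? = All.all? λ (a , b) → (a Finₚ.≟ 2F ⊎-dec b Finₚ.≟ 2F) ⊎-dec
      ((toℕ a ℕₚ.<? 3 ×-dec 3 ℕₚ.≤? toℕ b) ⊎-dec (3 ℕₚ.≤? toℕ a ×-dec toℕ b ℕₚ.<? 3))

    -- The calibration and the empty middle row and column fix the middle positions and values at
    -- `I` and `I⁺`; only the outer ones vary among the patterns of length four.
    Values : Permutation′ 4 → (x₁ x₄ y₁ y₄ : Fin n) → Set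
    Values p x₁ x₄ y₁ y₄ = ∀ c →
      wʳ (Vec.lookup (x₁ ∷ I ∷ I⁺ ∷ x₄ ∷ []) c) ≡ Vec.lookup (y₁ ∷ I ∷ I⁺ ∷ y₄ ∷ []) (p ⟨$⟩ʳ c)

    module Four (p : Permutation′ 4) (x₁ x₄ y₁ y₄ : Fin n)
      (x₁<i : toℕ x₁ < i) (i<x₄ : suc i < toℕ x₄) (y₁<i : toℕ y₁ < i) (i<y₄ : suc i < toℕ y₄)
      (values : Values p x₁ x₄ y₁ y₄)
      (cj ck : Fin 4) (j-at : Vec.lookup (x₁ ∷ I ∷ I⁺ ∷ x₄ ∷ []) cj ≡ j)
      (k-at : Vec.lookup (x₁ ∷ I ∷ I⁺ ∷ x₄ ∷ []) ck ≡ k) where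

      increasing : ∀ {t u} → toℕ t < i → suc i < toℕ u → Linked Fin._<_ (t ∷ I ∷ I⁺ ∷ u ∷ [])
      increasing {t} {u} t<i i<u =
        subst (toℕ t <_) (sym toℕ-I) t<i ∷
        subst₂ _<_ (sym toℕ-I) (sym toℕ-I⁺) ≤-refl ∷
        subst (_< toℕ u) (sym toℕ-I⁺) i<u ∷ [-]

      x y : Vec (Fin n) 4
      x = x₁ ∷ I ∷ I⁺ ∷ x₄ ∷ []
      y = y₁ ∷ I ∷ I⁺ ∷ y₄ ∷ []

      x↗ = increasing x₁<i i<x₄
      y↗ = increasing y₁<i i<y₄

      empty : ∀ a b → RUD a b → ∀ z → Between x a z → ¬ Between y b (wʳ z)
      empty a b (inj₁ (inj₁ refl)) z z-in _ = consecutive⇒empty {z = x} {2F}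
        (s≤s (≤-reflexive (trans toℕ-I⁺ (cong suc (sym toℕ-I))))) z-in
      empty a b (inj₁ (inj₂ refl)) z _ = consecutive⇒empty {z = y} {2F}
        (s≤s (≤-reflexive (trans toℕ-I⁺ (cong suc (sym toℕ-I)))))
      empty a b (inj₂ (inj₁ (a<3 , 3≤b))) = upper-left-empty x↗ y↗ cj j-at 3F 3F
        (s≤s (≤-reflexive toℕ-I⁺)) (≤-trans (ℕₚ.n≤1+n _) (s≤s (≤-reflexive (sym toℕ-I⁺)))) a<3 3≤b
      empty a b (inj₂ (inj₂ (3≤a , b<3))) = lower-right-empty x↗ y↗ ck k-at 3F 3F
        (≤-trans (ℕₚ.n≤1+n _) (s≤s (≤-reflexive (sym toℕ-I⁺)))) (s≤s (≤-reflexive toℕ-I⁺)) 3≤a b<3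

      occurrence : ∀ m → True (RUD? m) →
        Occurrence w (calibrated p m ((2F , iℤ) ∷ []) ((2F , iℤ) ∷ []))
      occurrence m m⊆RUD = build-occurrence x y x↗ y↗ values
        (λ a b ab∈m → empty a b (All.lookup (toWitness m⊆RUD) ab∈m))
        (cal-i toℕ-I ∷ []) (cal-i toℕ-I ∷ [])

    -- Supplies the first point of patterns (6) and (8): only `k` brings a value down from the right
    -- of `i`, and `j` sits at `i` itself, so the value `i` stems from further left.
    position-of-i : toℕ j ≡ i → toℕ (wʳ k) ≢ i → toℕ (wˡ I) < i
    position-of-i j≡ wk≢ = ℕₚ.≤∧≢⇒<
      (ℕₚ.≮⇒≥ λ i<z → ℕₚ.<⇒≱ (rest> z i<z λ { z≡k → wk≢ (trans (cong (toℕ ∘ wʳ) (sym z≡k)) wz≡) })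
        (≤-reflexive wz≡))
      λ z≡ → ℕₚ.<⇒≢ i<wj (sym (trans (cong (toℕ ∘ wʳ) (Finₚ.toℕ-injective (trans j≡ (sym z≡)))) wz≡))
      where
      z = wˡ I
      wz≡ : toℕ (wʳ z) ≡ i
      wz≡ = trans (cong toℕ (Perm.inverseʳ w)) toℕ-I

    position-of-1+i : toℕ k ≡ suc i → toℕ (wʳ j) ≢ suc i → suc i < toℕ (wˡ I⁺)
    position-of-1+i k≡ wj≢ = ℕₚ.≤∧≢⇒<
      (ℕₚ.≰⇒> λ z≤i → ℕₚ.<⇒≱ (≤-reflexive (sym wz≡))
        (rest≤ z z≤i λ { z≡j → wj≢ (trans (cong (toℕ ∘ wʳ) (sym z≡j)) wz≡) }))
      λ z≡ → ℕₚ.<⇒≱ (≤-reflexive (sym wz≡))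
        (subst (λ t → toℕ (wʳ t) ≤ i) (Finₚ.toℕ-injective (trans k≡ z≡)) wk≤i)
      where
      z = wˡ I⁺
      wz≡ : toℕ (wʳ z) ≡ suc i
      wz≡ = trans (cong toℕ (Perm.inverseʳ w)) toℕ-I⁺

    -- Supplies the lowest value of patterns (5) and (7): among the positions up to `i` only `j` has
    -- a value above `i`, and the value `i` is already taken at `k`.
    value-at-i : toℕ j ≢ i → toℕ (wʳ k) ≡ i → toℕ (wʳ I) < i
    value-at-i j≢ wk≡ = ℕₚ.≤∧≢⇒<
      (rest≤ I (≤-reflexive toℕ-I) λ { refl → j≢ toℕ-I })
      λ wI≡ → ℕₚ.<⇒≱ i<k (≤-trans (≤-reflexive (cong toℕ
        (w-injective (Finₚ.toℕ-injective (trans wk≡ (sym wI≡)))))) (≤-reflexive toℕ-I))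

    value-at-1+i : toℕ k ≢ suc i → toℕ (wʳ j) ≡ suc i → suc i < toℕ (wʳ I⁺)
    value-at-1+i k≢ wj≡ = ℕₚ.≤∧≢⇒<
      (rest> I⁺ (≤-reflexive (sym toℕ-I⁺)) λ { I⁺≡k → k≢ (trans (cong toℕ (sym I⁺≡k)) toℕ-I⁺) })
      λ wI⁺≡ → ℕₚ.<⇒≱ (≤-reflexive (sym (trans (cong toℕ
        (w-injective (Finₚ.toℕ-injective (trans wj≡ wI⁺≡)))) toℕ-I⁺))) j≤i

  pattern₅ : toℕ j ≢ i → toℕ (wʳ k) ≡ i → toℕ k ≡ suc i → toℕ (wʳ j) ≢ suc i →
             ∃ λ i → Any (w Contains_) (prismPatterns i)
  pattern₅ j≢ wk≡ k≡ wj≢ = iℤ , there (there (there (there (here (occurrence (R ++ D) _)))))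
    where
    values₅ : Values 4123ₚ j (wˡ I⁺) (wʳ I) (wʳ j)
    values₅ 0F = refl
    values₅ 1F = refl
    values₅ 2F = trans (cong wʳ (sym (is-I⁺ k≡))) (is-I wk≡)
    values₅ 3F = Perm.inverseʳ w

    open Four 4123ₚ j (wˡ I⁺) (wʳ I) (wʳ j)
      (ℕₚ.≤∧≢⇒< j≤i j≢) (position-of-1+i k≡ wj≢) (value-at-i j≢ wk≡) (ℕₚ.≤∧≢⇒< i<wj (wj≢ ∘ sym))
      values₅
      0F 2F refl (sym (is-I⁺ k≡))

  pattern₆ : toℕ j ≡ i → toℕ (wʳ k) ≢ i → toℕ k ≢ suc i → toℕ (wʳ j) ≡ suc i →
             ∃ λ i → Any (w Contains_) (prismPatterns i)
  pattern₆ j≡ wk≢ k≢ wj≡ = iℤ , there (there (there (there (there (here (occurrence (R ++ U) _))))))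
    where
    values₆ : Values 2341ₚ (wˡ I) k (wʳ k) (wʳ I⁺)
    values₆ 0F = Perm.inverseʳ w
    values₆ 1F = trans (cong wʳ (sym (is-I j≡))) (is-I⁺ wj≡)
    values₆ 2F = refl
    values₆ 3F = refl

    open Four 2341ₚ (wˡ I) k (wʳ k) (wʳ I⁺)
      (position-of-i j≡ wk≢) (ℕₚ.≤∧≢⇒< i<k (k≢ ∘ sym)) (ℕₚ.≤∧≢⇒< wk≤i wk≢) (value-at-1+i k≢ wj≡)
      values₆
      1F 3F (sym (is-I j≡)) refl

  pattern₇ : toℕ j ≢ i → toℕ (wʳ k) ≡ i → toℕ k ≢ suc i → toℕ (wʳ j) ≡ suc i →
             ∃ λ i → Any (w Contains_) (prismPatterns i)
  pattern₇ j≢ wk≡ k≢ wj≡ = iℤ , there (there (there (there (there (there (here (occurrence (R ++ U ++ D) _)))))))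
    where
    values₇ : Values 3142ₚ j k (wʳ I) (wʳ I⁺)
    values₇ 0F = is-I⁺ wj≡
    values₇ 1F = refl
    values₇ 2F = refl
    values₇ 3F = is-I wk≡

    open Four 3142ₚ j k (wʳ I) (wʳ I⁺)
      (ℕₚ.≤∧≢⇒< j≤i j≢) (ℕₚ.≤∧≢⇒< i<k (k≢ ∘ sym)) (value-at-i j≢ wk≡) (value-at-1+i k≢ wj≡)
      values₇
      0F 3F refl refl

  pattern₈ : toℕ j ≡ i → toℕ (wʳ k) ≢ i → toℕ k ≡ suc i → toℕ (wʳ j) ≢ suc i →
             ∃ λ i → Any (w Contains_) (prismPatterns i)
  pattern₈ j≡ wk≢ k≡ wj≢ =
    iℤ , there (there (there (there (there (there (there (here (occurrence (R ++ U ++ D) _))))))))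
    where
    values₈ : Values 2413ₚ (wˡ I) (wˡ I⁺) (wʳ k) (wʳ j)
    values₈ 0F = Perm.inverseʳ w
    values₈ 1F = cong wʳ (sym (is-I j≡))
    values₈ 2F = cong wʳ (sym (is-I⁺ k≡))
    values₈ 3F = Perm.inverseʳ w

    open Four 2413ₚ (wˡ I) (wˡ I⁺) (wʳ k) (wʳ j)
      (position-of-i j≡ wk≢) (position-of-1+i k≡ wj≢) (ℕₚ.≤∧≢⇒< wk≤i wk≢) (ℕₚ.≤∧≢⇒< i<wj (wj≢ ∘ sym))
      values₈
      1F 2F (sym (is-I j≡)) (sym (is-I⁺ k≡))

  -- When at least three of the four equations hold, `j` and `k` alone form an occurrence of 21.
  -- When exactly two hold, there is one from each side condition, and the four combinations are the
  -- patterns of length four.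
  contains-pattern : ∃ λ i → Any (w Contains_) (prismPatterns i)
  contains-pattern
    with toℕ j ℕₚ.≟ i | toℕ (wʳ k) ℕₚ.≟ i | toℕ k ℕₚ.≟ suc i | toℕ (wʳ j) ℕₚ.≟ suc i
  ... | yes j≡ | yes wk≡ | yes k≡ | _       = pattern₄ j≡ k≡ wk≡
  ... | yes j≡ | yes wk≡ | no _   | yes wj≡ = pattern₃ wk≡ wj≡ j≡
  ... | yes j≡ | no _    | yes k≡ | yes wj≡ = pattern₂ j≡ k≡ wj≡
  ... | no _   | yes wk≡ | yes k≡ | yes wj≡ = pattern₁ wk≡ wj≡ k≡
  ... | no j≢  | yes wk≡ | yes k≡ | no wj≢  = pattern₅ j≢ wk≡ k≡ wj≢
  ... | yes j≡ | no wk≢  | no k≢  | yes wj≡ = pattern₆ j≡ wk≢ k≢ wj≡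
  ... | no j≢  | yes wk≡ | no k≢  | yes wj≡ = pattern₇ j≢ wk≡ k≢ wj≡
  ... | yes j≡ | no wk≢  | yes k≡ | no wj≢  = pattern₈ j≡ wk≢ k≡ wj≢
  ... | no j≢  | no wk≢  | _      | _       = contradiction lowSide [ j≢ , wk≢ ]′
  ... | _      | _       | no k≢  | no wj≢  = contradiction highSide [ k≢ , wj≢ ]′

theorem3p7 : ∀ (n : ℕ) (w : Permutation′ n) →
    IsPrism w ⇔ (∃ λ (i : ℤ) → Any (w Contains_) (prismPatterns i))
theorem3p7 n w = mk⇔
  (λ prism → let C , rest≤ , rest> = prism⇒crossing prism
             in CrossingPatterns.contains-pattern C rest≤ rest>)
  (λ (i , occ) → let C , rest = pattern-half-crossing i occ in crossing⇒prism C rest)
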